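{- There exist absolute constants $c>0$ and $\beta>0$ such that for all integers $n,m\ge1$ and all functions $f_1,f_2,\dots,f_n:\{ -1,+1\}^m\to\{ -1,+1\}$, each of the following tasks requires at least $$c\min_{S\subseteq\{1,\dots,n\},\ |S|=\lceil0.99n\rceil}\left\{\sum_{i\in S}\deg_{1/5}(f_i)\right\}$$ quantum queries: (i) solving $f_1\otimes\cdots\otimes f_n$ with worst-case probability at least $1/2+2^{ -cn}$ (i.e., on every input the output is correct with probability at least $1/2+2^{ -cn}$); (ii) solving $(f_1,\dots,f_n)$ with worst-case probability at least $2^{ -cn}$ (i.e., on every input $(x_1,\dots,x_n)$ the algorithm outputs the vector $(f_1(x_1),\dots,f_n(x_n))$ with probability at least $2^{ -cn}$); (iii) solving with worst-case probability at least $2^{ -cn}$ at least $(1-\beta)n$ among the $n$ instances (i.e., on every input $(x_1,\dots,x_n)$ the algorithm outputs, with probability at least $2^{ -cn}$, a vector $z\in\{ -1,+1\}^n$ with $z_i=f_i(x_i)$ for at least $(1-\beta)n$ indices $i$).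
   Context: $f_1\otimes\cdots\otimes f_n:(\{ -1,+1\}^m)^n\to\{ -1,+1\}$ is given by $(x_1,\dots,x_n)\mapsto\prod_{i=1}^n f_i(x_i)$ (the XOR of the $f_i$ on independent inputs). For $f:\{ -1,+1\}^m\to\{ -1,+1\}$, $\deg_\epsilon(f)$ is the least degree of a real polynomial $p$ with $|f(x)-p(x)|\le\epsilon$ for all $x\in\{ -1,+1\}^m$. A quantum query algorithm with $T$ queries on unknown input $x\in\{ -1,+1\}^N$ starts in a fixed state, applies $U_TO_xU_{T-1}O_x\cdots U_1O_xU_0$, where the $U_j$ are input-independent unitaries and $O_x$ is the input oracle (mapping $|i,b,w\rangle$ to $|i,b\oplus b_i,w\rangle$ with $b_i=1$ if $x_i=-1$ and $b_i=0$ if $x_i=+1$), and outputs the result of a measurement. Its cost is the number $T$ of queries. Here the input is $(x_1,\dots,x_n)\in(\{ -1,+1\}^m)^n$, so $N=nm$. -}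

module Defs where

open import Level using (0ℓ)
open import Algebra.Apartness.Bundles using (HeytingField)
open import Algebra.Bundles using (CommutativeRing; RawMonoid; Semiring)
open import Algebra.Definitions.RawMonoid using () renaming (sum to monoidSum)
open import Data.Bool.Base using (Bool; true; false; if_then_else_; _xor_)
open import Data.Empty using (⊥-elim)
open import Data.Fin.Base using (Fin; zero; suc)
open import Data.Fin.Subset using (Subset; ∣_∣; _∈_)
open import Data.List.Base using (List; foldr)
open import Data.List.Relation.Unary.All using (All)
open import Data.Nat.Base as ℕ using (ℕ; zero; suc; NonZero)
open import Data.Product.Base using (Σ-syntax; ∃-syntax; _×_; _,_; proj₁; proj₂)
open import Data.Product.Properties using (≡-dec)
open import Data.Sign.Base as Sign using (Sign)
open import Data.Sum.Base using (_⊎_; inj₁; inj₂)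
open import Data.Vec.Base as Vec using (Vec; []; _∷_; lookup; tabulate; allFin; count)
open import Function.Base using (_∘_)
open import Relation.Binary.Core using (Rel)
open import Relation.Binary.Definitions using (DecidableEquality)
open import Relation.Binary.PropositionalEquality.Core using (_≡_)
open import Relation.Binary.Structures using (IsStrictPartialOrder)
open import Relation.Nullary.Decidable.Core using (does)
open import Relation.Nullary.Negation.Core using (¬_)
import Algebra.Properties.Ring as RingProperties
import Data.Bool.Properties as Bool
import Data.Fin.Properties as Fin
import Data.Nat.Properties as ℕ
import Data.Sign.Properties as Sign

-- The least element of a set of natural numbers, as a relation.
IsLeast : (ℕ → Set) → ℕ → Set
IsLeast P k = P k × (∀ j → P j → k ℕ.≤ j)

sumOver : ∀ {n} (M : RawMonoid 0ℓ 0ℓ) → Subset n → (Fin n → RawMonoid.Carrier M) → RawMonoid.Carrier M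
sumOver M S g = monoidSum M (λ i → if lookup S i then g i else RawMonoid.ε M)

-- k is the minimum of Σ_{i ∈ S} d i over all S ⊆ {1,…,n} with |S| = s.
IsMinSubsetSum : ∀ {n} → ℕ → (Fin n → ℕ) → ℕ → Set
IsMinSubsetSum {n} s d =
  IsLeast (λ k → Σ[ S ∈ Subset n ] ∣ S ∣ ≡ s × k ≡ sumOver ℕ.+-0-rawMonoid S d)

-- ⌈0.99 n⌉
⌈0·99_⌉ : ℕ → ℕ
⌈0·99 n ⌉ = (99 ℕ.* n ℕ.+ 99) ℕ./ 100

------------------------------------------------------------------------
-- Boolean functions on the cube {-1,+1}^m

BoolFun : ℕ → Set
BoolFun m = Vec Sign m → Sign

values : ∀ {n m} → (Fin n → BoolFun m) → Vec (Vec Sign m) n → Vec Sign n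
values f xs = tabulate (λ i → f i (lookup xs i))

⨂ : ∀ {n m} → (Fin n → BoolFun m) → Vec (Vec Sign m) n → Sign
⨂ f xs = monoidSum Sign.*-1-rawMonoid (λ i → f i (lookup xs i))

agreements : ∀ {n} → Vec Sign n → Vec Sign n → ℕ
agreements {n} y z = count (λ i → lookup y i Sign.≟ lookup z i) (allFin n)

module FieldNotions (F : HeytingField 0ℓ 0ℓ 0ℓ) where

  open HeytingField F

  commutativeRing : CommutativeRing 0ℓ 0ℓ
  commutativeRing = record { isCommutativeRing = isCommutativeRing }

  open CommutativeRing commutativeRing public
    using (+-rawMonoid; semiring)
  open import Algebra.Definitions.RawMonoid +-rawMonoid public
    using (sum) renaming (_×_ to _·ℕ_)
  open import Algebra.Definitions.RawSemiring (Semiring.rawSemiring semiring) public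
    using (_^_)

  fromℕ : ℕ → Carrier
  fromℕ n = n ·ℕ 1#

------------------------------------------------------------------------
-- The real numbers, axiomatised as a Cauchy-complete Archimedean ordered
-- field.  Classically these axioms determine ℝ up to isomorphism.  They
-- assume no decidability of the order, so that x ≤ y means ¬ (y < x).

record Reals : Set₁ where
  field
    heytingField : HeytingField 0ℓ 0ℓ 0ℓ

  open HeytingField heytingField public

  open FieldNotions heytingField public

  infix 4 _<_ _≤_

  field
    _<_                  : Rel Carrier 0ℓ
    isStrictPartialOrder : IsStrictPartialOrder _≈_ _<_
    <⇒#                  : ∀ {x y} → x < y → x # y
    #⇒<⊎>                : ∀ {x y} → x # y → x < y ⊎ y < x
    +-monoˡ-<            : ∀ z {x y} → x < y → x + z < y + z
    *-pos                : ∀ {x y} → 0# < x → 0# < y → 0# < x * y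
    archimedean          : ∀ x → ∃[ n ] x < fromℕ n
    complete             : (s : ℕ → Carrier) →
      (∀ ε → 0# < ε → ∃[ k ] ∀ i j → k ℕ.≤ i → k ℕ.≤ j → s i - s j < ε) →
      ∃[ l ] ∀ ε → 0# < ε → ∃[ k ] ∀ i → k ℕ.≤ i → s i - l < ε × l - s i < ε

  _≤_ : Rel Carrier 0ℓ
  x ≤ y = ¬ (y < x)

module RealNotions (R : Reals) where

  open Reals R hiding (zero)

  private
    open IsStrictPartialOrder isStrictPartialOrder
      using () renaming (<-respʳ-≈ to resp-r; <-respˡ-≈ to resp-l; trans to <-trans; irrefl to <-irrefl)
    open RingProperties (CommutativeRing.ring commutativeRing)
      using (-‿distribˡ-*; -‿involutive; -0#≈0#)

  0<1 : 0# < 1#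
  0<1 with #⇒<⊎> 0#1
    where
    0#1 : 0# # 1#
    0#1 = #-sym (invertible⇒# (1# , inv , trans (*-comm _ _) inv))
      where
      inv : 1# * (1# - 0#) ≈ 1#
      inv = trans (*-identityˡ _) (trans (+-congˡ -0#≈0#) (+-identityʳ 1#))
  ... | inj₁ p = p
  ... | inj₂ p = ⊥-elim (<-irrefl refl (<-trans p (resp-r square (*-pos 0<-1 0<-1))))
    where
    0<-1 : 0# < - 1#
    0<-1 = resp-l (-‿inverseʳ 1#) (resp-r (+-identityˡ (- 1#)) (+-monoˡ-< (- 1#) p))
    square : (- 1#) * (- 1#) ≈ 1#
    square = trans (sym (-‿distribˡ-* 1# (- 1#)))
                   (trans (-‿cong (*-identityˡ (- 1#))) (-‿involutive 1#))

  0<fromℕ : ∀ n → 0# < fromℕ (suc n)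
  0<fromℕ zero    = resp-r (sym (+-identityʳ 1#)) 0<1
  0<fromℕ (suc n) = <-trans (0<fromℕ n)
    (resp-l (+-identityˡ _) (+-monoˡ-< (fromℕ (suc n)) 0<1))

  1/_ : (n : ℕ) .{{_ : NonZero n}} → Carrier
  1/ suc n = proj₁ (#⇒invertible (#-sym (<⇒# (0<fromℕ n))))

  1/-inverse : ∀ n .{{_ : NonZero n}} → fromℕ n * (1/ n) ≈ 1#
  1/-inverse (suc n) = trans
    (*-congʳ (sym (trans (+-congˡ -0#≈0#) (+-identityʳ _))))
    (proj₂ (proj₂ (#⇒invertible (#-sym (<⇒# (0<fromℕ n))))))

  infix 4 ∣_∣≤_
  ∣_∣≤_ : Carrier → Carrier → Set
  ∣ x ∣≤ ε = - ε ≤ x × x ≤ ε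

  -- y = 2^t for real t: y is positive, and its comparison with every rational
  -- power 2^((a-b)/q) agrees with that of t with (a-b)/q, both written
  -- without division.
  infix 4 _≈2^_
  _≈2^_ : Carrier → Carrier → Set
  y ≈2^ t = 0# < y × (∀ a b q →
      (fromℕ a ≤ fromℕ b + fromℕ q * t → two ^ a ≤ two ^ b * y ^ q)
    × (fromℕ b + fromℕ q * t ≤ fromℕ a → two ^ b * y ^ q ≤ two ^ a))
    where two = fromℕ 2

  ----------------------------------------------------------------------
  -- Polynomials and approximate degree

  -- A real polynomial in m variables: a list of terms, each a coefficient
  -- with a vector of exponents.
  Polynomial : ℕ → Set
  Polynomial m = List (Carrier × Vec ℕ m)

  evalMonomial : ∀ {m} → Vec ℕ m → Vec Carrier m → Carrier
  evalMonomial []      []      = 1#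
  evalMonomial (e ∷ α) (x ∷ v) = x ^ e * evalMonomial α v

  eval : ∀ {m} → Polynomial m → Vec Carrier m → Carrier
  eval p v = foldr (λ { (a , α) r → a * evalMonomial α v + r }) 0# p

  -- Terms may repeat or cancel, but a polynomial has total degree at most d
  -- exactly when some list of terms representing it satisfies this.
  DegreeAtMost : ∀ {m} → ℕ → Polynomial m → Set
  DegreeAtMost d = All (λ { (_ , α) → Vec.sum α ℕ.≤ d })

  fromSign : Sign → Carrier
  fromSign Sign.+ = 1#
  fromSign Sign.- = - 1#

  -- d = deg_ε(f)
  IsApproxDegree : ∀ {m} → Carrier → BoolFun m → ℕ → Set
  IsApproxDegree {m} ε f = IsLeast (λ d → Σ[ p ∈ Polynomial m ] DegreeAtMost d p ×
    (∀ x → ∣ fromSign (f x) - eval p (Vec.map fromSign x) ∣≤ ε))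

  ----------------------------------------------------------------------
  -- Complex amplitudes

  record ℂ : Set where
    constructor _+i_
    field
      re im : Carrier
  open ℂ public

  infix 4 _≈ℂ_
  _≈ℂ_ : Rel ℂ 0ℓ
  z ≈ℂ w = re z ≈ re w × im z ≈ im w

  0ℂ 1ℂ : ℂ
  0ℂ = 0# +i 0#
  1ℂ = 1# +i 0#

  infixl 6 _+ℂ_
  infixl 7 _*ℂ_
  _+ℂ_ _*ℂ_ : ℂ → ℂ → ℂ
  z +ℂ w = (re z + re w) +i (im z + im w)
  z *ℂ w = (re z * re w - im z * im w) +i (re z * im w + im z * re w)

  conj : ℂ → ℂ
  conj z = re z +i (- im z)

  ∣_∣² : ℂ → Carrier
  ∣ z ∣² = re z * re z + im z * im z

  sumℂ : ∀ {n} → (Fin n → ℂ) → ℂ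
  sumℂ g = sum (re ∘ g) +i sum (im ∘ g)

  ----------------------------------------------------------------------
  -- States and operators on the space spanned by the vectors |i,b,w⟩

  Basis : ℕ → ℕ → Set
  Basis N W = Fin N × Bool × Fin W

  State : ℕ → ℕ → Set
  State N W = Basis N W → ℂ

  Operator : ℕ → ℕ → Set
  Operator N W = Basis N W → Basis N W → ℂ

  module _ {N W : ℕ} where

    _≟ᴮ_ : DecidableEquality (Basis N W)
    _≟ᴮ_ = ≡-dec Fin._≟_ (≡-dec Bool._≟_ Fin._≟_)

    sumBasis : (Basis N W → Carrier) → Carrier
    sumBasis g = sum (λ i → sum (λ w → g (i , false , w) + g (i , true , w)))

    sumBasisℂ : (Basis N W → ℂ) → ℂ
    sumBasisℂ g = sumBasis (re ∘ g) +i sumBasis (im ∘ g)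

    ‖_‖² : State N W → Carrier
    ‖ ψ ‖² = sumBasis (λ s → ∣ ψ s ∣²)

    infixr 8 _·_
    _·_ : Operator N W → State N W → State N W
    (A · ψ) s = sumBasisℂ (λ t → A s t *ℂ ψ t)

    infixr 8 _∙_
    _∙_ : Operator N W → Operator N W → Operator N W
    (A ∙ B) s t = sumBasisℂ (λ u → A s u *ℂ B u t)

    _† : Operator N W → Operator N W
    (A †) s t = conj (A t s)

    1ᴼ : Operator N W
    1ᴼ s t = if does (s ≟ᴮ t) then 1ℂ else 0ℂ

    infix 4 _≈ᴼ_
    _≈ᴼ_ : Rel (Operator N W) 0ℓ
    A ≈ᴼ B = ∀ s t → A s t ≈ℂ B s t

    Unitary : Operator N W → Set
    Unitary U = (U † ∙ U) ≈ᴼ 1ᴼ × (U ∙ U †) ≈ᴼ 1ᴼ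

    bit : Sign → Bool
    bit Sign.+ = false
    bit Sign.- = true

    -- The map |i,b,w⟩ ↦ |i,b⊕bᵢ,w⟩ is an involution of the basis, so the
    -- amplitude of |i,b,w⟩ afterwards is that of |i,b⊕bᵢ,w⟩ before.
    oracle : Vec Sign N → State N W → State N W
    oracle x ψ (i , b , w) = ψ (i , b xor bit (lookup x i) , w)

    -- U_T O_x U_{T-1} O_x ⋯ U_1 O_x U_0 ψ
    evolve : ∀ T → (Fin (suc T) → Operator N W) → Vec Sign N → State N W → State N W
    evolve zero    U x ψ = U zero · ψ
    evolve (suc T) U x ψ = evolve T (U ∘ suc) x (oracle x (U zero · ψ))

  ----------------------------------------------------------------------
  -- Quantum query algorithms

  -- The measurement is given by measurement operators M k with
  -- Σ_k M_k† M_k = 1, outcome k having probability ‖M_k ψ‖² and being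
  -- reported as the output (output k).
  record QueryAlgorithm (O : Set) (N T : ℕ) : Set where
    field
      W             : ℕ
      start         : State N W
      start-unit    : ‖ start ‖² ≈ 1#
      U             : Fin (suc T) → Operator N W
      U-unitary     : ∀ j → Unitary (U j)
      K             : ℕ
      M             : Fin K → Operator N W
      M-complete    : (λ s t → sumℂ (λ k → (M k † ∙ M k) s t)) ≈ᴼ 1ᴼ
      output        : Fin K → O

    outcomeProbability : Vec Sign N → Fin K → Carrier
    outcomeProbability x k = ‖ M k · evolve T U x start ‖²

  -- On input x the output of A lies in E with probability at least δ.
  -- As E need not be decidable, this asks for a set of measurement outcomes
  -- of total probability at least δ, all giving outputs in E.
  OutputProbabilityAtLeast : ∀ {O N T} → Carrier → QueryAlgorithm O N T → Vec Sign N → (O → Set) → Set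
  OutputProbabilityAtLeast δ A x E = Σ[ S ∈ Subset K ]
      (∀ k → k ∈ S → E (output k))
    × δ ≤ sumOver +-rawMonoid S (outcomeProbability x)
    where open QueryAlgorithm A

{-# OPTIONS --safe #-}
module Submission where

-- Fix approximate degrees dᵢ of the fᵢ, and let τ be maximal such that more than n/100 of them are at
-- least τ; then μ ≤ nτ.  For such an "active" fᵢ, linear programming duality (and the fact that a
-- polynomial with 1/4 ≤ f p ≤ 1 can be amplified to a 1/5-approximation at the cost of a constant
-- factor in the degree) gives measures u, w on the cube, of mass 1 and at most 1, for which
-- 4 u(f g) − w(f g) vanishes on all g of degree less than a constant times τ.  So the functional
-- g ↦ 4 u(f g) is the sum of a functional of norm at most 5 annihilating low degree and one of norm
-- at most 1.  The outcome probabilities of a T-query algorithm are polynomials of degree 2T in the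
-- input.  When a product of such functionals is applied to one of them, every term with more than
-- κ = O(T/τ) annihilators vanishes, and the remaining ones are small because κ is a small fraction of
-- the number n′ of active functions: the XOR of the active functions has correlation at most
-- 4^κ (3/4)^n′ with the output.  Integrating Σ_z Pr[z] ∏ᵢ (3 + zᵢ fᵢ) over active i instead, whose
-- factors are 4 or 2 according to whether zᵢ is correct, bounds the probability of few errors.

open import Defs
open import Algebra.Bundles using (CommutativeRing)
open import Algebra.Solver.Ring.AlmostCommutativeRing
  using (AlmostCommutativeRing; fromCommutativeRing; _-Raw-AlmostCommutative⟶_)
open import Data.Bool.Base using (Bool; true; false; if_then_else_; T; _xor_; not)
open import Data.Empty using (⊥; ⊥-elim)
open import Data.Fin.Base using (Fin; zero; suc)
open import Data.Fin.Subset using (Subset; ∣_∣; inside; outside)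
open import Data.Integer.Base as ℤ using (ℤ; +_; -[1+_])
open import Data.List.Base as List using (List; []; _∷_; _++_; cartesianProductWith)
open import Data.List.Membership.Propositional using (_∈_)
open import Data.List.Membership.Propositional.Properties
  using (∈-++⁺ˡ; ∈-++⁺ʳ; ∈-map⁺; ∈-cartesianProductWith⁺; ∈-filter⁺; ∈-upTo⁺)
open import Data.List.Relation.Unary.All as All using (All; []; _∷_)
open import Data.List.Relation.Unary.Any using (here; there)
open import Data.Nat.Base as ℕ using (ℕ; zero; suc)
open import Data.Product.Base using (∃-syntax; Σ-syntax; _×_; _,_; proj₁; proj₂; map₂)
open import Data.Sign.Base as Sign using (Sign)
open import Data.Sum.Base as Sum using (_⊎_; inj₁; inj₂)
open import Data.Unit.Base using (tt)
open import Data.Vec.Base as Vec using (Vec; []; _∷_; head; tail; lookup; tabulate; concat; count)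
open import Data.Vec.Properties using (lookup⇒[]=; sum-++)
open import Function.Base using (_∘_)
open import Relation.Binary.PropositionalEquality as ≡ using (_≡_; _≢_)
open import Relation.Binary.Structures using (IsStrictPartialOrder; IsPreorder)
open import Relation.Nullary.Decidable.Core using (Dec; yes; no; does; dec⇒maybe)
open import Relation.Nullary.Negation.Core using (¬_)
open import Relation.Unary using (Decidable)
import Algebra.Properties.AbelianGroup
import Algebra.Properties.Ring
import Algebra.Properties.Semiring.Exp
import Algebra.Properties.Semiring.Mult
import Algebra.Solver.Ring
import Data.Fin.Properties as Fin
import Data.Integer.Properties as ℤ
import Data.List.Relation.Unary.All.Properties as All
import Data.Maybe.Base as Maybe
import Data.Nat.DivMod as ℕ
import Data.Nat.Properties as ℕ
import Data.Nat.Tactic.RingSolver as ℕ-Solver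
import Data.Sign.Properties as Sign
import Relation.Binary.Reasoning.Base.Triple
import Relation.Binary.Reasoning.Setoid

-- Duality needs case distinctions on reals whose order is not decidable. They are made under double
-- negation; this suffices because `≤` is itself a negation, so the lower bound is proved by
-- refuting `T < c * μ`.
--
-- The norm bound 5 of an annihilating part exceeds the scale 4, so the expanded product is useful
-- only if annihilators are counted. Each is charged 8 = 4 · 2: the 4 is paid by a global budget of
-- κ annihilators, and only the 2 stays with its coordinate. An active coordinate then costs 2 + 1 =
-- 3 against 4.
--
-- A bound for each outcome separately would be multiplied by the number of outcomes. Hence the
-- induction carries one bound on the sum of absolute values over all outcomes.
--
-- The weight 3 + z f is positive, so wrong outputs may be discarded; an error costs only a factor
-- 2; and after scaling by 4 the cost 12 + 3 = 15 stays below the value 16 of a correct coordinate.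
--
-- The real power 2^(-cn) enters only through its (1/c)-th power, so that the last comparison is one
-- of natural numbers.

-- Ring identities with integer coefficients

module RingSolver (R : Reals) where

  open Reals R hiding (zero)
  open CommutativeRing commutativeRing using (ring; +-abelianGroup)
  open Algebra.Properties.Ring ring
    using (-‿distribˡ-*; -‿distribʳ-*; -0#≈0#) renaming (-‿involutive to neg-involutive)
  open Algebra.Properties.AbelianGroup +-abelianGroup using (⁻¹-∙-comm)
  open Algebra.Properties.Semiring.Mult semiring using (×-homo-+; ×1-homo-*)
  open Relation.Binary.Reasoning.Setoid setoid

  private
    -- Interpreting 0 and 1 by 0# and 1# themselves lets solved identities mention these constants.
    natural : ℕ → Carrier
    natural 0 = 0#
    natural 1 = 1#
    natural (suc (suc n)) = fromℕ (suc (suc n))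

    natural≈ : ∀ n → natural n ≈ fromℕ n
    natural≈ 0 = refl
    natural≈ 1 = sym (+-identityʳ 1#)
    natural≈ (suc (suc n)) = refl

    integer : ℤ → Carrier
    integer (+ n)    = natural n
    integer -[1+ n ] = - natural (suc n)

    difference : ∀ x y z → (z + x) - (z + y) ≈ x - y
    difference x y z = begin
      (z + x) - (z + y)     ≈⟨ +-cong (+-comm z x) (sym (⁻¹-∙-comm z y)) ⟩
      (x + z) + (- z - y)   ≈⟨ +-assoc x z (- z - y) ⟩
      x + (z + (- z - y))   ≈⟨ +-congˡ (sym (+-assoc z (- z) (- y))) ⟩
      x + ((z - z) - y)     ≈⟨ +-congˡ (trans (+-congʳ (-‿inverseʳ z)) (+-identityˡ (- y))) ⟩
      x - y                 ∎

    integer-⊖ : ∀ m n → integer (m ℤ.⊖ n) ≈ fromℕ m - fromℕ n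
    integer-⊖ m zero = begin
      integer (m ℤ.⊖ 0)  ≡⟨ ≡.cong integer (ℤ.⊖-≥ {m} {0} ℕ.z≤n) ⟩
      natural m          ≈⟨ natural≈ m ⟩
      fromℕ m            ≈⟨ sym (trans (+-congˡ -0#≈0#) (+-identityʳ _)) ⟩
      fromℕ m - 0#       ∎
    integer-⊖ zero (suc n) = trans (-‿cong (natural≈ (suc n))) (sym (+-identityˡ _))
    integer-⊖ (suc m) (suc n) = begin
      integer (suc m ℤ.⊖ suc n)  ≡⟨ ≡.cong integer (ℤ.[1+m]⊖[1+n]≡m⊖n m n) ⟩
      integer (m ℤ.⊖ n)          ≈⟨ integer-⊖ m n ⟩
      fromℕ m - fromℕ n          ≈⟨ sym (difference (fromℕ m) (fromℕ n) 1#) ⟩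
      fromℕ (suc m) - fromℕ (suc n) ∎

    natural-+ : ∀ m n → natural (m ℕ.+ n) ≈ natural m + natural n
    natural-+ m n = trans (natural≈ (m ℕ.+ n)) (trans (×-homo-+ 1# m n)
        (+-cong (sym (natural≈ m)) (sym (natural≈ n))))

    natural-* : ∀ m n → natural (m ℕ.* n) ≈ natural m * natural n
    natural-* m n = trans (natural≈ (m ℕ.* n)) (trans (×1-homo-* m n)
        (*-cong (sym (natural≈ m)) (sym (natural≈ n))))

    integer-⊖′ : ∀ m n → integer (m ℤ.⊖ n) ≈ natural m - natural n
    integer-⊖′ m n = trans (integer-⊖ m n) (+-cong (sym (natural≈ m)) (-‿cong (sym (natural≈ n))))

    integer-+ : ∀ i j → integer (i ℤ.+ j) ≈ integer i + integer j
    integer-+ (+ m)    (+ n)    = natural-+ m n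
    integer-+ (+ m)    -[1+ n ] = integer-⊖′ m (suc n)
    integer-+ -[1+ m ] (+ n)    = trans (integer-⊖′ n (suc m)) (+-comm _ _)
    integer-+ -[1+ m ] -[1+ n ] = begin
      - natural (suc (suc (m ℕ.+ n)))       ≡⟨ ≡.cong (λ k → - natural (suc k)) (≡.sym (ℕ.+-suc m n)) ⟩
      - natural (suc m ℕ.+ suc n)           ≈⟨ -‿cong (natural-+ (suc m) (suc n)) ⟩
      - (natural (suc m) + natural (suc n)) ≈⟨ sym (⁻¹-∙-comm _ _) ⟩
      - natural (suc m) - natural (suc n)   ∎

    integer-neg : ∀ i → integer (ℤ.- i) ≈ - integer i
    integer-neg (+ zero)  = sym -0#≈0#
    integer-neg (+ suc n) = refl
    integer-neg -[1+ n ]  = sym (neg-involutive _)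

    integer-* : ∀ i j → integer (i ℤ.* j) ≈ integer i * integer j
    integer-* (+ m) (+ n) = begin
      integer (+ m ℤ.* + n)   ≡⟨ ≡.cong integer (≡.sym (ℤ.pos-* m n)) ⟩
      natural (m ℕ.* n)       ≈⟨ natural-* m n ⟩
      natural m * natural n   ∎
    integer-* (+ m) -[1+ n ] = begin
      integer (+ m ℤ.* -[1+ n ])      ≡⟨ ≡.cong integer (≡.sym (ℤ.neg-distribʳ-* (+ m) (+ suc n))) ⟩
      integer (ℤ.- (+ m ℤ.* + suc n)) ≈⟨ integer-neg (+ m ℤ.* + suc n) ⟩
      - integer (+ m ℤ.* + suc n)     ≈⟨ -‿cong (integer-* (+ m) (+ suc n)) ⟩
      - (natural m * natural (suc n)) ≈⟨ -‿distribʳ-* _ _ ⟩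
      natural m * - natural (suc n)   ∎
    integer-* -[1+ m ] (+ n) = begin
      integer (-[1+ m ] ℤ.* + n)      ≡⟨ ≡.cong integer (≡.sym (ℤ.neg-distribˡ-* (+ suc m) (+ n))) ⟩
      integer (ℤ.- (+ suc m ℤ.* + n)) ≈⟨ integer-neg (+ suc m ℤ.* + n) ⟩
      - integer (+ suc m ℤ.* + n)     ≈⟨ -‿cong (integer-* (+ suc m) (+ n)) ⟩
      - (natural (suc m) * natural n) ≈⟨ -‿distribˡ-* _ _ ⟩
      - natural (suc m) * natural n   ∎
    integer-* -[1+ m ] -[1+ n ] = begin
      natural (suc m ℕ.* suc n)                  ≈⟨ natural-* (suc m) (suc n) ⟩
      natural (suc m) * natural (suc n)          ≈⟨ sym (neg-involutive _) ⟩
      - - (natural (suc m) * natural (suc n))    ≈⟨ -‿cong (-‿distribˡ-* _ _) ⟩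
      - (- natural (suc m) * natural (suc n))    ≈⟨ -‿distribʳ-* _ _ ⟩
      - natural (suc m) * - natural (suc n)      ∎

    target : AlmostCommutativeRing _ _
    target = fromCommutativeRing commutativeRing

    morphism : ℤ.+-*-rawRing -Raw-AlmostCommutative⟶ target
    morphism = record
      { ⟦_⟧    = integer
      ; +-homo = integer-+
      ; *-homo = integer-*
      ; -‿homo = integer-neg
      ; 0-homo = refl
      ; 1-homo = refl
      }

  module Solver = Algebra.Solver.Ring ℤ.+-*-rawRing target morphism
    (λ i j → Maybe.map (λ i≡j → reflexive (≡.cong integer i≡j)) (dec⇒maybe (i ℤ.≟ j)))
  open Solver public using (solve; _:=_; _:+_; _:*_; _:-_; :-_; con)

-- Order arithmetic without decidable comparison

module OrderedField (R : Reals) where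

  open Reals R hiding (zero)
  open RealNotions R
  open RingSolver R public
  open CommutativeRing commutativeRing using (ring)
  open Algebra.Properties.Semiring.Mult semiring using (×-homo-+; ×1-homo-*)
  open Algebra.Properties.Semiring.Exp semiring public
    using (^-homo-*)

  open IsStrictPartialOrder isStrictPartialOrder public
    using (<-resp-≈; <-respʳ-≈; <-respˡ-≈) renaming (irrefl to <-irrefl; trans to <-trans; asym to <-asym)

  -- The constructive substitute for comparing `z` with `x` and `y`: apartness is cotransitive, so
  -- `z` is apart from one of the two, and being apart decides the direction.
  <-cotrans : ∀ {x y} → x < y → ∀ z → x < z ⊎ z < y
  <-cotrans {x} {y} x<y z with #-cotrans (<⇒# x<y) z
  ... | inj₁ x#z with #⇒<⊎> x#z
  ...   | inj₁ x<z = inj₁ x<z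
  ...   | inj₂ z<x = inj₂ (<-trans z<x x<y)
  <-cotrans {x} {y} x<y z | inj₂ z#y with #⇒<⊎> z#y
  ...   | inj₁ z<y = inj₂ z<y
  ...   | inj₂ y<z = inj₁ (<-trans x<y y<z)

  <⇒≤ : ∀ {x y} → x < y → x ≤ y
  <⇒≤ x<y y<x = <-asym x<y y<x

  ≤-reflexive : ∀ {x y} → x ≈ y → x ≤ y
  ≤-reflexive x≈y y<x = <-irrefl (sym x≈y) y<x

  ≤-refl : ∀ {x} → x ≤ x
  ≤-refl = ≤-reflexive refl

  <-≤-trans : ∀ {x y z} → x < y → y ≤ z → x < z
  <-≤-trans {z = z} x<y y≤z with <-cotrans x<y z
  ... | inj₁ x<z = x<z
  ... | inj₂ z<y = ⊥-elim (y≤z z<y)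

  ≤-<-trans : ∀ {x y z} → x ≤ y → y < z → x < z
  ≤-<-trans {x} x≤y y<z with <-cotrans y<z x
  ... | inj₁ y<x = ⊥-elim (x≤y y<x)
  ... | inj₂ x<z = x<z

  ≤-trans : ∀ {x y z} → x ≤ y → y ≤ z → x ≤ z
  ≤-trans x≤y y≤z z<x = y≤z (<-≤-trans z<x x≤y)

  ≤-antisym : ∀ {x y} → x ≤ y → y ≤ x → x ≈ y
  ≤-antisym {x} {y} x≤y y≤x = proj₁ (tight x y) λ x#y → case (#⇒<⊎> x#y)
    where
    case : x < y ⊎ y < x → ⊥
    case (inj₁ x<y) = y≤x x<y
    case (inj₂ y<x) = x≤y y<x

  ≤-isPreorder : IsPreorder _≈_ _≤_
  ≤-isPreorder = record { isEquivalence = isEquivalence ; reflexive = ≤-reflexive ; trans = ≤-trans }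

  module ≤-Reasoning = Relation.Binary.Reasoning.Base.Triple
    ≤-isPreorder <-asym <-trans <-resp-≈ <⇒≤ <-≤-trans ≤-<-trans

  ≤-respˡ-≈ : ∀ {x y z} → x ≈ y → x ≤ z → y ≤ z
  ≤-respˡ-≈ x≈y x≤z = ≤-trans (≤-reflexive (sym x≈y)) x≤z

  ≤-respʳ-≈ : ∀ {x y z} → x ≈ y → z ≤ x → z ≤ y
  ≤-respʳ-≈ x≈y z≤x = ≤-trans z≤x (≤-reflexive x≈y)

  -- Usable wherever the goal is `⊥`; since `u ≤ v` unfolds to `v < u → ⊥`, every inequality `≤` may
  -- be proved by these cases.
  trichotomy : ∀ x y → ¬ ¬ (x < y ⊎ x ≈ y ⊎ y < x)
  trichotomy x y k = k (inj₂ (inj₁ (≤-antisym (λ y<x → k (inj₂ (inj₂ y<x))) (λ x<y → k (inj₁ x<y)))))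

  <-or-≥ : ∀ x y → ¬ ¬ (x < y ⊎ y ≤ x)
  <-or-≥ x y k = k (inj₂ λ x<y → k (inj₁ x<y))

  +-cancelʳ-< : ∀ z {x y} → x + z < y + z → x < y
  +-cancelʳ-< z {x} {y} lt = <-respˡ-≈ (cancel x) (<-respʳ-≈ (cancel y) (+-monoˡ-< (- z) lt))
    where
    cancel : ∀ a → a + z - z ≈ a
    cancel a = solve 2 (λ a z → a :+ z :- z := a) refl a z

  +-monoˡ-≤ : ∀ z {x y} → x ≤ y → x + z ≤ y + z
  +-monoˡ-≤ z x≤y lt = x≤y (+-cancelʳ-< z lt)

  +-mono-≤ : ∀ {x y u v} → x ≤ y → u ≤ v → x + u ≤ y + v
  +-mono-≤ {x} {y} {u} {v} x≤y u≤v = ≤-trans (+-monoˡ-≤ u x≤y)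
    (≤-respˡ-≈ (+-comm u y) (≤-respʳ-≈ (+-comm v y) (+-monoˡ-≤ y u≤v)))

  0≤⇒≤ : ∀ {x y} → 0# ≤ y - x → x ≤ y
  0≤⇒≤ {x} {y} le = ≤-respˡ-≈ (+-identityˡ x)
    (≤-respʳ-≈ (solve 2 (λ x y → y :- x :+ x := y) refl x y) (+-monoˡ-≤ x le))

  ≤⇒0≤ : ∀ {x y} → x ≤ y → 0# ≤ y - x
  ≤⇒0≤ {x} le = ≤-respˡ-≈ (-‿inverseʳ x) (+-monoˡ-≤ (- x) le)

  <⇒0< : ∀ {x y} → x < y → 0# < y - x
  <⇒0< {x} le = <-respˡ-≈ (-‿inverseʳ x) (+-monoˡ-< (- x) le)

  0<⇒< : ∀ {x y} → 0# < y - x → x < y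
  0<⇒< {x} {y} lt = <-respˡ-≈ (+-identityˡ x)
    (<-respʳ-≈ (solve 2 (λ x y → y :- x :+ x := y) refl x y) (+-monoˡ-< x lt))

  neg-mono-≤ : ∀ {x y} → x ≤ y → - y ≤ - x
  neg-mono-≤ {x} {y} le = 0≤⇒≤ (≤-respʳ-≈ (solve 2 (λ x y → y :- x := :- x :- (:- y)) refl x y) (≤⇒0≤ le))

  +-nonneg : ∀ {x y} → 0# ≤ x → 0# ≤ y → 0# ≤ x + y
  +-nonneg 0≤x 0≤y = ≤-respˡ-≈ (+-identityˡ 0#) (+-mono-≤ 0≤x 0≤y)

  *-nonneg : ∀ {x y} → 0# ≤ x → 0# ≤ y → 0# ≤ x * y
  *-nonneg {x} {y} 0≤x 0≤y xy<0 = trichotomy 0# x λ where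
    (inj₁ 0<x) → trichotomy 0# y λ where
      (inj₁ 0<y)        → <-asym (*-pos 0<x 0<y) xy<0
      (inj₂ (inj₁ 0≈y)) → <-irrefl (trans (*-congˡ (sym 0≈y)) (zeroʳ x)) xy<0
      (inj₂ (inj₂ y<0)) → 0≤y y<0
    (inj₂ (inj₁ 0≈x)) → <-irrefl (trans (*-congʳ (sym 0≈x)) (zeroˡ y)) xy<0
    (inj₂ (inj₂ x<0)) → 0≤x x<0

  0≤-_ : ∀ {x} → x < 0# → 0# ≤ - x
  0≤- x<0 = ≤-respʳ-≈ (+-identityˡ _) (≤⇒0≤ (<⇒≤ x<0))

  0≤x*x : ∀ x → 0# ≤ x * x
  0≤x*x x xx<0 = trichotomy 0# x λ where
    (inj₁ 0<x)        → <-asym (*-pos 0<x 0<x) xx<0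
    (inj₂ (inj₁ 0≈x)) → <-irrefl (trans (*-congʳ (sym 0≈x)) (zeroˡ x)) xx<0
    (inj₂ (inj₂ x<0)) → *-nonneg (0≤- x<0) (0≤- x<0)
                          (<-respˡ-≈ (solve 1 (λ x → x :* x := (:- x) :* (:- x)) refl x) xx<0)

  *-monoˡ-≤ : ∀ {x y z} → 0# ≤ z → x ≤ y → z * x ≤ z * y
  *-monoˡ-≤ {x} {y} {z} 0≤z x≤y = 0≤⇒≤ (≤-respʳ-≈
    (solve 3 (λ x y z → z :* (y :- x) := z :* y :- z :* x) refl x y z) (*-nonneg 0≤z (≤⇒0≤ x≤y)))

  *-mono-≤ : ∀ {x y u v} → 0# ≤ x → 0# ≤ v → x ≤ y → u ≤ v → x * u ≤ y * v
  *-mono-≤ {x} {y} {u} {v} 0≤x 0≤v x≤y u≤v = ≤-trans (*-monoˡ-≤ 0≤x u≤v)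
    (≤-respˡ-≈ (*-comm v x) (≤-respʳ-≈ (*-comm v y) (*-monoˡ-≤ 0≤v x≤y)))

  *-monoˡ-< : ∀ {x y z} → 0# < z → x < y → z * x < z * y
  *-monoˡ-< {x} {y} {z} 0<z x<y = 0<⇒< (<-respʳ-≈
    (solve 3 (λ x y z → z :* (y :- x) := z :* y :- z :* x) refl x y z) (*-pos 0<z (<⇒0< x<y)))

  *-cancelˡ-≤ : ∀ {x y z} → 0# < z → z * x ≤ z * y → x ≤ y
  *-cancelˡ-≤ 0<z le y<x = le (*-monoˡ-< 0<z y<x)

  0≤1 : 0# ≤ 1#
  0≤1 = <⇒≤ 0<1

  ^-nonneg : ∀ {x} n → 0# ≤ x → 0# ≤ x ^ n
  ^-nonneg zero    0≤x = 0≤1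
  ^-nonneg (suc n) 0≤x = *-nonneg 0≤x (^-nonneg n 0≤x)

  ^-mono-≤ : ∀ {x y} n → 0# ≤ x → x ≤ y → x ^ n ≤ y ^ n
  ^-mono-≤ zero    0≤x x≤y = ≤-refl
  ^-mono-≤ (suc n) 0≤x x≤y = *-mono-≤ 0≤x (^-nonneg n (≤-trans 0≤x x≤y)) x≤y (^-mono-≤ n 0≤x x≤y)

  ^-distrib-* : ∀ x y n → (x * y) ^ n ≈ x ^ n * y ^ n
  ^-distrib-* x y zero    = sym (*-identityˡ 1#)
  ^-distrib-* x y (suc n) = trans (*-congˡ (^-distrib-* x y n))
    (solve 4 (λ x y a b → x :* y :* (a :* b) := x :* a :* (y :* b)) refl x y (x ^ n) (y ^ n))

  fromℕ-+ : ∀ m n → fromℕ (m ℕ.+ n) ≈ fromℕ m + fromℕ n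
  fromℕ-+ = ×-homo-+ 1#

  fromℕ-* : ∀ m n → fromℕ (m ℕ.* n) ≈ fromℕ m * fromℕ n
  fromℕ-* = ×1-homo-*

  fromℕ-1 : fromℕ 1 ≈ 1#
  fromℕ-1 = +-identityʳ 1#

  fromℕ-^ : ∀ m n → fromℕ (m ℕ.^ n) ≈ fromℕ m ^ n
  fromℕ-^ m zero    = fromℕ-1
  fromℕ-^ m (suc n) = trans (fromℕ-* m (m ℕ.^ n)) (*-congˡ (fromℕ-^ m n))

  0≤fromℕ : ∀ n → 0# ≤ fromℕ n
  0≤fromℕ zero    = ≤-refl
  0≤fromℕ (suc n) = <⇒≤ (0<fromℕ n)

  fromℕ-mono-≤ : ∀ {m n} → m ℕ.≤ n → fromℕ m ≤ fromℕ n
  fromℕ-mono-≤ {n = n} ℕ.z≤n = 0≤fromℕ n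
  fromℕ-mono-≤ (ℕ.s≤s m≤n) = +-mono-≤ ≤-refl (fromℕ-mono-≤ m≤n)

  fromℕ-mono-< : ∀ {m n} → m ℕ.< n → fromℕ m < fromℕ n
  fromℕ-mono-< {m} m<n = <-≤-trans
    (<-respˡ-≈ (+-identityˡ _) (+-monoˡ-< (fromℕ m) 0<1)) (fromℕ-mono-≤ m<n)

  fromℕ-cancel-≤ : ∀ {m n} → fromℕ m ≤ fromℕ n → m ℕ.≤ n
  fromℕ-cancel-≤ le = ℕ.≮⇒≥ λ n<m → le (fromℕ-mono-< n<m)

  fromℕ-cancel-< : ∀ {m n} → fromℕ m < fromℕ n → m ℕ.< n
  fromℕ-cancel-< lt = ℕ.≰⇒> λ n≤m → fromℕ-mono-≤ n≤m lt

-- Linear functionals and measures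

module Functionals (R : Reals) where

  open Reals R hiding (zero)
  open RealNotions R
  open OrderedField R

  -- Functionals on all functions of `X` stand for signed weights on the points of `X`. Sums,
  -- reweightings, restrictions and iterated integrals are then plain compositions, with no weight
  -- vectors to keep track of.
  record Functional (X : Set) : Set where
    field
      apply       : (X → Carrier) → Carrier
      apply-cong  : ∀ {g h} → (∀ x → g x ≈ h x) → apply g ≈ apply h
      additive    : ∀ g h → apply (λ x → g x + h x) ≈ apply g + apply h
      homogeneous : ∀ c g → apply (λ x → c * g x) ≈ c * apply g

    apply-zero : ∀ {g} → (∀ x → g x ≈ 0#) → apply g ≈ 0#
    apply-zero {g} g≈0 = trans (apply-cong λ x → trans (g≈0 x) (sym (zeroˡ 0#)))
      (trans (homogeneous 0# (λ _ → 0#)) (zeroˡ _))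

    apply-sum : ∀ {n} (g : Fin n → X → Carrier) →
      apply (λ x → sum (λ k → g k x)) ≈ sum (λ k → apply (g k))
    apply-sum {zero}  g = apply-zero (λ _ → refl)
    apply-sum {suc n} g = trans (additive _ _) (+-congˡ (apply-sum (g ∘ suc)))

    homogeneousʳ : ∀ c g → apply (λ x → g x * c) ≈ apply g * c
    homogeneousʳ c g = trans (apply-cong (λ x → *-comm (g x) c)) (trans (homogeneous c g) (*-comm c _))

    apply-difference : ∀ g h → apply (λ x → g x - h x) ≈ apply g - apply h
    apply-difference g h = trans (additive _ _) (+-congˡ (trans
      (apply-cong (λ x → solve 1 (λ a → :- a := :- con (+ 1) :* a) refl (h x)))
      (trans (homogeneous _ h) (solve 1 (λ a → :- con (+ 1) :* a := :- a) refl (apply h)))))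

    apply-const : ∀ c → apply (λ _ → c) ≈ c * apply (λ _ → 1#)
    apply-const c = trans (apply-cong (λ _ → sym (*-identityʳ c))) (homogeneous c _)

  open Functional public

  -- A positive functional plays the role of a nonnegative measure.
  record Measure (X : Set) : Set where
    field
      functional : Functional X
      positive   : ∀ {g} → (∀ x → 0# ≤ g x) → 0# ≤ apply functional g

    ∫ : (X → Carrier) → Carrier
    ∫ = apply functional

    total : Carrier
    total = ∫ (λ _ → 1#)

    monotone : ∀ {g h} → (∀ x → g x ≤ h x) → ∫ g ≤ ∫ h
    monotone {g} {h} le = 0≤⇒≤ (≤-respʳ-≈ (apply-difference functional h g) (positive (λ x → ≤⇒0≤ (le x))))

  open Measure public

  zeroFunctional : ∀ {X} → Functional X
  zeroFunctional = record
    { apply       = λ _ → 0#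
    ; apply-cong  = λ _ → refl
    ; additive    = λ _ _ → sym (+-identityˡ 0#)
    ; homogeneous = λ c _ → sym (zeroʳ c)
    }

  dirac : ∀ {X} → X → Measure X
  dirac x = record
    { functional = record
      { apply       = λ g → g x
      ; apply-cong  = λ eq → eq x
      ; additive    = λ _ _ → refl
      ; homogeneous = λ _ _ → refl
      }
    ; positive = λ 0≤g → 0≤g x
    }

  infixl 6 _⊞_
  infixl 7 _⊡_

  _⊞_ : ∀ {X} → Functional X → Functional X → Functional X
  L ⊞ L′ = record
    { apply       = λ g → apply L g + apply L′ g
    ; apply-cong  = λ eq → +-cong (apply-cong L eq) (apply-cong L′ eq)
    ; additive    = λ g h → trans (+-cong (additive L g h) (additive L′ g h))
        (solve 4 (λ a b c d → a :+ b :+ (c :+ d) := a :+ c :+ (b :+ d)) refl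
          (apply L g) (apply L h) (apply L′ g) (apply L′ h))
    ; homogeneous = λ c g → trans (+-cong (homogeneous L c g) (homogeneous L′ c g)) (sym (distribˡ c _ _))
    }

  _⊡_ : ∀ {X} → Carrier → Functional X → Functional X
  a ⊡ L = record
    { apply       = λ g → a * apply L g
    ; apply-cong  = λ eq → *-congˡ (apply-cong L eq)
    ; additive    = λ g h → trans (*-congˡ (additive L g h)) (distribˡ a _ _)
    ; homogeneous = λ c g → trans (*-congˡ (homogeneous L c g))
        (solve 3 (λ a c b → a :* (c :* b) := c :* (a :* b)) refl a c (apply L g))
    }

  weighted : ∀ {X} → (X → Carrier) → Functional X → Functional X
  weighted w L = record
    { apply       = λ g → apply L (λ x → w x * g x)
    ; apply-cong  = λ eq → apply-cong L (λ x → *-congˡ (eq x))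
    ; additive    = λ g h → trans (apply-cong L (λ x → distribˡ (w x) (g x) (h x))) (additive L _ _)
    ; homogeneous = λ c g → trans
        (apply-cong L (λ x → solve 3 (λ a c b → a :* (c :* b) := c :* (a :* b)) refl (w x) c (g x)))
        (homogeneous L c _)
    }

  _⊞⁺_ : ∀ {X} → Measure X → Measure X → Measure X
  μ ⊞⁺ ν = record
    { functional = functional μ ⊞ functional ν
    ; positive   = λ 0≤g → +-nonneg (positive μ 0≤g) (positive ν 0≤g)
    }

  scaled : ∀ {X} a → 0# ≤ a → Measure X → Measure X
  scaled a 0≤a μ = record
    { functional = a ⊡ functional μ
    ; positive   = λ 0≤g → *-nonneg 0≤a (positive μ 0≤g)
    }

  -- Duality produces one measure on two copies of the cube; its restrictions to the copies give the
  -- two measures `u` and `w`.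
  side : ∀ {X} → Bool → Measure (X × Bool) → Measure X
  side {X} s μ = record
    { functional = record
      { apply       = λ g → ∫ μ (extend s g)
      ; apply-cong  = λ eq → apply-cong (functional μ) λ { (x , t) → extend-cong s eq x t }
      ; additive    = λ g h → trans (apply-cong (functional μ) λ { (x , t) → extend-+ s g h x t })
          (additive (functional μ) _ _)
      ; homogeneous = λ c g → trans (apply-cong (functional μ) λ { (x , t) → extend-* s c g x t })
          (homogeneous (functional μ) c _)
      }
    ; positive = λ 0≤g → positive μ λ { (x , t) → extend-nonneg s 0≤g x t }
    }
    where
    extend : Bool → (X → Carrier) → X × Bool → Carrier
    extend false g (x , false) = g x
    extend false g (x , true)  = 0#
    extend true  g (x , false) = 0#
    extend true  g (x , true)  = g x

    extend-cong : ∀ s {g h} → (∀ x → g x ≈ h x) → ∀ x t → extend s g (x , t) ≈ extend s h (x , t)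
    extend-cong false eq x false = eq x
    extend-cong false eq x true  = refl
    extend-cong true  eq x false = refl
    extend-cong true  eq x true  = eq x

    extend-+ : ∀ s g h x t → extend s (λ x → g x + h x) (x , t) ≈ extend s g (x , t) + extend s h (x , t)
    extend-+ false g h x false = refl
    extend-+ false g h x true  = sym (+-identityˡ 0#)
    extend-+ true  g h x false = sym (+-identityˡ 0#)
    extend-+ true  g h x true  = refl

    extend-* : ∀ s c g x t → extend s (λ x → c * g x) (x , t) ≈ c * extend s g (x , t)
    extend-* false c g x false = refl
    extend-* false c g x true  = sym (zeroʳ c)
    extend-* true  c g x false = sym (zeroʳ c)
    extend-* true  c g x true  = refl

    extend-nonneg : ∀ s {g} → (∀ x → 0# ≤ g x) → ∀ x t → 0# ≤ extend s g (x , t)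
    extend-nonneg false 0≤g x false = 0≤g x
    extend-nonneg false 0≤g x true  = ≤-refl
    extend-nonneg true  0≤g x false = ≤-refl
    extend-nonneg true  0≤g x true  = 0≤g x

  side-split : ∀ {X} (μ : Measure (X × Bool)) (g : X × Bool → Carrier) →
    ∫ μ g ≈ ∫ (side false μ) (λ x → g (x , false)) + ∫ (side true μ) (λ x → g (x , true))
  side-split μ g = trans (apply-cong (functional μ) λ where
      (x , false) → sym (+-identityʳ _)
      (x , true)  → sym (+-identityˡ _))
    (additive (functional μ) _ _)

  sumMeasure : ∀ n → Measure (Fin n)
  sumMeasure n = record
    { functional = record
      { apply       = sum
      ; apply-cong  = cong-sum n
      ; additive    = sum-+ n
      ; homogeneous = sum-* n
      }
    ; positive = sum-nonneg n
    }
    where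
    cong-sum : ∀ n {g h : Fin n → Carrier} → (∀ i → g i ≈ h i) → sum g ≈ sum h
    cong-sum zero    eq = refl
    cong-sum (suc n) eq = +-cong (eq zero) (cong-sum n (eq ∘ suc))

    sum-+ : ∀ n (g h : Fin n → Carrier) → sum (λ i → g i + h i) ≈ sum g + sum h
    sum-+ zero    g h = sym (+-identityˡ 0#)
    sum-+ (suc n) g h = trans (+-congˡ (sum-+ n (g ∘ suc) (h ∘ suc)))
      (solve 4 (λ a b c d → a :+ b :+ (c :+ d) := a :+ c :+ (b :+ d)) refl (g zero) (h zero) _ _)

    sum-* : ∀ n c (g : Fin n → Carrier) → sum (λ i → c * g i) ≈ c * sum g
    sum-* zero    c g = sym (zeroʳ c)
    sum-* (suc n) c g = trans (+-congˡ (sum-* n c (g ∘ suc))) (sym (distribˡ c _ _))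

    sum-nonneg : ∀ n {g : Fin n → Carrier} → (∀ i → 0# ≤ g i) → 0# ≤ sum g
    sum-nonneg zero    0≤g = ≤-refl
    sum-nonneg (suc n) 0≤g = +-nonneg (0≤g zero) (sum-nonneg n (0≤g ∘ suc))

  sum-cong : ∀ n {g h : Fin n → Carrier} → (∀ i → g i ≈ h i) → sum g ≈ sum h
  sum-cong n = apply-cong (functional (sumMeasure n))

  sum-mono : ∀ n {g h : Fin n → Carrier} → (∀ i → g i ≤ h i) → sum g ≤ sum h
  sum-mono n = monotone (sumMeasure n)

  -- The first coordinate is the inner integral, which fits an induction that removes the first
  -- block while the remaining blocks are held fixed.
  product : ∀ {X n} → Measure X → Measure (Vec X n) → Measure (Vec X (suc n))
  product μ ν = record
    { functional = record
      { apply       = λ g → ∫ ν (λ xs → ∫ μ (λ x → g (x ∷ xs)))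
      ; apply-cong  = λ eq → apply-cong (functional ν) λ xs → apply-cong (functional μ) λ x → eq (x ∷ xs)
      ; additive    = λ g h → trans (apply-cong (functional ν) λ xs → additive (functional μ) _ _)
          (additive (functional ν) _ _)
      ; homogeneous = λ c g → trans (apply-cong (functional ν) λ xs → homogeneous (functional μ) c _)
          (homogeneous (functional ν) c _)
      }
    ; positive = λ 0≤g → positive ν λ xs → positive μ λ x → 0≤g (x ∷ xs)
    }

  inverse-positive : ∀ {x y} → 0# < x → x * y ≈ 1# → 0# < y
  inverse-positive {x} {y} 0<x x*y≈1 = positive-or-negative (#⇒<⊎> y#0)
    where
    minus-0 : y - 0# ≈ y
    minus-0 = solve 1 (λ z → z :- con (+ 0) := z) refl y

    y#0 : y # 0#
    y#0 = invertible⇒# (x , trans (*-congˡ minus-0) x*y≈1 , trans (*-congʳ minus-0) (trans (*-comm y x) x*y≈1))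

    x*-y≈-1 : x * (0# - y) ≈ 0# - 1#
    x*-y≈-1 = trans (solve 2 (λ x y → x :* (con (+ 0) :- y) := con (+ 0) :- x :* y) refl x y)
                    (+-congˡ (-‿cong x*y≈1))

    positive-or-negative : y < 0# ⊎ 0# < y → 0# < y
    positive-or-negative (inj₂ 0<y) = 0<y
    positive-or-negative (inj₁ y<0) =
      ⊥-elim (<-asym 0<1 (0<⇒< (<-respʳ-≈ x*-y≈-1 (*-pos 0<x (<⇒0< y<0)))))

  reciprocal : ∀ {x} → 0# < x → ∃[ y ] 0# < y × x * y ≈ 1#
  reciprocal {x} 0<x = y , inverse-positive 0<x x*y≈1 , x*y≈1
    where
    invertible = #⇒invertible (#-sym (<⇒# 0<x))
    y = proj₁ invertible

    x*y≈1 : x * y ≈ 1#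
    x*y≈1 = trans (*-congʳ (solve 1 (λ z → z := z :- con (+ 0)) refl x)) (proj₂ (proj₂ invertible))

-- Linear programming duality

module Farkas (R : Reals) where

  open Reals R hiding (zero)
  open RealNotions R
  open OrderedField R
  open Functionals R

  -- The witness is the maximum of all lower bounds and of the minimum of 0 and the upper bounds,
  -- built one comparison at a time; 0 is the value when there is no bound at all.
  between : ∀ {A B : Set} (lo : A → Carrier) (hi : B → Carrier) (as : List A) (bs : List B) →
    (∀ {a b} → a ∈ as → b ∈ bs → lo a ≤ hi b) →
    ¬ ¬ (∃[ y ] (∀ {a} → a ∈ as → lo a ≤ y) × (∀ {b} → b ∈ bs → y ≤ hi b))
  between lo hi [] [] le k = k (0# , (λ ()) , λ ())
  between lo hi [] (b ∷ bs) le k = between lo hi [] bs (λ ()) λ (y , above , below) →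
    <-or-≥ (hi b) y λ where
      (inj₁ hib<y) → k (hi b , (λ ()) , λ where
        (here ≡.refl) → ≤-refl
        (there b∈bs)  → ≤-trans (<⇒≤ hib<y) (below b∈bs))
      (inj₂ y≤hib) → k (y , (λ ()) , λ where
        (here ≡.refl) → y≤hib
        (there b∈bs)  → below b∈bs)
  between lo hi (a ∷ as) bs le k = between lo hi as bs (λ a∈as → le (there a∈as)) λ (y , above , below) →
    <-or-≥ y (lo a) λ where
      (inj₁ y<loa) → k (lo a , (λ where
        (here ≡.refl) → ≤-refl
        (there a∈as)  → ≤-trans (above a∈as) (<⇒≤ y<loa)) , le (here ≡.refl))
      (inj₂ loa≤y) → k (y , (λ where
        (here ≡.refl) → loa≤y
        (there a∈as)  → above a∈as) , below)

  module _ {X : Set} where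

    Kills : List (X → Carrier) → Measure X → Set
    Kills hs μ = All (λ h → ∫ μ h ≈ 0#) hs

    -- A linear inequality `0 ≤ ∫ μ (g + b)` is stored as its measure `μ`. The list `ks` holds the
    -- functions already eliminated, whose coefficients no longer influence the inequality.
    Constraint : List (X → Carrier) → Set
    Constraint ks = Σ[ μ ∈ Measure X ] Kills ks μ

    module _ (h : X → Carrier) {ks : List (X → Carrier)} where

      slope : Constraint ks → Carrier
      slope (μ , _) = ∫ μ h

      record Sorted (cs : List (Constraint ks)) : Set where
        field
          positives : List (Σ[ c ∈ Constraint ks ] 0# < slope c)
          negatives : List (Σ[ c ∈ Constraint ks ] slope c < 0#)
          zeros     : List (Σ[ c ∈ Constraint ks ] slope c ≈ 0#)
          exhaustive  : ∀ {c} → c ∈ cs → (∃[ p ] (c , p) ∈ positives)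
                        ⊎ (∃[ p ] (c , p) ∈ negatives) ⊎ (∃[ p ] (c , p) ∈ zeros)

      sort : ∀ cs → ¬ ¬ Sorted cs
      sort [] k = k record { positives = [] ; negatives = [] ; zeros = [] ; exhaustive = λ () }
      sort (c ∷ cs) k = sort cs λ sorted → let open Sorted sorted in trichotomy 0# (slope c) λ where
        (inj₁ 0<c) → k record
          { positives = (c , 0<c) ∷ positives ; negatives = negatives ; zeros = zeros
          ; exhaustive = λ where
              (here ≡.refl) → inj₁ (0<c , here ≡.refl)
              (there c∈cs) → Sum.map₁ (map₂ there) (exhaustive c∈cs) }
        (inj₂ (inj₁ 0≈c)) → k record
          { positives = positives ; negatives = negatives ; zeros = (c , sym 0≈c) ∷ zeros
          ; exhaustive = λ where
              (here ≡.refl) → inj₂ (inj₂ (sym 0≈c , here ≡.refl))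
              (there c∈cs) → Sum.map₂ (Sum.map₂ (map₂ there)) (exhaustive c∈cs) }
        (inj₂ (inj₂ c<0)) → k record
          { positives = positives ; negatives = (c , c<0) ∷ negatives ; zeros = zeros
          ; exhaustive = λ where
              (here ≡.refl) → inj₂ (inj₁ (c<0 , here ≡.refl))
              (there c∈cs) → Sum.map₂ (Sum.map₁ (map₂ there)) (exhaustive c∈cs) }

      -- Each measure is weighted by the absolute slope of the other, both weights being
      -- nonnegative, so the coefficient of `h` cancels.
      combine : Σ[ c ∈ Constraint ks ] 0# < slope c → Σ[ c ∈ Constraint ks ] slope c < 0# → Constraint (h ∷ ks)
      combine ((μ , killsμ) , 0<μh) ((ν , killsν) , νh<0) =
        scaled (- ∫ ν h) (0≤- νh<0) μ ⊞⁺ scaled (∫ μ h) (<⇒≤ 0<μh) ν ,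
        solve 2 (λ a b → (:- b) :* a :+ a :* b := con (+ 0)) refl (∫ μ h) (∫ ν h)
        ∷ All.zipWith (λ (μk≈0 , νk≈0) → trans (+-cong (*-congˡ μk≈0) (*-congˡ νk≈0))
            (solve 2 (λ a b → a :* con (+ 0) :+ b :* con (+ 0) := con (+ 0)) refl (- ∫ ν h) (∫ μ h)))
            (killsμ , killsν)

      keep : Σ[ c ∈ Constraint ks ] slope c ≈ 0# → Constraint (h ∷ ks)
      keep ((μ , killsμ) , μh≈0) = μ , μh≈0 ∷ killsμ

      eliminate : ∀ {cs} → Sorted cs → List (Constraint (h ∷ ks))
      eliminate sorted = List.map keep zeros ++ cartesianProductWith combine positives negatives
        where open Sorted sorted

      -- Constraints of positive slope bound `y` below, those of negative slope bound it above, and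
      -- those of slope zero do not restrict it. After clearing denominators, the combined
      -- constraint of a pair says exactly that its lower bound is at most its upper bound.
      extend : ∀ {cs} (sorted : Sorted cs) (g : X → Carrier) →
        (∀ {c} → c ∈ eliminate sorted → 0# ≤ ∫ (proj₁ c) g) →
        ¬ ¬ (∃[ y ] ∀ {c} → c ∈ cs → 0# ≤ ∫ (proj₁ c) (λ x → y * h x + g x))
      extend {cs} sorted g feasible k = between lo hi positives negatives lo≤hi
        λ (y , above , below) → k (y , satisfied above below)
        where
        open Sorted sorted

        lo : Σ[ c ∈ Constraint ks ] 0# < slope c → Carrier
        lo ((μ , _) , 0<μh) = - (∫ μ g * proj₁ (reciprocal 0<μh))

        hi : Σ[ c ∈ Constraint ks ] slope c < 0# → Carrier
        hi ((ν , _) , νh<0) = ∫ ν g * proj₁ (reciprocal (<⇒0< νh<0))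

        lo≤hi : ∀ {p q} → p ∈ positives → q ∈ negatives → lo p ≤ hi q
        lo≤hi {p@((μ , _) , 0<μh)} {q@((ν , _) , νh<0)} p∈ q∈ =
          0≤⇒≤ (≤-respʳ-≈ equal (*-nonneg (*-nonneg (<⇒≤ 0<r) (<⇒≤ 0<s)) combined))
          where
          r = proj₁ (reciprocal 0<μh)
          s = proj₁ (reciprocal (<⇒0< νh<0))
          0<r = proj₁ (proj₂ (reciprocal 0<μh))
          0<s = proj₁ (proj₂ (reciprocal (<⇒0< νh<0)))
          r-inverse = proj₂ (proj₂ (reciprocal 0<μh))
          s-inverse = proj₂ (proj₂ (reciprocal (<⇒0< νh<0)))
          combined : 0# ≤ (- ∫ ν h) * ∫ μ g + ∫ μ h * ∫ ν g
          combined = feasible (∈-++⁺ʳ (List.map keep zeros) (∈-cartesianProductWith⁺ combine p∈ q∈))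
          equal : r * s * ((- ∫ ν h) * ∫ μ g + ∫ μ h * ∫ ν g) ≈ hi q - lo p
          equal = trans
            (solve 6 (λ r s a b A B → r :* s :* ((:- b) :* A :+ a :* B)
              := B :* s :* (a :* r) :+ A :* r :* ((con (+ 0) :- b) :* s))
              refl r s (∫ μ h) (∫ ν h) (∫ μ g) (∫ ν g))
            (trans (+-cong (*-congˡ r-inverse) (*-congˡ s-inverse))
              (solve 4 (λ r s A B → B :* s :* con (+ 1) :+ A :* r :* con (+ 1) := B :* s :- (:- (A :* r)))
                refl r s (∫ μ g) (∫ ν g)))

        satisfied : ∀ {y} → (∀ {p} → p ∈ positives → lo p ≤ y) → (∀ {q} → q ∈ negatives → y ≤ hi q) →
          ∀ {c} → c ∈ cs → 0# ≤ ∫ (proj₁ c) (λ x → y * h x + g x)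
        satisfied {y} above below {c@(μ , _)} c∈cs = ≤-respʳ-≈
          (sym (trans (additive (functional μ) _ g) (+-congʳ (homogeneous (functional μ) y h))))
          (by (exhaustive c∈cs))
          where
          by : (∃[ p ] (c , p) ∈ positives) ⊎ (∃[ p ] (c , p) ∈ negatives) ⊎ (∃[ p ] (c , p) ∈ zeros) →
            0# ≤ y * ∫ μ h + ∫ μ g
          by (inj₁ (0<μh , c∈)) = ≤-respʳ-≈ equal (*-nonneg (<⇒≤ 0<μh) (≤⇒0≤ (above c∈)))
            where
            r = proj₁ (reciprocal 0<μh)
            equal : ∫ μ h * (y - lo (c , 0<μh)) ≈ y * ∫ μ h + ∫ μ g
            equal = trans
              (solve 4 (λ a y A r → a :* (y :- (:- (A :* r))) := y :* a :+ A :* (a :* r)) refl (∫ μ h) y (∫ μ g) r)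
              (+-congˡ (trans (*-congˡ (proj₂ (proj₂ (reciprocal 0<μh)))) (*-identityʳ _)))
          by (inj₂ (inj₁ (μh<0 , c∈))) = ≤-respʳ-≈ equal (*-nonneg (<⇒≤ (<⇒0< μh<0)) (≤⇒0≤ (below c∈)))
            where
            s = proj₁ (reciprocal (<⇒0< μh<0))
            equal : (0# - ∫ μ h) * (hi (c , μh<0) - y) ≈ y * ∫ μ h + ∫ μ g
            equal = trans
              (solve 4 (λ a y A s → (con (+ 0) :- a) :* (A :* s :- y) := y :* a :+ A :* ((con (+ 0) :- a) :* s))
                refl (∫ μ h) y (∫ μ g) s)
              (+-congˡ (trans (*-congˡ (proj₂ (proj₂ (reciprocal (<⇒0< μh<0))))) (*-identityʳ _)))
          by (inj₂ (inj₂ (μh≈0 , c∈))) = ≤-respʳ-≈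
            (trans (sym (+-identityˡ _)) (+-congʳ (sym (trans (*-congˡ μh≈0) (zeroʳ y)))))
            (feasible (∈-++⁺ˡ (∈-map⁺ keep c∈)))

    check : (b : X → Carrier) → ∀ {ks} (cs : List (Constraint ks)) →
      ¬ ¬ ((∀ {c} → c ∈ cs → 0# ≤ ∫ (proj₁ c) b) ⊎ (∃[ μ ] Kills ks μ × ∫ μ b < 0#))
    check b [] k = k (inj₁ λ ())
    check b ((μ , kills) ∷ cs) k = <-or-≥ (∫ μ b) 0# λ where
      (inj₁ μb<0) → k (inj₂ (μ , kills , μb<0))
      (inj₂ 0≤μb) → check b cs λ where
        (inj₂ infeasible) → k (inj₂ infeasible)
        (inj₁ feasible)   → k (inj₁ λ { (here ≡.refl) → 0≤μb ; (there c∈cs) → feasible c∈cs })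

    -- Fourier–Motzkin elimination of the coefficients of the functions hs, one at a time.  A derived
    -- constraint is a positive combination of the given ones, so it is again a measure.
    farkas : (𝒫 : (X → Carrier) → Set) → 𝒫 (λ _ → 0#) → (b : X → Carrier) →
      ∀ {ks} hs → All (λ h → ∀ y {g} → 𝒫 g → 𝒫 (λ x → y * h x + g x)) hs → (cs : List (Constraint ks)) →
      ¬ ¬ ((∃[ g ] 𝒫 g × (∀ {c} → c ∈ cs → 0# ≤ ∫ (proj₁ c) (λ x → g x + b x)))
         ⊎ (∃[ μ ] Kills hs μ × Kills ks μ × ∫ μ b < 0#))
    farkas 𝒫 𝒫0 b [] [] cs k = check b cs λ where
      (inj₁ feasible) → k (inj₁ ((λ _ → 0#) , 𝒫0 , λ {c} c∈cs →
        ≤-respʳ-≈ (apply-cong (functional (proj₁ c)) (λ x → sym (+-identityˡ (b x)))) (feasible c∈cs)))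
      (inj₂ (μ , kills , μb<0)) → k (inj₂ (μ , [] , kills , μb<0))
    farkas 𝒫 𝒫0 b (h ∷ hs) (closed ∷ closeds) cs k = sort h cs λ sorted →
      farkas 𝒫 𝒫0 b hs closeds (eliminate h sorted) λ where
        (inj₂ (μ , kills-hs , kills-h ∷ kills-ks , μb<0)) → k (inj₂ (μ , kills-h ∷ kills-hs , kills-ks , μb<0))
        (inj₁ (g , 𝒫g , feasible)) → extend h sorted _ feasible λ (y , feasible′) →
          k (inj₁ (_ , closed y 𝒫g , λ {c} c∈cs →
            ≤-respʳ-≈ (apply-cong (functional (proj₁ c)) (λ x → sym (+-assoc (y * h x) (g x) (b x))))
                (feasible′ c∈cs)))

-- Low-degree functions on the cube

module LowDegreeFunctions (R : Reals) where

  open Reals R hiding (zero)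
  open RealNotions R
  open OrderedField R
  open Functionals R

  monomial : ∀ {N} → Vec ℕ N → Vec Sign N → Carrier
  monomial α x = evalMonomial α (Vec.map fromSign x)

  LowDegree : ∀ {N} → ℕ → (Vec Sign N → Carrier) → Set
  LowDegree {N} d g = Σ[ p ∈ Polynomial N ] DegreeAtMost d p × (∀ x → eval p (Vec.map fromSign x) ≈ g x)

  lowDegree-cong : ∀ {N d} {g h : Vec Sign N → Carrier} → (∀ x → g x ≈ h x) → LowDegree d g → LowDegree d h
  lowDegree-cong g≈h (p , deg , eq) = p , deg , λ x → trans (eq x) (g≈h x)

  lowDegree-weaken : ∀ {N d e} {g : Vec Sign N → Carrier} → d ℕ.≤ e → LowDegree d g → LowDegree e g
  lowDegree-weaken d≤e (p , deg , eq) = p , All.map (λ { {_ , _} le → ℕ.≤-trans le d≤e }) deg , eq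

  lowDegree-monomial : ∀ {N d} (α : Vec ℕ N) → Vec.sum α ℕ.≤ d → LowDegree d (monomial α)
  lowDegree-monomial α le = (1# , α) ∷ [] , le ∷ [] , λ x → trans (+-identityʳ _) (*-identityˡ _)

  sum-zeros : ∀ N → Vec.sum (Vec.replicate N 0) ≡ 0
  sum-zeros zero    = ≡.refl
  sum-zeros (suc N) = sum-zeros N

  monomial-zeros : ∀ {N} (x : Vec Sign N) → monomial (Vec.replicate N 0) x ≈ 1#
  monomial-zeros []      = refl
  monomial-zeros (s ∷ x) = trans (*-identityˡ _) (monomial-zeros x)

  indicator : ∀ {N} → Fin N → Vec ℕ N
  indicator {suc N} zero    = 1 ∷ Vec.replicate N 0
  indicator {suc N} (suc i) = 0 ∷ indicator i

  lowDegree-variable : ∀ {N} (i : Fin N) → LowDegree 1 (λ x → fromSign (lookup x i))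
  lowDegree-variable i = lowDegree-cong (value i) (lowDegree-monomial (indicator i) (ℕ.≤-reflexive (degree i)))
    where
    degree : ∀ {N} (i : Fin N) → Vec.sum (indicator i) ≡ 1
    degree {suc N} zero    = ≡.cong suc (sum-zeros N)
    degree {suc N} (suc i) = degree i
    value : ∀ {N} (i : Fin N) x → monomial (indicator i) x ≈ fromSign (lookup x i)
    value {suc N} zero (s ∷ x) = trans (*-cong (*-identityʳ _) (monomial-zeros x)) (*-identityʳ _)
    value {suc N} (suc i) (s ∷ x) = trans (*-identityˡ _) (value i x)

  eval-++ : ∀ {N} (p q : Polynomial N) v → eval (p ++ q) v ≈ eval p v + eval q v
  eval-++ []            q v = sym (+-identityˡ _)
  eval-++ ((a , α) ∷ p) q v = trans (+-congˡ (eval-++ p q v)) (sym (+-assoc _ _ _))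

  lowDegree-+ : ∀ {N d} {g h : Vec Sign N → Carrier} →
    LowDegree d g → LowDegree d h → LowDegree d (λ x → g x + h x)
  lowDegree-+ (p , p≤d , p≈g) (q , q≤d , q≈h) =
    p ++ q , All.++⁺ p≤d q≤d , λ x → trans (eval-++ p q _) (+-cong (p≈g x) (q≈h x))

  evalMonomial-+ : ∀ {N} (α β : Vec ℕ N) v →
    evalMonomial (Vec.zipWith ℕ._+_ α β) v ≈ evalMonomial α v * evalMonomial β v
  evalMonomial-+ []      []      []      = sym (*-identityˡ 1#)
  evalMonomial-+ (a ∷ α) (b ∷ β) (x ∷ v) = trans
    (*-cong (^-homo-* x a b) (evalMonomial-+ α β v))
    (solve 4 (λ a b c d → a :* b :* (c :* d) := a :* c :* (b :* d)) refl (x ^ a) (x ^ b) _ _)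

  interchange : ∀ a b c d → a ℕ.+ b ℕ.+ (c ℕ.+ d) ≡ a ℕ.+ c ℕ.+ (b ℕ.+ d)
  interchange = ℕ-Solver.solve-∀

  sum-zipWith-+ : ∀ {N} (α β : Vec ℕ N) → Vec.sum (Vec.zipWith ℕ._+_ α β) ≡ Vec.sum α ℕ.+ Vec.sum β
  sum-zipWith-+ []      []      = ≡.refl
  sum-zipWith-+ (a ∷ α) (b ∷ β) = ≡.trans (≡.cong (a ℕ.+ b ℕ.+_) (sum-zipWith-+ α β))
    (interchange a b (Vec.sum α) (Vec.sum β))

  termTimes : ∀ {N} → Carrier × Vec ℕ N → Polynomial N → Polynomial N
  termTimes (a , α) []            = []
  termTimes (a , α) ((b , β) ∷ q) = (a * b , Vec.zipWith ℕ._+_ α β) ∷ termTimes (a , α) q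

  eval-termTimes : ∀ {N} a α (q : Polynomial N) v →
    eval (termTimes (a , α) q) v ≈ a * evalMonomial α v * eval q v
  eval-termTimes a α []            v = sym (zeroʳ _)
  eval-termTimes a α ((b , β) ∷ q) v = trans
    (+-cong (*-congˡ (evalMonomial-+ α β v)) (eval-termTimes a α q v))
    (solve 5 (λ a b α β q → a :* b :* (α :* β) :+ a :* α :* q := a :* α :* (b :* β :+ q)) refl
      a b (evalMonomial α v) (evalMonomial β v) (eval q v))

  degree-termTimes : ∀ {N d e} a (α : Vec ℕ N) {q} → Vec.sum α ℕ.≤ d → DegreeAtMost e q →
    DegreeAtMost (d ℕ.+ e) (termTimes (a , α) q)
  degree-termTimes a α le [] = []
  degree-termTimes {d = d} {e} a α {(b , β) ∷ q} le (leβ ∷ q≤e) =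
    ≡.subst (ℕ._≤ d ℕ.+ e) (≡.sym (sum-zipWith-+ α β)) (ℕ.+-mono-≤ le leβ) ∷ degree-termTimes a α le q≤e

  times : ∀ {N} → Polynomial N → Polynomial N → Polynomial N
  times []      q = []
  times (t ∷ p) q = termTimes t q ++ times p q

  eval-times : ∀ {N} (p q : Polynomial N) v → eval (times p q) v ≈ eval p v * eval q v
  eval-times []            q v = sym (zeroˡ _)
  eval-times ((a , α) ∷ p) q v = trans (eval-++ (termTimes (a , α) q) (times p q) v)
    (trans (+-cong (eval-termTimes a α q v) (eval-times p q v)) (sym (distribʳ _ _ _)))

  lowDegree-* : ∀ {N d e} {g h : Vec Sign N → Carrier} →
    LowDegree d g → LowDegree e h → LowDegree (d ℕ.+ e) (λ x → g x * h x)
  lowDegree-* {d = d} {e} (p , p≤d , p≈g) (q , q≤e , q≈h) =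
    times p q , degree p≤d , λ x → trans (eval-times p q _) (*-cong (p≈g x) (q≈h x))
    where
    degree : ∀ {p} → DegreeAtMost d p → DegreeAtMost (d ℕ.+ e) (times p q)
    degree {[]}          []         = []
    degree {(a , α) ∷ p} (le ∷ les) = All.++⁺ (degree-termTimes a α le q≤e) (degree les)

  lowDegree-const : ∀ {N} d c → LowDegree {N} d (λ _ → c)
  lowDegree-const {N} d c = (c , Vec.replicate N 0) ∷ [] , ℕ.≤-trans (ℕ.≤-reflexive (sum-zeros N)) ℕ.z≤n ∷ [] ,
    λ x → trans (+-identityʳ _) (trans (*-congˡ (monomial-zeros x)) (*-identityʳ c))

  lowDegree-scale : ∀ {N d} c {g : Vec Sign N → Carrier} → LowDegree d g → LowDegree d (λ x → c * g x)
  lowDegree-scale c low = lowDegree-* (lowDegree-const 0 c) low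

  lowDegree-neg : ∀ {N d} {g : Vec Sign N → Carrier} → LowDegree d g → LowDegree d (λ x → - g x)
  lowDegree-neg {g = g} low = lowDegree-cong (λ x → solve 1 (λ a → (:- con (+ 1)) :* a := :- a) refl (g x))
    (lowDegree-scale (- 1#) low)

  lowDegree-sum : ∀ {N d n} {g : Fin n → Vec Sign N → Carrier} →
    (∀ i → LowDegree d (g i)) → LowDegree d (λ x → sum (λ i → g i x))
  lowDegree-sum {d = d} {zero}  low = lowDegree-const d 0#
  lowDegree-sum {n = suc n} low = lowDegree-+ (low zero) (lowDegree-sum (low ∘ suc))

  -- Amplification of a weak approximation

  module Amplification where

    half : Carrier
    half = 1/ 2

    half+half : half + half ≈ 1#
    half+half = trans (solve 1 (λ h → h :+ h := con (+ 2) :* h) refl half) (1/-inverse 2)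

    -- A cubic fixing 0 and ±1 and moving the other points of [-1,1] towards ±1.
    push : Carrier → Carrier
    push t = half * (t + t + t - t * t * t)

    push^ : ℕ → Carrier → Carrier
    push^ zero    t = t
    push^ (suc j) t = push (push^ j t)

    triple : ∀ a d → a ℕ.* d ℕ.+ a ℕ.* d ℕ.+ a ℕ.* d ≡ 3 ℕ.* a ℕ.* d
    triple = ℕ-Solver.solve-∀

    lowDegree-push^ : ∀ {N d} j {g : Vec Sign N → Carrier} → LowDegree d g →
        LowDegree (3 ℕ.^ j ℕ.* d) (push^ j ∘ g)
    lowDegree-push^ {d = d} zero low = lowDegree-weaken (ℕ.≤-reflexive (≡.sym (ℕ.*-identityˡ d))) low
    lowDegree-push^ {d = d} (suc j) {g} low = lowDegree-scale half
      (lowDegree-+ (lowDegree-weaken e≤3e (lowDegree-+ (lowDegree-+ low′ low′) low′))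
        (lowDegree-neg (lowDegree-weaken (ℕ.≤-reflexive 3e) (lowDegree-* (lowDegree-* low′ low′) low′))))
      where
      e = 3 ℕ.^ j ℕ.* d
      low′ = lowDegree-push^ j low
      3e : e ℕ.+ e ℕ.+ e ≡ 3 ℕ.^ suc j ℕ.* d
      3e = triple (3 ℕ.^ j) d
      e≤3e : e ℕ.≤ 3 ℕ.^ suc j ℕ.* d
      e≤3e = ℕ.≤-trans (ℕ.≤-trans (ℕ.m≤m+n e e) (ℕ.m≤m+n _ e)) (ℕ.≤-reflexive 3e)

    InRange : Carrier → Set
    InRange t = 1# ≤ fromℕ 4 * t × t ≤ 1#

    0≤half : 0# ≤ half
    0≤half = *-cancelˡ-≤ (0<fromℕ 1) (≤-trans (≤-reflexive (zeroʳ _))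
        (≤-trans 0≤1 (≤-reflexive (sym (1/-inverse 2)))))

    module _ {t : Carrier} (range : InRange t) where

      private
        1≤4t = proj₁ range
        0≤1-t = ≤⇒0≤ (proj₂ range)
        0≤4t-1 = ≤⇒0≤ 1≤4t

        0≤t : 0# ≤ t
        0≤t = *-cancelˡ-≤ (0<fromℕ 3) (≤-trans (≤-reflexive (zeroʳ _)) (≤-trans 0≤1 1≤4t))

        1-push : 1# - push t ≈ half * ((1# - t) * (1# - t) * (1# + 1# + t))
        1-push = trans (+-congʳ (sym half+half)) (solve 2 (λ h t →
          h :+ h :- h :* (t :+ t :+ t :- t :* t :* t) :=
          h :* ((con (+ 1) :- t) :* (con (+ 1) :- t) :* (con (+ 1) :+ con (+ 1) :+ t))) refl half t)

        push-t : push t - t ≈ half * (t * ((1# - t) * (1# + t)))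
        push-t = trans (+-congˡ (-‿cong (trans (sym (*-identityˡ t)) (*-congʳ (sym half+half))))) (solve 2 (λ h t →
          h :* (t :+ t :+ t :- t :* t :* t) :- (h :+ h) :* t :=
          h :* (t :* ((con (+ 1) :- t) :* (con (+ 1) :+ t)))) refl half t)

      push-range : InRange (push t)
      push-range =
        ≤-trans 1≤4t (*-monoˡ-≤ (0≤fromℕ 4) (0≤⇒≤ (≤-respʳ-≈ (sym push-t)
          (*-nonneg 0≤half (*-nonneg 0≤t (*-nonneg 0≤1-t (+-nonneg 0≤1 0≤t))))))) ,
        0≤⇒≤ (≤-respʳ-≈ (sym 1-push)
          (*-nonneg 0≤half (*-nonneg (*-nonneg 0≤1-t 0≤1-t) (+-nonneg (+-nonneg 0≤1 0≤1) 0≤t))))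

      -- Here 1 - `push t` = (1 - t)²(2 + t)/2, and 7 - 4(1 - t)(2 + t) = (4t - 1) + 4t², which is
      -- nonnegative from t = 1/4 on. So each round shrinks the distance to 1 by a factor 7/8.
      push-gap : fromℕ 8 * (1# - push t) ≤ fromℕ 7 * (1# - t)
      push-gap = 0≤⇒≤ (≤-respʳ-≈ (sym (trans (+-congˡ (-‿cong gap)) factor))
        (*-nonneg 0≤1-t (+-nonneg 0≤4t-1 (*-nonneg (*-nonneg (0≤fromℕ 4) 0≤t) 0≤t))))
        where
        gap : fromℕ 8 * (1# - push t) ≈ fromℕ 4 * ((1# - t) * (1# - t) * (1# + 1# + t))
        gap = trans (*-congˡ 1-push) (trans
          (solve 2 (λ h u → con (+ 8) :* (h :* u) := con (+ 4) :* ((h :+ h) :* u)) refl half _)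
          (*-congˡ (trans (*-congʳ half+half) (*-identityˡ _))))
        factor : fromℕ 7 * (1# - t) - fromℕ 4 * ((1# - t) * (1# - t) * (1# + 1# + t))
          ≈ (1# - t) * ((fromℕ 4 * t - 1#) + fromℕ 4 * t * t)
        factor = solve 1 (λ t → con (+ 7) :* (con (+ 1) :- t)
          :- con (+ 4) :* ((con (+ 1) :- t) :* (con (+ 1) :- t) :* (con (+ 1) :+ con (+ 1) :+ t))
          := (con (+ 1) :- t) :* ((con (+ 4) :* t :- con (+ 1)) :+ con (+ 4) :* t :* t)) refl t

    push^-range : ∀ j {t} → InRange t → InRange (push^ j t)
    push^-range zero    range = range
    push^-range (suc j) range = push-range (push^-range j range)

    push^-gap : ∀ j {t} → InRange t → fromℕ (8 ℕ.^ j) * (1# - push^ j t) ≤ fromℕ (7 ℕ.^ j) * (1# - t)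
    push^-gap zero        range = ≤-refl
    push^-gap (suc j) {t} range = begin
      fromℕ (8 ℕ.* 8 ℕ.^ j) * (1# - push^ (suc j) t)     ≈⟨ shuffle 8 (8 ℕ.^ j) _ ⟩
      fromℕ (8 ℕ.^ j) * (fromℕ 8 * (1# - push^ (suc j) t)) ≤⟨ *-monoˡ-≤ (0≤fromℕ (8 ℕ.^ j))
          (push-gap (push^-range j range)) ⟩
      fromℕ (8 ℕ.^ j) * (fromℕ 7 * (1# - push^ j t))       ≈⟨ solve 3
          (λ a b c → a :* (b :* c) := b :* (a :* c)) refl _ _ _ ⟩
      fromℕ 7 * (fromℕ (8 ℕ.^ j) * (1# - push^ j t))       ≤⟨ *-monoˡ-≤ (0≤fromℕ 7) (push^-gap j range) ⟩
      fromℕ 7 * (fromℕ (7 ℕ.^ j) * (1# - t))               ≈⟨ sym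
          (trans (*-congʳ (fromℕ-* 7 (7 ℕ.^ j))) (*-assoc _ _ _)) ⟩
      fromℕ (7 ℕ.* 7 ℕ.^ j) * (1# - t)                     ∎
      where
      open ≤-Reasoning
      shuffle : ∀ a b c → fromℕ (a ℕ.* b) * c ≈ fromℕ b * (fromℕ a * c)
      shuffle a b c = trans (*-congʳ (fromℕ-* a b)) (solve 3 (λ a b c → a :* b :* c := b :* (a :* c)) refl
          (fromℕ a) (fromℕ b) c)

    -- The initial distance to 1 is at most 3/4, and (7/8)^10 · 3/4 ≤ 1/5.
    rounds : ℕ
    rounds = 10

    push^-rounds : ∀ {t} → InRange t → 1# - push^ rounds t ≤ 1/ 5
    push^-rounds {t} range@(1≤4t , _) = *-cancelˡ-≤ 0<5 (≤-trans scaled-gap (≤-reflexive (sym (1/-inverse 5))))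
      where
      open ≤-Reasoning
      0<5 = 0<fromℕ 4
      gap = 1# - push^ rounds t
      numeric : 7 ℕ.^ rounds ℕ.* 15 ℕ.≤ 8 ℕ.^ rounds ℕ.* 4
      numeric = ℕ.≤ᵇ⇒≤ (7 ℕ.^ rounds ℕ.* 15) (8 ℕ.^ rounds ℕ.* 4) tt
      quarter : fromℕ 4 * (1# - t) ≤ fromℕ 3
      quarter = 0≤⇒≤ (≤-respʳ-≈ (solve 1 (λ t → con (+ 4) :* t :- con (+ 1) := con (+ 3) :- con (+ 4) :*
          (con (+ 1) :- t)) refl t)
        (≤⇒0≤ 1≤4t))
      -- The powers of 7 and 8 are generalised to variables, so that the chain of inequalities never
      -- works with their numerals.
      general : ∀ a b → a ℕ.* 15 ℕ.≤ b ℕ.* 4 → fromℕ b * gap ≤ fromℕ a * (1# - t) →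
        fromℕ b * (fromℕ 4 * (fromℕ 5 * gap)) ≤ fromℕ b * (fromℕ 4 * 1#)
      general a b le gap≤ = begin
        fromℕ b * (fromℕ 4 * (fromℕ 5 * gap)) ≈⟨ solve 2
            (λ b g → b :* (con (+ 4) :* (con (+ 5) :* g)) := con (+ 20) :* (b :* g)) refl (fromℕ b) gap ⟩
        fromℕ 20 * (fromℕ b * gap)            ≤⟨ *-monoˡ-≤ (0≤fromℕ 20) gap≤ ⟩
        fromℕ 20 * (fromℕ a * (1# - t))       ≈⟨ solve 2
            (λ a g → con (+ 20) :* (a :* g) := con (+ 5) :* a :* (con (+ 4) :* g)) refl (fromℕ a) (1# - t) ⟩
        fromℕ 5 * fromℕ a * (fromℕ 4 * (1# - t)) ≤⟨ *-monoˡ-≤ (*-nonneg (0≤fromℕ 5) (0≤fromℕ a)) quarter ⟩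
        fromℕ 5 * fromℕ a * fromℕ 3           ≈⟨ solve 1
            (λ a → con (+ 5) :* a :* con (+ 3) := a :* con (+ 15)) refl (fromℕ a) ⟩
        fromℕ a * fromℕ 15                    ≈⟨ sym (fromℕ-* a 15) ⟩
        fromℕ (a ℕ.* 15)                      ≤⟨ fromℕ-mono-≤ le ⟩
        fromℕ (b ℕ.* 4)                       ≈⟨ fromℕ-* b 4 ⟩
        fromℕ b * fromℕ 4                     ≈⟨ *-congˡ (sym (*-identityʳ _)) ⟩
        fromℕ b * (fromℕ 4 * 1#)              ∎
      scaled-gap : fromℕ 5 * gap ≤ 1#
      scaled-gap = *-cancelˡ-≤ (0<fromℕ 3) (*-cancelˡ-≤ 0<8^
          (general (7 ℕ.^ rounds) (8 ℕ.^ rounds) numeric (push^-gap rounds range)))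
        where
        0<8^ : 0# < fromℕ (8 ℕ.^ rounds)
        0<8^ = fromℕ-mono-< {0} (ℕ.m^n>0 8 rounds)

    fromSign-square : ∀ s → fromSign s * fromSign s ≈ 1#
    fromSign-square Sign.+ = *-identityˡ 1#
    fromSign-square Sign.- = solve 0 ((:- con (+ 1)) :* (:- con (+ 1)) := con (+ 1)) refl

    -- The hypothesis concerns f p, but f itself need not have low degree. Oddness moves the sign
    -- outside, so that the cubic is applied to p alone and the degree is only multiplied by a
    -- constant.
    push^-odd : ∀ j s p → push^ j (fromSign s * p) ≈ fromSign s * push^ j p
    push^-odd zero    s p = refl
    push^-odd (suc j) s p = trans
      (*-congˡ (+-cong (+-cong (+-cong e e) e) (-‿cong (*-cong (*-cong e e) e))))
      (trans (solve 3 (λ h s p → h :* (s :* p :+ s :* p :+ s :* p :- s :* p :* (s :* p) :* (s :* p))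
          := s :* (h :* (p :+ p :+ p :- (s :* s) :* (p :* p :* p)))) refl half (fromSign s) (push^ j p))
        (*-congˡ (*-congˡ (+-congˡ (-‿cong (trans (*-congʳ (fromSign-square s)) (*-identityˡ _)))))))
      where e = push^-odd j s p

    approximates : ∀ s {p} → InRange (fromSign s * p) → ∣ fromSign s - push^ rounds p ∣≤ (1/ 5)
    approximates s {p} range = bound s gap≤ 0≤gap
      where
      q = push^ rounds p
      oddness : 1# - push^ rounds (fromSign s * p) ≈ 1# - fromSign s * q
      oddness = +-congˡ (-‿cong (push^-odd rounds s p))
      gap≤ : 1# - fromSign s * q ≤ 1/ 5
      gap≤ = ≤-respˡ-≈ oddness (push^-rounds range)
      0≤gap : 0# ≤ 1# - fromSign s * q
      0≤gap = ≤-respʳ-≈ oddness (≤⇒0≤ (proj₂ (push^-range rounds range)))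
      -ε≤0 : - (1/ 5) ≤ 0#
      -ε≤0 = ≤-respʳ-≈ (solve 0 (:- con (+ 0) := con (+ 0)) refl) (neg-mono-≤ (≤-trans 0≤gap gap≤))
      bound : ∀ s → 1# - fromSign s * q ≤ 1/ 5 → 0# ≤ 1# - fromSign s * q → ∣ fromSign s - q ∣≤ (1/ 5)
      bound Sign.+ gap≤ 0≤gap = ≤-trans -ε≤0 (≤-respʳ-≈ eq 0≤gap) , ≤-respˡ-≈ eq gap≤
        where
        eq : 1# - 1# * q ≈ 1# - q
        eq = +-congˡ (-‿cong (*-identityˡ q))
      bound Sign.- gap≤ 0≤gap = ≤-respʳ-≈ eq (neg-mono-≤ gap≤) ,
        ≤-respˡ-≈ eq (≤-trans (neg-mono-≤ 0≤gap) (≤-trans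
            (≤-reflexive (solve 0 (:- con (+ 0) := con (+ 0)) refl)) (≤-trans 0≤gap gap≤)))
        where
        eq : - (1# - - 1# * q) ≈ - 1# - q
        eq = solve 1 (λ q → :- (con (+ 1) :- (:- con (+ 1)) :* q) := :- con (+ 1) :- q) refl q

-- Dual measures for the approximate degree

exponents : ∀ m → ℕ → List (Vec ℕ m)
exponents zero    e = [] ∷ []
exponents (suc m) e = cartesianProductWith _∷_ (List.upTo (suc e)) (exponents m e)

∈-exponents : ∀ {m e} (α : Vec ℕ m) → Vec.sum α ℕ.≤ e → α ∈ exponents m e
∈-exponents []      le = here ≡.refl
∈-exponents (a ∷ α) le = ∈-cartesianProductWith⁺ _∷_
  (∈-upTo⁺ (ℕ.s≤s (ℕ.m+n≤o⇒m≤o a le))) (∈-exponents α (ℕ.m+n≤o⇒n≤o a le))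

signs : List Sign
signs = Sign.+ ∷ Sign.- ∷ []

cube : ∀ m → List (Vec Sign m)
cube zero    = [] ∷ []
cube (suc m) = cartesianProductWith _∷_ signs (cube m)

∈-cube : ∀ {m} (x : Vec Sign m) → x ∈ cube m
∈-cube []           = here ≡.refl
∈-cube (Sign.+ ∷ x) = ∈-cartesianProductWith⁺ _∷_ {xs = signs} (here ≡.refl) (∈-cube x)
∈-cube (Sign.- ∷ x) = ∈-cartesianProductWith⁺ _∷_ {xs = signs} (there (here ≡.refl)) (∈-cube x)

abstract
  -- The degree of the amplifying polynomial.
  boost : ℕ
  boost = 3 ℕ.^ 10

  boost≡ : boost ≡ 3 ℕ.^ 10
  boost≡ = ≡.refl

instance
  boost-nonZero : ℕ.NonZero boost
  boost-nonZero = ≡.subst ℕ.NonZero (≡.sym boost≡) _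

module DualMeasures (R : Reals) where

  open Reals R hiding (zero)
  open RealNotions R
  open OrderedField R
  open Functionals R
  open Farkas R
  open LowDegreeFunctions R
  open Amplification

  record DualPair {m} (f : BoolFun m) (τ : ℕ) : Set where
    field
      u w     : Measure (Vec Sign m)
      total-u : total u ≈ 1#
      total-w : total w ≤ 1#
      dual    : ∀ α → boost ℕ.* Vec.sum α ℕ.< τ →
        fromℕ 4 * ∫ u (λ x → fromSign (f x) * monomial α x) ≈ ∫ w (λ x → fromSign (f x) * monomial α x)

  module _ {m : ℕ} (f : BoolFun m) where

    private
      F : Vec Sign m → Carrier
      F x = fromSign (f x)

    -- The inequality `signed q + offset ≥ 0` reads 4 f q - 1 ≥ 0 on the first copy of the cube and
    -- 1 - f q ≥ 0 on the second. Together they say 1/4 ≤ f q ≤ 1, the range on which amplification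
    -- works.
    signed : (Vec Sign m → Carrier) → Vec Sign m × Bool → Carrier
    signed g (x , false) = fromℕ 4 * (F x * g x)
    signed g (x , true)  = - (F x * g x)

    offset : Vec Sign m × Bool → Carrier
    offset (x , false) = - 1#
    offset (x , true)  = 1#

    signed-linear : ∀ y g h xs → y * signed g xs + signed h xs ≈ signed (λ x → y * g x + h x) xs
    signed-linear y g h (x , false) = solve 4 (λ y s g h →
      y :* (con (+ 4) :* (s :* g)) :+ con (+ 4) :* (s :* h) := con (+ 4) :* (s :* (y :* g :+ h))) refl y (F x)
          (g x) (h x)
    signed-linear y g h (x , true)  = solve 4 (λ y s g h →
      y :* (:- (s :* g)) :+ (:- (s :* h)) := :- (s :* (y :* g :+ h))) refl y (F x) (g x) (h x)

    constraints : List (Constraint {Vec Sign m × Bool} [])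
    constraints = cartesianProductWith (λ x s → dirac (x , s) , []) (cube m) (false ∷ true ∷ [])

    ∈-constraints : ∀ x s → (dirac (x , s) , []) ∈ constraints
    ∈-constraints x false = ∈-cartesianProductWith⁺ _ (∈-cube x) (here ≡.refl)
    ∈-constraints x true  = ∈-cartesianProductWith⁺ _ (∈-cube x) (there (here ≡.refl))

    monomials : ℕ → List (Vec ℕ m)
    monomials e = List.filter (λ α → Vec.sum α ℕ.≤? e) (exponents m e)

    Signed : ℕ → (Vec Sign m × Bool → Carrier) → Set
    Signed e g = ∃[ q ] LowDegree e q × (∀ xs → g xs ≈ signed q xs)

    signed-zero : ∀ e → Signed e (λ _ → 0#)
    signed-zero e = (λ _ → 0#) , lowDegree-const e 0# , λ where
      (x , false) → sym (trans (*-congˡ (zeroʳ _)) (zeroʳ _))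
      (x , true)  → solve 1 (λ s → con (+ 0) := :- (s :* con (+ 0))) refl (F x)

    signed-closed : ∀ e → All (λ h → ∀ y {g} → Signed e g → Signed e (λ xs → y * h xs + g xs))
      (List.map (signed ∘ monomial) (monomials e))
    signed-closed e = All.map⁺ (All.map (λ {α} → closed {α})
        (All.all-filter (λ α → Vec.sum α ℕ.≤? e) (exponents m e)))
      where
      closed : ∀ {α} → Vec.sum α ℕ.≤ e → ∀ y {g} → Signed e g → Signed e (λ xs → y * signed (monomial α) xs + g xs)
      closed {α} α≤e y (q , low , eq) = (λ x → y * monomial α x + q x) ,
        lowDegree-+ (lowDegree-scale y (lowDegree-monomial α α≤e)) low ,
        λ xs → trans (+-congˡ (eq xs)) (signed-linear y (monomial α) q xs)

    -- A feasible `q` of degree `e` would be amplified to a 1/5-approximation of degree `boost * e`,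
    -- below the least possible degree `d`.
    no-feasible : ∀ {d e} → IsApproxDegree (1/ 5) f d → boost ℕ.* e ℕ.< d →
      ∀ {g} → Signed e g → ¬ (∀ {c} → c ∈ constraints → 0# ≤ ∫ (proj₁ c) (λ xs → g xs + offset xs))
    no-feasible {d} {e} (_ , least) e<d (q , low , eq) feasible = ℕ.<⇒≱ e<d (least _ (p , deg , λ x →
      let (lower , upper) = approximates (f x) (range x) in
      ≤-respʳ-≈ (+-congˡ (-‿cong (sym (p≈ x)))) lower , ≤-respˡ-≈ (+-congˡ (-‿cong (sym (p≈ x)))) upper))
      where
      pushed : LowDegree (boost ℕ.* e) (push^ rounds ∘ q)
      pushed = ≡.subst (λ b → LowDegree (b ℕ.* e) (push^ rounds ∘ q)) (≡.sym boost≡) (lowDegree-push^ rounds low)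
      p = proj₁ pushed
      deg = proj₁ (proj₂ pushed)
      p≈ = proj₂ (proj₂ pushed)
      range : ∀ x → InRange (F x * q x)
      range x = 0≤⇒≤ (≤-respʳ-≈ (+-congʳ (eq (x , false))) (feasible (∈-constraints x false))) ,
        0≤⇒≤ (≤-respʳ-≈ (trans (+-congʳ (eq (x , true))) (+-comm _ _)) (feasible (∈-constraints x true)))

    dualPair : ∀ {d τ} → IsApproxDegree (1/ 5) f d → suc τ ℕ.≤ d → ¬ ¬ DualPair f (suc τ)
    dualPair {d} {τ} approx τ<d k = farkas (Signed e) (signed-zero e) offset {[]}
      (List.map (signed ∘ monomial) (monomials e)) (signed-closed e) constraints λ where
        (inj₁ (g , low , feasible)) → no-feasible approx be<d low feasible
        (inj₂ (μ , kills , _ , μb<0)) → k (normalise μ kills μb<0)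
      where
      -- The largest `e` with `boost * e < suc τ`: small enough for `no-feasible`, and large enough
      -- to cover every monomial for which `dual` is demanded.
      e = τ ℕ./ boost
      be<d : boost ℕ.* e ℕ.< d
      be<d = ℕ.≤-trans (ℕ.s≤s (ℕ.≤-trans (ℕ.≤-reflexive (ℕ.*-comm boost e)) (ℕ.m/n*n≤m τ boost))) τ<d
      ≤e : ∀ a → boost ℕ.* a ℕ.< suc τ → a ℕ.≤ e
      ≤e a lt = ℕ.≤-trans (ℕ.≤-reflexive (≡.sym (ℕ.m*n/n≡m a boost)))
        (ℕ./-monoˡ-≤ boost (ℕ.≤-trans (ℕ.≤-reflexive (ℕ.*-comm a boost)) (ℕ.≤-pred lt)))

      -- The negative integral of `offset` says that `w₀` has less mass than `u₀`. Hence `u₀` has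
      -- positive mass, and dividing both measures by it gives the required masses. The equation
      -- `dual` is `∫ μ` of a signed monomial, split over the two copies.
      normalise : ∀ μ → Kills (List.map (signed ∘ monomial) (monomials e)) μ → ∫ μ offset < 0# → DualPair f (suc τ)
      normalise μ kills μb<0 = record
        { u = scaled r (<⇒≤ 0<r) u₀
        ; w = scaled r (<⇒≤ 0<r) w₀
        ; total-u = trans (*-comm r _) r-inverse
        ; total-w = ≤-trans (*-monoˡ-≤ (<⇒≤ 0<r) (<⇒≤ W<U)) (≤-reflexive (trans (*-comm r _) r-inverse))
        ; dual = λ α lt → trans (solve 3 (λ a b c → a :* (b :* c) := b :* (a :* c)) refl _ r _)
            (*-congˡ (dual α lt))
        }
        where
        u₀ = side false μ
        w₀ = side true μ
        difference : ∫ μ offset ≈ total w₀ - total u₀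
        difference = trans (side-split μ offset) (trans
          (+-congʳ (apply-const (functional u₀) (- 1#)))
          (solve 2 (λ u w → (:- con (+ 1)) :* u :+ w := w :- u) refl (total u₀) (total w₀)))
        W<U : total w₀ < total u₀
        W<U = 0<⇒< (<-respʳ-≈ (trans (+-identityˡ _) (trans (-‿cong difference)
          (solve 2 (λ u w → :- (w :- u) := u :- w) refl (total u₀) (total w₀)))) (<⇒0< μb<0))
        0<U : 0# < total u₀
        0<U = ≤-<-trans (positive w₀ (λ _ → 0≤1)) W<U
        r = proj₁ (reciprocal 0<U)
        0<r = proj₁ (proj₂ (reciprocal 0<U))
        r-inverse = proj₂ (proj₂ (reciprocal 0<U))
        dual : ∀ α → boost ℕ.* Vec.sum α ℕ.< suc τ →
          fromℕ 4 * ∫ u₀ (λ x → F x * monomial α x) ≈ ∫ w₀ (λ x → F x * monomial α x)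
        dual α lt = begin
          fromℕ 4 * U                          ≈⟨ solve 2 (λ u w → u := u :+ :- w :+ w) refl _ W ⟩
          fromℕ 4 * U + - W + W                ≈⟨ +-congʳ
              (trans (sym (+-cong (homogeneous (functional u₀) _ _) neg-W))
                                                    (trans (sym (side-split μ (signed (monomial α)))) killed)) ⟩
          0# + W                               ≈⟨ +-identityˡ W ⟩
          W                                    ∎
          where
          open import Relation.Binary.Reasoning.Setoid setoid
          U = ∫ u₀ (λ x → F x * monomial α x)
          W = ∫ w₀ (λ x → F x * monomial α x)
          neg-W : ∫ w₀ (λ x → - (F x * monomial α x)) ≈ - W
          neg-W = trans (apply-cong (functional w₀) (λ x → solve 1 (λ a → :- a := (:- con (+ 1)) :* a) refl _))
            (trans (homogeneous (functional w₀) (- 1#) _) (solve 1 (λ a → (:- con (+ 1)) :* a := :- a) refl W))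
          killed : ∫ μ (signed (monomial α)) ≈ 0#
          killed = All.lookup kills (∈-map⁺ (signed ∘ monomial)
            (∈-filter⁺ (λ α → Vec.sum α ℕ.≤? e) (∈-exponents α (≤e _ lt)) (≤e _ lt)))

-- The bound on products of functionals

Block : ℕ → ℕ → Set
Block n m = Vec (Vec Sign m) n

blockDegree : ∀ {n m} → Vec (Vec ℕ m) n → ℕ
blockDegree []       = 0
blockDegree (α ∷ αs) = Vec.sum α ℕ.+ blockDegree αs

-- Equal to 4^(k-1), except that it vanishes at 0.
fourPower : ℕ → ℕ
fourPower zero    = 0
fourPower (suc k) = 4 ℕ.^ k

-- An annihilator has norm at most `4 * size` and lowers the budget `k` by one. The lower budget
-- gains the factor 4, so only `size` is charged to the coordinate.
fourPower-suc : ∀ k → 4 ℕ.* fourPower k ℕ.≤ fourPower (suc k)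
fourPower-suc zero    = ℕ.z≤n
fourPower-suc (suc k) = ℕ.≤-refl

module ProductBound (R : Reals) (τ : ℕ) where

  open Reals R hiding (zero)
  open RealNotions R
  open OrderedField R
  open Functionals R
  open LowDegreeFunctions R
  open DualMeasures R using (DualPair)

  blockMonomial : ∀ {n m} → Vec (Vec ℕ m) n → Block n m → Carrier
  blockMonomial []       []       = 1#
  blockMonomial (α ∷ αs) (x ∷ xs) = monomial α x * blockMonomial αs xs

  BlockPolynomial : ℕ → ℕ → Set
  BlockPolynomial n m = List (Carrier × Vec (Vec ℕ m) n)

  evalBlocks : ∀ {n m} → BlockPolynomial n m → Block n m → Carrier
  evalBlocks []             xs = 0#
  evalBlocks ((c , α) ∷ ts) xs = c * blockMonomial α xs + evalBlocks ts xs

  -- Total degree measured in units of `τ / boost`, written without division. The bound is strict,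
  -- so `k` exceeds by one the number of annihilators that a term can survive.
  BlockDegreeBelow : ∀ {n m} → ℕ → BlockPolynomial n m → Set
  BlockDegreeBelow k = All (λ t → boost ℕ.* blockDegree (proj₂ t) ℕ.< k ℕ.* τ)

  record LowBlockDegree {n m} (k : ℕ) (G : Block n m → Carrier) : Set where
    constructor represented
    field
      terms   : BlockPolynomial n m
      degrees : BlockDegreeBelow k terms
      value   : ∀ xs → evalBlocks terms xs ≈ G xs

  -- No term can have degree below zero, so an exhausted budget leaves an empty sum.
  lowBlockDegree-0 : ∀ {n m} {G : Block n m → Carrier} → LowBlockDegree 0 G → ∀ xs → G xs ≈ 0#
  lowBlockDegree-0 (represented [] _ eq)            xs = sym (eq xs)
  lowBlockDegree-0 (represented (_ ∷ _) (() ∷ _) _) xs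

  lowBlockDegree-scale : ∀ {n m k} c {G : Block n m → Carrier} → LowBlockDegree k G →
      LowBlockDegree k (λ xs → c * G xs)
  lowBlockDegree-scale {n} {m} {k} c (represented ts deg eq) =
    represented (scale ts) (degree deg) (λ xs → trans (value ts xs) (*-congˡ (eq xs)))
    where
    scale : BlockPolynomial n m → BlockPolynomial n m
    scale []             = []
    scale ((a , α) ∷ ts) = (c * a , α) ∷ scale ts
    degree : ∀ {ts} → BlockDegreeBelow k ts → BlockDegreeBelow k (scale ts)
    degree []         = []
    degree (lt ∷ lts) = lt ∷ degree lts
    value : ∀ ts xs → evalBlocks (scale ts) xs ≈ c * evalBlocks ts xs
    value []             xs = sym (zeroʳ c)
    value ((a , α) ∷ ts) xs = trans (+-cong (*-assoc c a _) (value ts xs)) (sym (distribˡ c _ _))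

  apply-first : ∀ {n m k} (L : Functional (Vec Sign m)) {G : Block (suc n) m → Carrier} →
    LowBlockDegree k G → LowBlockDegree k (λ xs → apply L (λ x → G (x ∷ xs)))
  apply-first {n} {m} {k} L (represented ts deg eq) = represented (first ts) (degree deg) (λ xs →
    trans (value ts xs) (apply-cong L (λ x → eq (x ∷ xs))))
    where
    first : BlockPolynomial (suc n) m → BlockPolynomial n m
    first []                  = []
    first ((c , α ∷ αs) ∷ ts) = (c * apply L (monomial α) , αs) ∷ first ts
    degree : ∀ {ts} → BlockDegreeBelow k ts → BlockDegreeBelow k (first ts)
    degree []                             = []
    degree {(c , α ∷ αs) ∷ ts} (lt ∷ lts) =
      ℕ.≤-<-trans (ℕ.*-monoʳ-≤ boost (ℕ.m≤n+m (blockDegree αs) (Vec.sum α))) lt ∷ degree lts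
    value : ∀ ts xs → evalBlocks (first ts) xs ≈ apply L (λ x → evalBlocks ts (x ∷ xs))
    value []                  xs = sym (apply-zero L (λ _ → refl))
    value ((c , α ∷ αs) ∷ ts) xs = sym (trans (additive L _ _) (+-cong
      (trans (homogeneous L c _) (trans (*-congˡ (homogeneousʳ L (blockMonomial αs xs) (monomial α)))
          (sym (*-assoc c _ _))))
      (sym (value ts xs))))

  Annihilates : ∀ {m} → Functional (Vec Sign m) → Set
  Annihilates L = ∀ α → boost ℕ.* Vec.sum α ℕ.< τ → apply L (monomial α) ≈ 0#

  -- Only the monomials whose first block has degree at least τ / boost survive.
  apply-annihilator : ∀ {n m k} (L : Functional (Vec Sign m)) → Annihilates L → {G : Block (suc n) m → Carrier} →
    LowBlockDegree (suc k) G → LowBlockDegree k (λ xs → apply L (λ x → G (x ∷ xs)))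
  apply-annihilator {n} {m} {k} L kills {G} (represented ts deg eq) = resulting (survivors ts deg)
    where
    resulting : LowBlockDegree k (λ xs → apply L (λ x → evalBlocks ts (x ∷ xs))) →
      LowBlockDegree k (λ xs → apply L (λ x → G (x ∷ xs)))
    resulting (represented ts′ deg′ eq′) = represented ts′ deg′
        (λ xs → trans (eq′ xs) (apply-cong L (λ x → eq (x ∷ xs))))

    survivors : ∀ ts → BlockDegreeBelow (suc k) ts →
        LowBlockDegree k (λ xs → apply L (λ x → evalBlocks ts (x ∷ xs)))
    survivors [] [] = represented [] [] (λ xs → sym (apply-zero L (λ _ → refl)))
    survivors ((c , α ∷ αs) ∷ ts) (lt ∷ lts) with survivors ts lts | boost ℕ.* Vec.sum α ℕ.<? τ
    ... | represented ts′ deg′ eq′ | yes low = represented ts′ deg′ λ xs → trans (eq′ xs)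
        (sym (trans (additive L _ _)
      (trans (+-congʳ (trans (homogeneous L c _) (trans (*-congˡ
          (trans (homogeneousʳ L (blockMonomial αs xs) (monomial α))
         (trans (*-congʳ (kills α low)) (zeroˡ _)))) (zeroʳ c)))) (+-identityˡ _))))
    ... | represented ts′ deg′ eq′ | no ¬low = represented ((c * apply L (monomial α) , αs) ∷ ts′)
        (remaining ∷ deg′) λ xs → sym (trans (additive L _ _) (+-cong
      (trans (homogeneous L c _) (trans (*-congˡ (homogeneousʳ L (blockMonomial αs xs) (monomial α)))
          (sym (*-assoc c _ _))))
      (sym (eq′ xs))))
      where
      remaining : boost ℕ.* blockDegree αs ℕ.< k ℕ.* τ
      remaining = ℕ.+-cancelˡ-< (boost ℕ.* Vec.sum α) _ _ (ℕ.<-≤-trans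
        (≡.subst (ℕ._< suc k ℕ.* τ) (ℕ.*-distribˡ-+ boost (Vec.sum α) (blockDegree αs)) lt)
        (ℕ.+-monoˡ-≤ (k ℕ.* τ) (ℕ.≮⇒≥ ¬low)))

  -- The functional g ↦ scale · ∫ u (f g) is split into an annihilator of low degree and a small remainder.
  record Splitting {m} (f : BoolFun m) (scale size : ℕ) : Set where
    field
      u              : Measure (Vec Sign m)
      total-u        : total u ≈ 1#
      high low       : Functional (Vec Sign m)
      split          : ∀ h → fromℕ scale * ∫ u (λ x → fromSign (f x) * h x) ≈ apply high h + apply low h
      high-kills     : Annihilates high
      high-bound     : ∀ {h H} → 0# ≤ H → (∀ x → ∣ h x ∣≤ H) → apply high h ≤ fromℕ (4 ℕ.* size) * H
      low-bound      : ∀ {h H} → 0# ≤ H → (∀ x → ∣ h x ∣≤ H) → apply low h ≤ H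

  signed-bound : ∀ s {x H} → ∣ x ∣≤ H → ∣ fromSign s * x ∣≤ H
  signed-bound Sign.+ {x} (lower , upper) = ≤-respʳ-≈ eq lower , ≤-respˡ-≈ eq upper
    where eq = sym (*-identityˡ x)
  signed-bound Sign.- {x} {H} (lower , upper) = ≤-respʳ-≈ eq (neg-mono-≤ upper) ,
    ≤-respˡ-≈ eq (≤-respʳ-≈ (solve 1 (λ H → :- (:- H) := H) refl H) (neg-mono-≤ lower))
    where
    eq : - x ≈ - 1# * x
    eq = solve 1 (λ x → :- x := (:- con (+ 1)) :* x) refl x

  measure-bound : ∀ {X} (μ : Measure X) {h H} → 0# ≤ H → total μ ≤ 1# → (∀ x → ∣ h x ∣≤ H) → ∣ ∫ μ h ∣≤ H
  measure-bound μ {h} {H} 0≤H total≤1 bound = lower , upper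
    where
    H*total≤H : H * total μ ≤ H
    H*total≤H = ≤-trans (*-monoˡ-≤ 0≤H total≤1) (≤-reflexive (*-identityʳ H))
    upper : ∫ μ h ≤ H
    upper = ≤-trans (monotone μ (proj₂ ∘ bound)) (≤-trans (≤-reflexive (apply-const (functional μ) H)) H*total≤H)
    lower : - H ≤ ∫ μ h
    lower = ≤-trans (neg-mono-≤ H*total≤H) (≤-trans
      (≤-reflexive (trans (solve 2 (λ H t → :- (H :* t) := (:- H) :* t) refl H (total μ))
          (sym (apply-const (functional μ) (- H)))))
      (monotone μ (proj₁ ∘ bound)))

  -- An inactive function is evaluated at one fixed input, where it is a constant sign. It requires
  -- no annihilator and costs the factor 1.
  trivialSplitting : ∀ {m} (f : BoolFun m) → Splitting f 1 0
  trivialSplitting {m} f = record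
    { u          = point
    ; total-u    = refl
    ; high       = zeroFunctional
    ; low        = weighted (fromSign ∘ f) (functional point)
    ; split      = λ h → trans (*-congʳ fromℕ-1) (trans (*-identityˡ _) (sym (+-identityˡ _)))
    ; high-kills = λ _ _ → refl
    ; high-bound = λ _ _ → ≤-reflexive (sym (zeroˡ _))
    ; low-bound  = λ _ bound → proj₂ (signed-bound (f x₀) (bound x₀))
    }
    where
    x₀ = Vec.replicate m Sign.+
    point = dirac x₀

  -- The `high` part is 4 f u - f w, of norm at most 4 + 1 = 5. This is rounded up to 8 = 4 · 2, a
  -- multiple of the factor that the budget absorbs.
  dualSplitting : ∀ {m} {f : BoolFun m} → DualPair f τ → Splitting f 4 2
  dualSplitting {m} {f} pair = record
    { u          = u
    ; total-u    = total-u
    ; high       = high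
    ; low        = low
    ; split      = λ h → solve 2 (λ a b → a := a :+ (:- con (+ 1)) :* b :+ b) refl _ _
    ; high-kills = λ α lt → trans (+-congʳ (dual α lt)) (solve 1
        (λ a → a :+ (:- con (+ 1)) :* a := con (+ 0)) refl _)
    ; high-bound = high-bound
    ; low-bound  = λ 0≤H bound → proj₂ (low-bound 0≤H bound)
    }
    where
    open DualPair pair
    low high : Functional (Vec Sign m)
    low  = weighted (fromSign ∘ f) (functional w)
    high = fromℕ 4 ⊡ weighted (fromSign ∘ f) (functional u) ⊞ (- 1#) ⊡ low
    low-bound : ∀ {h H} → 0# ≤ H → (∀ x → ∣ h x ∣≤ H) → ∣ apply low h ∣≤ H
    low-bound 0≤H bound = measure-bound w 0≤H total-w (λ x → signed-bound (f x) (bound x))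
    high-bound : ∀ {h H} → 0# ≤ H → (∀ x → ∣ h x ∣≤ H) → apply high h ≤ fromℕ 8 * H
    high-bound {h} {H} 0≤H bound = ≤-trans (+-mono-≤
        (*-monoˡ-≤ (0≤fromℕ 4) (proj₂ (measure-bound u 0≤H (≤-reflexive total-u)
            (λ x → signed-bound (f x) (bound x)))))
        (≤-respˡ-≈ (solve 1 (λ a → :- a := (:- con (+ 1)) :* a) refl _)
            (neg-mono-≤ (proj₁ (low-bound 0≤H bound)))))
      (0≤⇒≤ (≤-respʳ-≈ (solve 1 (λ H → con (+ 3) :* H := con (+ 8) :* H :- (con (+ 4) :* H :+ :- (:- H))) refl H)
        (*-nonneg (0≤fromℕ 3) 0≤H)))

  -- One form for both kinds of task: the weight of an output sign `z` is the constant `a` plus `b`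
  -- times the scaled correlation with `f`. In `bound`, the constant contributes `a`, the low part
  -- `b` and the high part `b * size`, its further factor 4 being left to the budget.
  record Coordinate (m : ℕ) : Set where
    field
      f           : BoolFun m
      scale size  : ℕ
      splitting   : Splitting f scale size
      a b         : ℕ
    open Splitting splitting public

    factor : Sign → Vec Sign m → Carrier
    factor z x = fromℕ a + fromℕ b * (fromℕ scale * (fromSign z * fromSign (f x)))

    bound : ℕ
    bound = a ℕ.+ b ℕ.* suc size

  open Coordinate

  factors : ∀ {n m} → Vec (Coordinate m) n → Vec Sign n → Block n m → Carrier
  factors []       []       []       = 1#
  factors (c ∷ cs) (z ∷ zs) (x ∷ xs) = factor c z x * factors cs zs xs

  bounds : ∀ {n m} → Vec (Coordinate m) n → ℕ
  bounds []       = 1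
  bounds (c ∷ cs) = bound c ℕ.* bounds cs

  measures : ∀ {n m} → Vec (Coordinate m) n → Measure (Block n m)
  measures []       = dirac []
  measures (c ∷ cs) = product (u c) (measures cs)

  measures-total : ∀ {n m} (cs : Vec (Coordinate m) n) → total (measures cs) ≈ 1#
  measures-total []       = refl
  measures-total (c ∷ cs) = trans (apply-cong (functional (measures cs)) (λ _ → total-u c)) (measures-total cs)

  -- The bound Σ |p κ x| ≤ H written without absolute values. For fixed signs the sum over κ is a
  -- single function, so a functional can be applied to it at once, and the bound never involves the
  -- number of outcomes.
  SignSumsBelow : ∀ {K} {X : Set} → (Fin K → X → Carrier) → Carrier → Set
  SignSumsBelow {K} {X} p H = ∀ (ε : Fin K → Sign) (x : X) → sum (λ κ → fromSign (ε κ) * p κ x) ≤ H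

  fromSign-* : ∀ s t → fromSign (s Sign.* t) ≈ fromSign s * fromSign t
  fromSign-* Sign.+ t      = sym (*-identityˡ _)
  fromSign-* Sign.- Sign.+ = sym (*-identityʳ _)
  fromSign-* Sign.- Sign.- = solve 0 (con (+ 1) := (:- con (+ 1)) :* (:- con (+ 1))) refl

  signSums-∣∣≤ : ∀ {K X} {p : Fin K → X → Carrier} {H} → SignSumsBelow p H →
    ∀ (ε : Fin K → Sign) x → ∣ sum (λ κ → fromSign (ε κ) * p κ x) ∣≤ H
  signSums-∣∣≤ {K} {p = p} below ε x = ≤-respʳ-≈ equal (neg-mono-≤ (below (λ κ → Sign.- Sign.* ε κ) x)) , below ε x
    where
    S = sumMeasure K
    equal : - sum (λ κ → fromSign (Sign.- Sign.* ε κ) * p κ x) ≈ sum (λ κ → fromSign (ε κ) * p κ x)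
    equal = trans (-‿cong (trans
        (sum-cong K (λ κ → trans (*-congʳ (fromSign-* Sign.- (ε κ))) (*-assoc _ _ _)))
        (homogeneous (functional S) (- 1#) _)))
      (solve 1 (λ a → :- ((:- con (+ 1)) :* a) := a) refl _)

  module _ {n m K : ℕ} (z : Fin K → Sign) (p : Fin K → Block (suc n) m → Carrier) {H : Carrier} (0≤H : 0# ≤ H) (below : SignSumsBelow p H) where

    -- The signs z are absorbed in the signs over which the hypothesis quantifies.
    apply-signSums : ∀ (L : Functional (Vec Sign m)) {B} → (∀ {h} → (∀ x → ∣ h x ∣≤ H) → apply L h ≤ B) →
      SignSumsBelow (λ κ xs → fromSign (z κ) * apply L (λ x → p κ (x ∷ xs))) B
    apply-signSums L L≤ ε xs = ≤-respˡ-≈ equal (L≤ (λ x → signSums-∣∣≤ below (λ κ → ε κ Sign.* z κ) (x ∷ xs)))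
      where
      equal : apply L (λ x → sum (λ κ → fromSign (ε κ Sign.* z κ) * p κ (x ∷ xs)))
        ≈ sum (λ κ → fromSign (ε κ) * (fromSign (z κ) * apply L (λ x → p κ (x ∷ xs))))
      equal = trans (apply-sum L (λ κ x → fromSign (ε κ Sign.* z κ) * p κ (x ∷ xs)))
          (sum-cong K (λ κ → trans (homogeneous L _ _)
        (trans (*-congʳ (fromSign-* (ε κ) (z κ))) (*-assoc _ _ _))))

  signSums-scale : ∀ {K X} {p : Fin K → X → Carrier} {H} c → 0# ≤ c → SignSumsBelow p H →
    SignSumsBelow (λ κ x → c * p κ x) (c * H)
  signSums-scale {K} {p = p} c 0≤c below ε x = ≤-respˡ-≈
    (trans (sym (homogeneous (functional (sumMeasure K)) c (λ κ → fromSign (ε κ) * p κ x)))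
      (sum-cong K (λ κ → solve 3 (λ c s p → c :* (s :* p) := s :* (c :* p)) refl c (fromSign (ε κ)) (p κ x))))
    (*-monoˡ-≤ 0≤c (below ε x))

  integralSum : ∀ {n m K} (cs : Vec (Coordinate m) n) (z : Fin K → Vec Sign n)
      (p : Fin K → Block n m → Carrier) → Carrier
  integralSum cs z p = sum (λ κ → ∫ (measures cs) (λ xs → p κ xs * factors cs (z κ) xs))

  integralSum-zero : ∀ {n m K} (cs : Vec (Coordinate m) n)
      (z : Fin K → Vec Sign n) {p : Fin K → Block n m → Carrier} →
    (∀ κ xs → p κ xs ≈ 0#) → integralSum cs z p ≈ 0#
  integralSum-zero {K = K} cs z p≈0 = apply-zero (functional (sumMeasure K)) (λ κ →
    apply-zero (functional (measures cs)) (λ xs → trans (*-congʳ (p≈0 κ xs)) (zeroˡ _)))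

  -- The remaining factors do not depend on the first block and are pulled out of its integral.
  -- There `split` turns the scaled correlation into `high` plus `low`, and the first output sign
  -- joins the function to be integrated.
  integralSum-expand : ∀ {n m K} (c : Coordinate m) (cs : Vec (Coordinate m) n) (z : Fin K → Vec Sign (suc n))
    (p : Fin K → Block (suc n) m → Carrier) →
    integralSum (c ∷ cs) z p ≈
      integralSum cs (tail ∘ z) (λ κ xs → fromℕ (a c) * ∫ (u c) (λ x → p κ (x ∷ xs)))
      + (integralSum cs (tail ∘ z) (λ κ xs → fromℕ (b c) *
          (fromSign (head (z κ)) * apply (high c) (λ x → p κ (x ∷ xs))))
      + integralSum cs (tail ∘ z) (λ κ xs → fromℕ (b c) *
          (fromSign (head (z κ)) * apply (low c) (λ x → p κ (x ∷ xs)))))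
  integralSum-expand {K = K} c cs z p = trans (sum-cong K (λ κ → term (z κ) (p κ)))
    (trans (additive S _ _) (+-congˡ (additive S _ _)))
    where
    S = functional (sumMeasure K)
    M = functional (measures cs)
    a′ = fromℕ (a c)
    b′ = fromℕ (b c)
    term : ∀ zs (q : Block _ _ → Carrier) → ∫ (measures (c ∷ cs)) (λ xs → q xs * factors (c ∷ cs) zs xs) ≈
      apply M (λ xs → a′ * ∫ (u c) (λ x → q (x ∷ xs)) * factors cs (tail zs) xs)
      + (apply M (λ xs → b′ * (fromSign (head zs) * apply (high c) (λ x → q (x ∷ xs))) * factors cs (tail zs) xs)
      + apply M (λ xs → b′ * (fromSign (head zs) * apply (low c) (λ x → q (x ∷ xs))) * factors cs (tail zs) xs))
    term (z₁ ∷ zs) q = trans (apply-cong M inner) (trans (additive M _ _) (+-congˡ (additive M _ _)))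
      where
      s = fromSign z₁
      inner : ∀ xs → ∫ (u c) (λ x → q (x ∷ xs) * (factor c z₁ x * factors cs zs xs)) ≈
        (a′ * ∫ (u c) (λ x → q (x ∷ xs))) * factors cs zs xs
        + ((b′ * (s * apply (high c) (λ x → q (x ∷ xs)))) * factors cs zs xs
        + (b′ * (s * apply (low c) (λ x → q (x ∷ xs)))) * factors cs zs xs)
      inner xs = trans (apply-cong U (λ x → solve 7 (λ p a b g s f r →
            p :* ((a :+ b :* (g :* (s :* f))) :* r) := a :* r :* p :+ b :* s :* r :* g :* (f :* p)) refl
            (q (x ∷ xs)) a′ b′ (fromℕ (scale c)) s (fromSign (f c x)) (factors cs zs xs)))
        (trans (additive U _ _) (trans (+-cong (homogeneous U _ _) (trans (homogeneous U _ _)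
            (trans (*-assoc _ _ _) (*-congˡ (split c (λ x → q (x ∷ xs)))))))
          (solve 7 (λ a b s r P h l → a :* r :* P :+ b :* s :* r :* (h :+ l)
             := a :* P :* r :+ (b :* (s :* h) :* r :+ b :* (s :* l) :* r)) refl a′ b′ s (factors cs zs xs) _ _ _)))
        where U = functional (u c)

  -- Induction on the blocks. Of the three parts of the first factor only the `high` part lowers
  -- `k`; the other two keep it. With E = `fourPower (suc k)` and E₀ = `fourPower k`, the sum of the
  -- three bounds needs E a + 4 E₀ b s + E b ≤ E (a + b (s + 1)), which is 4 E₀ ≤ E.
  productBound : ∀ {n m K} (cs : Vec (Coordinate m) n) k (z : Fin K → Vec Sign n)
      (p : Fin K → Block n m → Carrier) {H} →
    0# ≤ H → (∀ κ → LowBlockDegree k (p κ)) → SignSumsBelow p H →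
    integralSum cs z p ≤ fromℕ (fourPower k ℕ.* bounds cs) * H
  productBound cs zero z p 0≤H low below = ≤-reflexive (trans
    (integralSum-zero cs z (λ κ → lowBlockDegree-0 (low κ))) (sym (zeroˡ _)))
  productBound {K = K} [] (suc k) z p {H} 0≤H low below = ≤-trans
    (≤-respˡ-≈ (sum-cong K (λ κ → trans (*-identityˡ _) (sym
        (trans (*-congˡ (no-factors (z κ))) (*-identityʳ _)))))
      (below (λ _ → Sign.+) []))
    (≤-trans (≤-reflexive (sym (*-identityˡ H)))
      (*-mono-≤ 0≤1 0≤H (≤-trans (≤-reflexive (sym fromℕ-1)) (fromℕ-mono-≤ 1≤)) ≤-refl))
    where
    no-factors : ∀ zs → factors [] zs [] ≈ 1#
    no-factors [] = refl
    1≤ : 1 ℕ.≤ 4 ℕ.^ k ℕ.* 1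
    1≤ = ℕ.≤-trans (ℕ.m^n>0 4 k) (ℕ.≤-reflexive (≡.sym (ℕ.*-identityʳ _)))
  productBound {K = K} (c ∷ cs) (suc k) z p {H} 0≤H low below = begin
    integralSum (c ∷ cs) z p ≈⟨ integralSum-expand c cs z p ⟩
    _ ≤⟨ +-mono-≤
      (productBound cs (suc k) (tail ∘ z) _ (*-nonneg (0≤fromℕ (a c)) 0≤H)
        (λ κ → lowBlockDegree-scale _ (apply-first (functional (u c)) (low κ)))
        (signSums-scale _ (0≤fromℕ (a c)) u-below))
      (+-mono-≤
        (productBound cs k (tail ∘ z) _ (*-nonneg (0≤fromℕ (b c)) (*-nonneg (0≤fromℕ (4 ℕ.* size c)) 0≤H))
          (λ κ → lowBlockDegree-scale _ (lowBlockDegree-scale _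
              (apply-annihilator (high c) (high-kills c) (low κ))))
          (signSums-scale _ (0≤fromℕ (b c)) (apply-signSums (head ∘ z) p 0≤H below (high c) (high-bound c 0≤H))))
        (productBound cs (suc k) (tail ∘ z) _ (*-nonneg (0≤fromℕ (b c)) 0≤H)
          (λ κ → lowBlockDegree-scale _ (lowBlockDegree-scale _ (apply-first (low′) (low κ))))
          (signSums-scale _ (0≤fromℕ (b c)) (apply-signSums (head ∘ z) p 0≤H below low′ (low-bound c 0≤H))))) ⟩
    fromℕ (E ℕ.* B) * (fromℕ (a c) * H) + (fromℕ (E₀ ℕ.* B) *
        (fromℕ (b c) * (fromℕ (4 ℕ.* size c) * H)) + fromℕ (E ℕ.* B) * (fromℕ (b c) * H))
      ≈⟨ collect ⟩
    fromℕ expanded * H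
      ≤⟨ *-mono-≤ (0≤fromℕ expanded) 0≤H (fromℕ-mono-≤ estimate) ≤-refl ⟩
    fromℕ (E ℕ.* (bound c ℕ.* B)) * H ∎
    where
    open ≤-Reasoning
    low′ = Coordinate.low c
    E₀ = fourPower k
    E = fourPower (suc k)
    B = bounds cs
    expanded = E ℕ.* B ℕ.* a c ℕ.+ (E₀ ℕ.* B ℕ.* (b c ℕ.* (4 ℕ.* size c)) ℕ.+ E ℕ.* B ℕ.* b c)

    u-below : SignSumsBelow (λ κ xs → ∫ (u c) (λ x → p κ (x ∷ xs))) H
    u-below ε xs = ≤-respˡ-≈
      (trans (apply-sum (functional (u c)) (λ κ x → fromSign (ε κ) * p κ (x ∷ xs)))
          (sum-cong K (λ κ → homogeneous (functional (u c)) (fromSign (ε κ)) (λ x → p κ (x ∷ xs)))))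
      (proj₂ (measure-bound (u c) 0≤H (≤-reflexive (total-u c)) (λ x → signSums-∣∣≤ below ε (x ∷ xs))))

    collect : fromℕ (E ℕ.* B) * (fromℕ (a c) * H) + (fromℕ (E₀ ℕ.* B) *
        (fromℕ (b c) * (fromℕ (4 ℕ.* size c) * H)) + fromℕ (E ℕ.* B) * (fromℕ (b c) * H))
      ≈ fromℕ expanded * H
    collect = sym (trans (*-congʳ (trans (fromℕ-+ (E ℕ.* B ℕ.* a c) _) (+-cong (fromℕ-* (E ℕ.* B) (a c))
        (trans (fromℕ-+ (E₀ ℕ.* B ℕ.* (b c ℕ.* (4 ℕ.* size c))) _) (+-cong
          (trans (fromℕ-* (E₀ ℕ.* B) _) (*-congˡ (fromℕ-* (b c) (4 ℕ.* size c)))) (fromℕ-* (E ℕ.* B) (b c)))))))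
      (solve 6 (λ x y a b s H → (x :* a :+ (y :* (b :* s) :+ x :* b)) :* H := x :* (a :* H) :+
          (y :* (b :* (s :* H)) :+ x :* (b :* H)))
        refl (fromℕ (E ℕ.* B)) (fromℕ (E₀ ℕ.* B)) (fromℕ (a c)) (fromℕ (b c)) (fromℕ (4 ℕ.* size c)) H))

    estimate : expanded ℕ.≤ E ℕ.* (bound c ℕ.* B)
    estimate = ℕ.≤-trans
      (ℕ.+-monoʳ-≤ (E ℕ.* B ℕ.* a c) (ℕ.+-monoˡ-≤ (E ℕ.* B ℕ.* b c)
        (ℕ.≤-trans (ℕ.≤-reflexive (regroup E₀ B (b c) (size c)))
            (ℕ.*-monoˡ-≤ (B ℕ.* (b c ℕ.* size c)) (fourPower-suc k)))))
      (ℕ.≤-reflexive (distribute E B (a c) (b c) (size c)))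
      where
      regroup : ∀ e B b s → e ℕ.* B ℕ.* (b ℕ.* (4 ℕ.* s)) ≡ 4 ℕ.* e ℕ.* (B ℕ.* (b ℕ.* s))
      regroup = ℕ-Solver.solve-∀
      distribute : ∀ E B a b s → E ℕ.* B ℕ.* a ℕ.+ (E ℕ.* (B ℕ.* (b ℕ.* s)) ℕ.+ E ℕ.* B ℕ.* b)
          ≡ E ℕ.* ((a ℕ.+ b ℕ.* suc s) ℕ.* B)
      distribute = ℕ-Solver.solve-∀

-- Outcome probabilities as polynomials

module QueryPolynomials (R : Reals) where

  open Reals R hiding (zero)
  open RealNotions R
  open OrderedField R
  open Functionals R
  open LowDegreeFunctions R
  open Amplification using (half; half+half)

  sum-single : ∀ {n} (i : Fin n) {g : Fin n → Carrier} → (∀ j → j ≢ i → g j ≈ 0#) → sum g ≈ g i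
  sum-single {suc n} zero    g≈0 = trans (+-congˡ (apply-zero (functional (sumMeasure n))
      (λ j → g≈0 (suc j) λ ()))) (+-identityʳ _)
  sum-single         (suc i) g≈0 = trans (+-cong (g≈0 zero λ ())
      (sum-single i (λ j j≢i → g≈0 (suc j) (j≢i ∘ Fin.suc-injective))))
    (+-identityˡ _)

  apply-combination : ∀ {X} (L : Functional X) c g d h →
    apply L (λ x → c * g x - d * h x) ≈ c * apply L g - d * apply L h
  apply-combination L c g d h = trans (apply-difference L (λ x → c * g x) (λ x → d * h x))
    (+-cong (homogeneous L c g) (-‿cong (homogeneous L d h)))

  module _ {N W : ℕ} where

    private
      S : ∀ n → Functional (Fin n)
      S n = functional (sumMeasure n)

    basisMeasure : Measure (Basis N W)
    basisMeasure = record
      { functional = record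
        { apply       = sumBasis
        ; apply-cong  = λ eq → sum-cong N λ i → sum-cong W λ w → +-cong (eq (i , false , w)) (eq (i , true , w))
        ; additive    = λ g h → trans (sum-cong N λ i → trans (sum-cong W λ w →
            solve 4 (λ a b c d → a :+ b :+ (c :+ d) := a :+ c :+ (b :+ d)) refl
              (g (i , false , w)) (h (i , false , w)) (g (i , true , w)) (h (i , true , w)))
              (additive (S W) (λ w → g (i , false , w) + g (i , true , w))
                  (λ w → h (i , false , w) + h (i , true , w))))
            (additive (S N) (λ i → sum (λ w → g (i , false , w) + g (i , true , w)))
                (λ i → sum (λ w → h (i , false , w) + h (i , true , w))))
        ; homogeneous = λ c g → trans (sum-cong N λ i → trans
            (sum-cong W λ w → sym (distribˡ c (g (i , false , w)) (g (i , true , w))))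
            (homogeneous (S W) c (λ w → g (i , false , w) + g (i , true , w))))
            (homogeneous (S N) c (λ i → sum (λ w → g (i , false , w) + g (i , true , w))))
        }
      ; positive = λ 0≤g → positive (sumMeasure N) λ i → positive (sumMeasure W) λ w →
          +-nonneg (0≤g (i , false , w)) (0≤g (i , true , w))
      }

    private
      Σᴮ : Functional (Basis N W)
      Σᴮ = functional basisMeasure

    apply-sumBasis : ∀ {X} (L : Functional X) (g : Basis N W → X → Carrier) →
      apply L (λ x → sumBasis (λ t → g t x)) ≈ sumBasis (λ t → apply L (g t))
    apply-sumBasis L g = trans (apply-sum L (λ i x → sum (λ w → g (i , false , w) x + g (i , true , w) x)))
      (sum-cong N λ i → trans (apply-sum L (λ w x → g (i , false , w) x + g (i , true , w) x))
          (sum-cong W λ w → additive L (g (i , false , w)) (g (i , true , w))))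

    sumBasis-single : ∀ t {g : Basis N W → Carrier} → (∀ s → s ≢ t → g s ≈ 0#) → sumBasis g ≈ g t
    sumBasis-single (i , b , w) {g} g≈0 = trans
      (sum-single i (λ j j≢i → apply-zero (S W) (λ v → trans
        (+-cong (g≈0 _ λ { ≡.refl → j≢i ≡.refl }) (g≈0 _ λ { ≡.refl → j≢i ≡.refl })) (+-identityˡ 0#))))
      (trans (sum-single w (λ v v≢w → trans
        (+-cong (g≈0 _ λ { ≡.refl → v≢w ≡.refl }) (g≈0 _ λ { ≡.refl → v≢w ≡.refl })) (+-identityˡ 0#)))
      (pair b g≈0))
      where
      pair : ∀ b → (∀ s → s ≢ (i , b , w) → g s ≈ 0#) → g (i , false , w) + g (i , true , w) ≈ g (i , b , w)
      pair false g≈0 = trans (+-congˡ (g≈0 _ λ ())) (+-identityʳ _)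
      pair true  g≈0 = trans (+-congʳ (g≈0 _ λ ())) (+-identityˡ _)

    -- ⟨ψ, Xψ⟩, which is real for the Hermitian X to which it is applied.
    matrixTerm : State N W → Operator N W → Basis N W → Basis N W → Carrier
    matrixTerm ψ X t t′ = re (conj (ψ t) *ℂ ψ t′) * re (X t t′) - im (conj (ψ t) *ℂ ψ t′) * im (X t t′)

    expectation : State N W → Operator N W → Carrier
    expectation ψ X = sumBasis (λ t → sumBasis (matrixTerm ψ X t))

    expectation-cong : ∀ ψ {X Y} → X ≈ᴼ Y → expectation ψ X ≈ expectation ψ Y
    expectation-cong ψ {X} {Y} X≈Y = apply-cong Σᴮ λ t → apply-cong Σᴮ λ t′ → matrixTerm-cong t t′
      where
      matrixTerm-cong : ∀ t t′ → matrixTerm ψ X t t′ ≈ matrixTerm ψ Y t t′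
      matrixTerm-cong t t′ = +-cong (*-congˡ (proj₁ (X≈Y t t′))) (-‿cong (*-congˡ (proj₂ (X≈Y t t′))))

    expectation-1 : ∀ ψ → expectation ψ 1ᴼ ≈ ‖ ψ ‖²
    expectation-1 ψ = apply-cong Σᴮ λ t → trans (sumBasis-single t (off t)) (diagonal t)
      where
      off : ∀ t s → s ≢ t → matrixTerm ψ 1ᴼ t s ≈ 0#
      off t s s≢t with t ≟ᴮ s
      ... | yes t≡s = ⊥-elim (s≢t (≡.sym t≡s))
      ... | no _    = solve 2 (λ a b → a :* con (+ 0) :- b :* con (+ 0) := con (+ 0)) refl _ _
      diagonal : ∀ t → matrixTerm ψ 1ᴼ t t ≈ ∣ ψ t ∣²
      diagonal t with t ≟ᴮ t
      ... | no t≢t = ⊥-elim (t≢t ≡.refl)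
      ... | yes _  = solve 2 (λ a b → (a :* a :- (:- b) :* b) :* con (+ 1) :- (a :* b :+ (:- b) :* a) :* con
          (+ 0) := a :* a :+ b :* b)
                       refl (re (ψ t)) (im (ψ t))

    expectation-sum : ∀ ψ {K} (X : Fin K → Operator N W) →
      sum (λ k → expectation ψ (X k)) ≈ expectation ψ (λ s t → sumℂ (λ k → X k s t))
    expectation-sum ψ {K} X = trans (apply-sumBasis (S K) (λ t k → sumBasis (matrixTerm ψ (X k) t)))
      (apply-cong Σᴮ λ t → trans (apply-sumBasis (S K) (λ t′ k → matrixTerm ψ (X k) t t′))
        (apply-cong Σᴮ λ t′ → apply-combination (S K)
          (re (conj (ψ t) *ℂ ψ t′)) (λ k → re (X k t t′)) (im (conj (ψ t) *ℂ ψ t′)) (λ k → im (X k t t′))))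

    -- Expanding the squares and summing over the row index first collects the entries of M†M. Both
    -- unitarity and the completeness of a measurement are identities for such products, so each
    -- becomes a statement on norms.
    norm-· : ∀ M ψ → ‖ M · ψ ‖² ≈ expectation ψ (M † ∙ M)
    norm-· M ψ = trans (apply-cong Σᴮ squared)
      (trans (apply-sumBasis Σᴮ (λ t s → sumBasis (λ t′ → term s t t′)))
        (apply-cong Σᴮ λ t → trans (apply-sumBasis Σᴮ (λ t′ s → term s t t′))
          (apply-cong Σᴮ λ t′ → trans (apply-cong Σᴮ (λ s → regroup (ψ t) (ψ t′) (M s t) (M s t′)))
            (apply-combination Σᴮ
              (re (conj (ψ t) *ℂ ψ t′)) (λ s → re (conj (M s t) *ℂ M s t′))
              (im (conj (ψ t) *ℂ ψ t′)) (λ s → im (conj (M s t) *ℂ M s t′))))))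
      where
      term : Basis N W → Basis N W → Basis N W → Carrier
      term s t t′ = re (M s t *ℂ ψ t) * re (M s t′ *ℂ ψ t′) + im (M s t *ℂ ψ t) * im (M s t′ *ℂ ψ t′)

      product-of-sums : ∀ (g h : Basis N W → Carrier) → sumBasis g * sumBasis h
          ≈ sumBasis (λ t → sumBasis (λ t′ → g t * h t′))
      product-of-sums g h = trans (sym (homogeneousʳ Σᴮ (sumBasis h) g))
          (apply-cong Σᴮ λ t → sym (homogeneous Σᴮ (g t) h))

      squared : ∀ s → ∣ (M · ψ) s ∣² ≈ sumBasis (λ t → sumBasis (λ t′ → term s t t′))
      squared s = trans (+-cong (product-of-sums r r) (product-of-sums i i))
        (trans (sym (additive Σᴮ (λ t → sumBasis (λ t′ → r t * r t′)) (λ t → sumBasis (λ t′ → i t * i t′))))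
          (apply-cong Σᴮ λ t → sym (additive Σᴮ (λ t′ → r t * r t′) (λ t′ → i t * i t′))))
        where
        r i : Basis N W → Carrier
        r t = re (M s t *ℂ ψ t)
        i t = im (M s t *ℂ ψ t)

      regroup : ∀ p q x y →
        re (x *ℂ p) * re (y *ℂ q) + im (x *ℂ p) * im (y *ℂ q) ≈
        re (conj p *ℂ q) * re (conj x *ℂ y) - im (conj p *ℂ q) * im (conj x *ℂ y)
      regroup (p +i p′) (q +i q′) (x +i x′) (y +i y′) = solve 8 (λ p p′ q q′ x x′ y y′ →
        (x :* p :- x′ :* p′) :* (y :* q :- y′ :* q′) :+ (x :* p′ :+ x′ :* p) :* (y :* q′ :+ y′ :* q) :=
        (p :* q :- (:- p′) :* q′) :* (x :* y :- (:- x′) :* y′) :- (p :* q′ :+ (:- p′) :* q) :*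
            (x :* y′ :+ (:- x′) :* y))
        refl p p′ q q′ x x′ y y′

    norm-nonneg : ∀ ψ → 0# ≤ ‖ ψ ‖²
    norm-nonneg ψ = positive basisMeasure λ s → +-nonneg (0≤x*x (re (ψ s))) (0≤x*x (im (ψ s)))

    norm-unitary : ∀ U → Unitary U → ∀ ψ → ‖ U · ψ ‖² ≈ ‖ ψ ‖²
    norm-unitary U (U†U≈1 , _) ψ = trans (norm-· U ψ) (trans (expectation-cong ψ U†U≈1) (expectation-1 ψ))

    norm-oracle : ∀ x ψ → ‖ oracle x ψ ‖² ≈ ‖ ψ ‖²
    norm-oracle x ψ = sum-cong N λ i → sum-cong W λ w → swap i w
      where
      swap : ∀ i w → ∣ oracle x ψ (i , false , w) ∣² + ∣ oracle x ψ (i , true , w) ∣²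
          ≈ ∣ ψ (i , false , w) ∣² + ∣ ψ (i , true , w) ∣²
      swap i w with lookup x i
      ... | Sign.+ = refl
      ... | Sign.- = +-comm _ _

    norm-evolve : ∀ T (U : Fin (suc T) → Operator N W) → (∀ j → Unitary (U j)) → ∀ x ψ → ‖ evolve T U x ψ ‖²
        ≈ ‖ ψ ‖²
    norm-evolve zero    U unitary x ψ = norm-unitary (U zero) (unitary zero) ψ
    norm-evolve (suc T) U unitary x ψ = trans (norm-evolve T (U ∘ suc) (unitary ∘ suc) x (oracle x (U zero · ψ)))
      (trans (norm-oracle x (U zero · ψ)) (norm-unitary (U zero) (unitary zero) ψ))

    LowDegreeState : ℕ → (Vec Sign N → State N W) → Set
    LowDegreeState d ψ = ∀ s → LowDegree d (λ x → re (ψ x s)) × LowDegree d (λ x → im (ψ x s))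

    lowDegree-sumBasis : ∀ {d} {g : Basis N W → Vec Sign N → Carrier} → (∀ s → LowDegree d (g s)) →
        LowDegree d (λ x → sumBasis (λ s → g s x))
    lowDegree-sumBasis low = lowDegree-sum λ i → lowDegree-sum λ w → lowDegree-+ (low (i , false , w))
        (low (i , true , w))

    lowDegree-· : ∀ {d} (M : Operator N W) {ψ} → LowDegreeState d ψ → LowDegreeState d (λ x → M · ψ x)
    lowDegree-· M low s =
      lowDegree-sumBasis (λ t → lowDegree-+ (lowDegree-scale (re (M s t)) (proj₁ (low t)))
          (lowDegree-neg (lowDegree-scale (im (M s t)) (proj₂ (low t))))) ,
      lowDegree-sumBasis (λ t → lowDegree-+ (lowDegree-scale (re (M s t)) (proj₂ (low t)))
          (lowDegree-scale (im (M s t)) (proj₁ (low t))))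

    -- The amplitude read after a query is interpolated linearly in the queried variable: (h b + h
    -- b̄)/2 + xᵢ (h b - h b̄)/2, where b̄ is the other bit. So one query raises the degree by one.
    lowDegree-select : ∀ {d} (i : Fin N) b {h : Bool → Vec Sign N → Carrier} → (∀ b → LowDegree d (h b)) →
      LowDegree (suc d) (λ x → h (b xor bit {N} {W} (lookup x i)) x)
    lowDegree-select {d} i b {h} low = lowDegree-cong (λ x → select (lookup x i) b (λ b → h b x))
      (lowDegree-scale half (lowDegree-+
        (lowDegree-weaken (ℕ.n≤1+n d) (lowDegree-+ (low b) (low (not b))))
        (lowDegree-* (lowDegree-variable i) (lowDegree-+ (low b) (lowDegree-neg (low (not b)))))))
      where
      halves : ∀ y → half * (y + y) ≈ y
      halves y = trans (solve 2 (λ h y → h :* (y :+ y) := (h :+ h) :* y) refl half y)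
          (trans (*-congʳ half+half) (*-identityˡ y))
      same : ∀ y z → half * (y + z + 1# * (y - z)) ≈ y
      same y z = trans (*-congˡ (solve 2 (λ y z → y :+ z :+ con (+ 1) :* (y :- z) := y :+ y) refl y z)) (halves y)
      other : ∀ y z → half * (y + z + - 1# * (y - z)) ≈ z
      other y z = trans (*-congˡ (solve 2 (λ y z → y :+ z :+ (:- con (+ 1)) :* (y :- z) := z :+ z) refl y z))
          (halves z)
      select : ∀ s b (g : Bool → Carrier) → half * (g b + g (not b) + fromSign s * (g b - g (not b)))
          ≈ g (b xor bit {N} {W} s)
      select Sign.+ false g = same _ _
      select Sign.+ true  g = same _ _
      select Sign.- false g = other _ _
      select Sign.- true  g = other _ _

    lowDegree-oracle : ∀ {d ψ} → LowDegreeState d ψ → LowDegreeState (suc d) (λ x → oracle x (ψ x))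
    lowDegree-oracle low (i , b , w) =
      lowDegree-select i b (λ b → proj₁ (low (i , b , w))) , lowDegree-select i b (λ b → proj₂ (low (i , b , w)))

    lowDegree-evolve : ∀ T (U : Fin (suc T) → Operator N W) {d} ψ → LowDegreeState d ψ →
      LowDegreeState (T ℕ.+ d) (λ x → evolve T U x (ψ x))
    lowDegree-evolve zero    U ψ low = lowDegree-· (U zero) {ψ} low
    lowDegree-evolve (suc T) U {d} ψ low s = lowDegree-weaken T+1+d (proj₁ (low′ s)) , lowDegree-weaken T+1+d
        (proj₂ (low′ s))
      where
      T+1+d = ℕ.≤-reflexive (ℕ.+-suc T d)
      low′ : LowDegreeState (T ℕ.+ suc d) (λ x → evolve T (U ∘ suc) x (oracle x (U zero · ψ x)))
      low′ = lowDegree-evolve T (U ∘ suc) (λ x → oracle x (U zero · ψ x))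
        (lowDegree-oracle {ψ = λ x → U zero · ψ x} (lowDegree-· (U zero) {ψ} low))

    lowDegree-norm : ∀ {d ψ} → LowDegreeState d ψ → LowDegree (d ℕ.+ d) (λ x → ‖ ψ x ‖²)
    lowDegree-norm low = lowDegree-sumBasis λ s →
      lowDegree-+ (lowDegree-* (proj₁ (low s)) (proj₁ (low s))) (lowDegree-* (proj₂ (low s)) (proj₂ (low s)))

  module _ {O : Set} {N T : ℕ} (A : QueryAlgorithm O N T) where

    open QueryAlgorithm A

    outcomeProbability-nonneg : ∀ x k → 0# ≤ outcomeProbability x k
    outcomeProbability-nonneg x k = norm-nonneg (M k · evolve T U x start)

    outcomeProbability-sum : ∀ x → sum (outcomeProbability x) ≈ 1#
    outcomeProbability-sum x = trans (sum-cong K (λ k → norm-· (M k) ψ))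
        (trans (expectation-sum ψ (λ k → M k † ∙ M k))
      (trans (expectation-cong ψ M-complete) (trans (expectation-1 ψ)
          (trans (norm-evolve T U U-unitary x start) start-unit))))
      where ψ = evolve T U x start

    lowDegree-outcomeProbability : ∀ k → LowDegree (T ℕ.+ T) (λ x → outcomeProbability x k)
    lowDegree-outcomeProbability k = lowDegree-weaken (ℕ.≤-reflexive
        (≡.cong₂ ℕ._+_ (ℕ.+-identityʳ T) (ℕ.+-identityʳ T)))
      (lowDegree-norm {ψ = λ x → M k · evolve T U x start} (lowDegree-· (M k) {λ x → evolve T U x start}
        (lowDegree-evolve T U (λ _ → start) (λ s → lowDegree-const 0 _ , lowDegree-const 0 _))))

-- The threshold and the numerical estimates

last-true : ∀ {P : ℕ → Set} → (∀ j → Dec (P j)) → P 0 → ∀ M → ¬ P M → ∃[ j ] P j × ¬ P (suc j)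
last-true P? p zero    ¬p = ⊥-elim (¬p p)
last-true P? p (suc M) ¬p with P? M
... | yes p′ = M , p′ , ¬p
... | no ¬p′ = last-true P? p M ¬p′

count≥ : ∀ {n} → ℕ → (Fin n → ℕ) → ℕ
count≥ {zero}  τ d = 0
count≥ {suc n} τ d = (if τ ℕ.≤ᵇ d zero then 1 else 0) ℕ.+ count≥ τ (d ∘ suc)

count≥-0 : ∀ {n} (d : Fin n → ℕ) → count≥ 0 d ≡ n
count≥-0 {zero}  d = ≡.refl
count≥-0 {suc n} d = ≡.cong suc (count≥-0 (d ∘ suc))

count≥-≤ : ∀ {n} τ (d : Fin n → ℕ) → count≥ τ d ℕ.≤ n
count≥-≤ {zero}  τ d = ℕ.z≤n
count≥-≤ {suc n} τ d with τ ℕ.≤ᵇ d zero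
... | true  = ℕ.s≤s (count≥-≤ τ (d ∘ suc))
... | false = ℕ.m≤n⇒m≤1+n (count≥-≤ τ (d ∘ suc))

count≥-bounded : ∀ {n} τ (d : Fin n → ℕ) → (∀ i → d i ℕ.< τ) → count≥ τ d ≡ 0
count≥-bounded {zero}  τ d d<τ = ≡.refl
count≥-bounded {suc n} τ d d<τ with τ ℕ.≤ᵇ d zero in eq
... | true  = ⊥-elim (ℕ.<⇒≱ (d<τ zero) (ℕ.≤ᵇ⇒≤ τ (d zero) (≡.subst T (≡.sym eq) tt)))
... | false = count≥-bounded τ (d ∘ suc) (d<τ ∘ suc)

upperBound : ∀ {n} (d : Fin n → ℕ) → ∃[ M ] ∀ i → d i ℕ.< M
upperBound {zero}  d = 0 , λ ()
upperBound {suc n} d = let (M , d<M) = upperBound (d ∘ suc) in suc (d zero) ℕ.+ M , λ where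
  zero    → ℕ.m≤m+n (suc (d zero)) M
  (suc i) → ℕ.≤-trans (d<M i) (ℕ.m≤n+m M (suc (d zero)))

sum⊆ : ∀ {n} → Subset n → (Fin n → ℕ) → ℕ
sum⊆ S d = sumOver ℕ.+-0-rawMonoid S d

-- At most `n − s` of the numbers exceed `τ`. Skipping all of them still leaves `s` indices to pick,
-- each contributing at most `τ`.
choose-below : ∀ {n} τ (d : Fin n → ℕ) s → s ℕ.+ count≥ (suc τ) d ℕ.≤ n →
  Σ[ S ∈ Subset n ] ∣ S ∣ ≡ s × sum⊆ S d ℕ.≤ s ℕ.* τ
choose-below {zero}  τ d zero    le = [] , ≡.refl , ℕ.z≤n
choose-below {suc n} τ d zero    le =
  let (S , size , sum≤) = choose-below τ (d ∘ suc) 0 (count≥-≤ (suc τ) (d ∘ suc)) in outside ∷ S , size , sum≤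
choose-below {suc n} τ d (suc s) le with suc τ ℕ.≤ᵇ d zero in eq
... | true =
  let (S , size , sum≤) = choose-below τ (d ∘ suc) (suc s) (ℕ.≤-pred (≡.subst (ℕ._≤ suc n) (ℕ.+-suc (suc s) _) le)) in
  outside ∷ S , size , sum≤
... | false =
  let (S , size , sum≤) = choose-below τ (d ∘ suc) s (ℕ.≤-pred le) in
  inside ∷ S , ≡.cong suc size , ℕ.+-mono-≤ (ℕ.≤-pred (ℕ.≰⇒> (λ lt → ≡.subst T eq (ℕ.≤⇒≤ᵇ lt)))) sum≤

module _ {n s : ℕ} (0<s : 0 ℕ.< s) (s≤n : s ℕ.≤ n) where

  -- The largest τ such that more than n − s of the numbers d i are at least τ.
  threshold : ∀ {d : Fin n → ℕ} {μ} → IsMinSubsetSum s d μ → ∃[ τ ] n ℕ.< count≥ τ d ℕ.+ s × μ ℕ.≤ n ℕ.* τ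
  threshold {d} {μ} (_ , least) with upperBound d
  ... | M , d<M with last-true (λ τ → n ℕ.<? count≥ τ d ℕ.+ s) at-0 M at-M
    where
    at-0 : n ℕ.< count≥ 0 d ℕ.+ s
    at-0 = ≡.subst (λ k → n ℕ.< k ℕ.+ s) (≡.sym (count≥-0 d)) (ℕ.m<m+n n 0<s)
    at-M : ¬ n ℕ.< count≥ M d ℕ.+ s
    at-M lt = ℕ.<⇒≱ (≡.subst (λ k → n ℕ.< k ℕ.+ s) (count≥-bounded M d d<M) lt) s≤n
  ... | τ , many , few = τ , many , small
    where
    small : μ ℕ.≤ n ℕ.* τ
    small = let (S , size , sum≤) = choose-below τ d s (≡.subst (ℕ._≤ n) (ℕ.+-comm (count≥ (suc τ) d) s) (ℕ.≮⇒≥ few)) in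
      ℕ.≤-trans (least _ (S , size , ≡.refl)) (ℕ.≤-trans sum≤ (ℕ.*-monoˡ-≤ τ s≤n))

-- The quotient is ⌈bn/(b+1)⌉, which is ⌈0.99 n⌉ for `b = 99`. The letter keeps large numerals out
-- of the ring identities.
ceiling≤ : ∀ b n → (b ℕ.* n ℕ.+ b) ℕ./ suc b ℕ.≤ n
ceiling≤ b n = ℕ.≤-pred (ℕ.m<n*o⇒m/o<n {b ℕ.* n ℕ.+ b} {suc n} {suc b}
  (ℕ.≤-trans (ℕ.m≤m+n (suc (b ℕ.* n ℕ.+ b)) n) (ℕ.≤-reflexive (expand b n))))
  where
  expand : ∀ b n → suc (b ℕ.* n ℕ.+ b) ℕ.+ n ≡ suc n ℕ.* suc b
  expand = ℕ-Solver.solve-∀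

ceiling>0 : ∀ b n → 1 ℕ.≤ b → 1 ℕ.≤ n → 0 ℕ.< (b ℕ.* n ℕ.+ b) ℕ./ suc b
ceiling>0 b n 1≤b 1≤n = ℕ.m≥n⇒m/n>0 {b ℕ.* n ℕ.+ b} {suc b} (ℕ.+-monoˡ-≤ b (ℕ.*-mono-≤ 1≤b 1≤n))

-- Multiply by `suc b`: the quotient times `suc b` is at most `b * n + b`, whereas `suc b * suc n`
-- is larger than that by `suc n`. This is how more than n - ⌈0.99 n⌉ active indices become more
-- than n/100.
ceiling-complement : ∀ b n k → n ℕ.< k ℕ.+ (b ℕ.* n ℕ.+ b) ℕ./ suc b → n ℕ.< suc b ℕ.* k
ceiling-complement b n k lt = ℕ.+-cancelˡ-< (b ℕ.* n ℕ.+ b) n _ (ℕ.≤-trans (ℕ.≤-reflexive (expand b n))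
  (ℕ.≤-trans (ℕ.*-monoʳ-≤ (suc b) lt) (ℕ.≤-trans (ℕ.≤-reflexive (swap b k _))
    (ℕ.+-monoˡ-≤ (suc b ℕ.* k) (ℕ.m/n*n≤m (b ℕ.* n ℕ.+ b) (suc b))))))
  where
  expand : ∀ b n → suc (b ℕ.* n ℕ.+ b ℕ.+ n) ≡ suc b ℕ.* suc n
  expand = ℕ-Solver.solve-∀
  swap : ∀ b k s → suc b ℕ.* (k ℕ.+ s) ≡ s ℕ.* suc b ℕ.+ suc b ℕ.* k
  swap = ℕ-Solver.solve-∀

m<[1+m/n]*n : ∀ m n .{{_ : ℕ.NonZero n}} → m ℕ.< suc (m ℕ./ n) ℕ.* n
m<[1+m/n]*n m n = ≡.subst (ℕ._< suc (m ℕ./ n) ℕ.* n) (≡.sym (ℕ.m≡m%n+[m/n]*n m n))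
    (ℕ.+-monoˡ-< (m ℕ./ n ℕ.* n) (ℕ.m%n<n m n))

m<n*o⇒0<o : ∀ {m} n o → m ℕ.< n ℕ.* o → 0 ℕ.< o
m<n*o⇒0<o {m} n zero    lt = ⊥-elim (ℕ.n≮0 (≡.subst (m ℕ.<_) (ℕ.*-zeroʳ n) lt))
m<n*o⇒0<o     n (suc o) lt = ℕ.s≤s ℕ.z≤n

-- The product 2 h² b. One `h` pays for `n ≤ h * n′`, the other for `h * κ ≤ n′`; the 2 comes from
-- probabilities being quadratic in amplitudes, and `b` from the degree lost in amplification.
overhead : ℕ → ℕ → ℕ
overhead h b = (h ℕ.* h ℕ.+ h ℕ.* h) ℕ.* b

-- With κ = ⌊2bT/t⌋, the chain t h² κ ≤ 2 h² b T ≤ μ ≤ n t ≤ h n′ t allows `h` and `t` to be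
-- cancelled. Few queries thus force the budget to be a small fraction of the active coordinates.
overhead-few : ∀ h b T t {n n′ μ} .{{_ : ℕ.NonZero h}} .{{_ : ℕ.NonZero t}} →
  overhead h b ℕ.* T ℕ.≤ μ → μ ℕ.≤ n ℕ.* t → n ℕ.≤ h ℕ.* n′ → h ℕ.* (b ℕ.* (T ℕ.+ T) ℕ./ t) ℕ.≤ n′
overhead-few h b T t {n} {n′} {μ} cost≤ μ≤ n≤ = ℕ.*-cancelˡ-≤ h
    (ℕ.*-cancelˡ-≤ {h ℕ.* (h ℕ.* κ)} {h ℕ.* n′} t (begin
  t ℕ.* (h ℕ.* (h ℕ.* κ))          ≡⟨ regroup₁ t h κ ⟩
  h ℕ.* h ℕ.* (κ ℕ.* t)            ≤⟨ ℕ.*-monoʳ-≤ (h ℕ.* h) (ℕ.m/n*n≤m (b ℕ.* (T ℕ.+ T)) t) ⟩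
  h ℕ.* h ℕ.* (b ℕ.* (T ℕ.+ T))    ≡⟨ regroup₂ h b T ⟩
  overhead h b ℕ.* T               ≤⟨ cost≤ ⟩
  μ                                ≤⟨ μ≤ ⟩
  n ℕ.* t                          ≤⟨ ℕ.*-monoˡ-≤ t n≤ ⟩
  h ℕ.* n′ ℕ.* t                   ≡⟨ ℕ.*-comm (h ℕ.* n′) t ⟩
  t ℕ.* (h ℕ.* n′)                 ∎))
  where
  open ℕ.≤-Reasoning
  κ = b ℕ.* (T ℕ.+ T) ℕ./ t
  regroup₁ : ∀ t h k → t ℕ.* (h ℕ.* (h ℕ.* k)) ≡ h ℕ.* h ℕ.* (k ℕ.* t)
  regroup₁ = ℕ-Solver.solve-∀
  regroup₂ : ∀ h b T → h ℕ.* h ℕ.* (b ℕ.* (T ℕ.+ T)) ≡ (h ℕ.* h ℕ.+ h ℕ.* h) ℕ.* b ℕ.* T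
  regroup₂ = ℕ-Solver.solve-∀

overhead-≥ : ∀ h b .{{_ : ℕ.NonZero b}} → h ℕ.* h ℕ.≤ overhead h b
overhead-≥ h b = ℕ.≤-trans (ℕ.m≤m+n (h ℕ.* h) (h ℕ.* h)) (ℕ.m≤m*n (h ℕ.* h ℕ.+ h ℕ.* h) b)

0<⌈0·99⌉ : ∀ {n} → 1 ℕ.≤ n → 0 ℕ.< ⌈0·99 n ⌉
0<⌈0·99⌉ {n} = ceiling>0 99 n (ℕ.s≤s ℕ.z≤n)

⌈0·99⌉≤ : ∀ n → ⌈0·99 n ⌉ ℕ.≤ n
⌈0·99⌉≤ = ceiling≤ 99

⌈0·99⌉-complement : ∀ {n} k → n ℕ.< k ℕ.+ ⌈0·99 n ⌉ → n ℕ.< 100 ℕ.* k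
⌈0·99⌉-complement {n} = ceiling-complement 99 n

^-distrib : ∀ a b k → (a ℕ.* b) ℕ.^ k ≡ a ℕ.^ k ℕ.* b ℕ.^ k
^-distrib a b zero    = ≡.refl
^-distrib a b (suc k) = ≡.trans (≡.cong (a ℕ.* b ℕ.*_) (^-distrib a b k)) (rearrange a b (a ℕ.^ k) (b ℕ.^ k))
  where
  rearrange : ∀ a b x y → a ℕ.* b ℕ.* (x ℕ.* y) ≡ a ℕ.* x ℕ.* (b ℕ.* y)
  rearrange = ℕ-Solver.solve-∀

-- Raise the inequality to the power `r`. Since `n`, `t` and `κ` are controlled by `n′`, the factor
-- 2^n becomes at most 2^(n′Q), and the factors 2^t 4^κ together at most 8^(n′Q). Everything is then
-- an (n′Q)-th power, and the comparison of bases is `gap`.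
power-gap : ∀ {n n′ t κ Q} a b r → 2 ℕ.* (2 ℕ.* 4 ℕ.* b ℕ.^ r) ℕ.< a ℕ.^ r →
  1 ℕ.≤ n′ → n ℕ.≤ r ℕ.* n′ → r ℕ.* t ℕ.≤ n′ → r ℕ.* κ ℕ.≤ n′ → r ℕ.* r ℕ.≤ Q → 1 ℕ.≤ Q →
  ¬ (a ℕ.^ (n′ ℕ.* Q) ℕ.≤ 2 ℕ.^ n ℕ.* (2 ℕ.^ t ℕ.* 4 ℕ.^ κ ℕ.* b ℕ.^ n′) ℕ.^ Q)
power-gap {n} {n′} {t} {κ} {Q} a b r gap 1≤n′ n≤ t≤ κ≤ Q≥ 1≤Q le = ℕ.<⇒≱ strict-power (begin
  (a ^ r) ^ N                                  ≡⟨ swap a r N ⟩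
  (a ^ N) ^ r                                  ≤⟨ ℕ.^-monoˡ-≤ r le ⟩
  (2 ^ n * X ^ Q) ^ r                           ≡⟨ ^-distrib (2 ^ n) (X ^ Q) r ⟩
  (2 ^ n) ^ r * (X ^ Q) ^ r                   ≡⟨ ≡.cong₂ _*_ (ℕ.^-*-assoc 2 n r) (swap X Q r) ⟩
  2 ^ (n * r) * (X ^ r) ^ Q                   ≤⟨ ℕ.*-mono-≤ (ℕ.^-monoʳ-≤ 2 nr≤N) (ℕ.^-monoˡ-≤ Q X^r≤) ⟩
  2 ^ N * ((2 * 4 * b ^ r) ^ n′) ^ Q           ≡⟨ ≡.cong (2 ^ N *_) (ℕ.^-*-assoc (2 * 4 * b ^ r) n′ Q) ⟩
  2 ^ N * (2 * 4 * b ^ r) ^ N                  ≡⟨ ≡.sym (^-distrib 2 (2 * 4 * b ^ r) N) ⟩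
  (2 * (2 * 4 * b ^ r)) ^ N                    ∎)
  where
  open import Data.Nat.Base using (_*_; _^_)
  open ℕ.≤-Reasoning
  N = n′ * Q
  X = 2 ^ t * 4 ^ κ * b ^ n′

  swap : ∀ a j k → (a ^ j) ^ k ≡ (a ^ k) ^ j
  swap a j k = ≡.trans (ℕ.^-*-assoc a j k) (≡.trans (≡.cong (a ^_) (ℕ.*-comm j k)) (≡.sym (ℕ.^-*-assoc a k j)))

  nr≤N : n * r ℕ.≤ N
  nr≤N = ℕ.≤-trans (ℕ.*-monoˡ-≤ r n≤) (ℕ.≤-trans (ℕ.≤-reflexive (regroup r n′)) (ℕ.*-monoʳ-≤ n′ Q≥))
    where
    regroup : ∀ r k → r * k * r ≡ k * (r * r)
    regroup = ℕ-Solver.solve-∀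

  X^r≤ : X ^ r ℕ.≤ (2 * 4 * b ^ r) ^ n′
  X^r≤ = begin
    X ^ r                                         ≡⟨ ^-distrib (2 ^ t * 4 ^ κ) (b ^ n′) r ⟩
    (2 ^ t * 4 ^ κ) ^ r * (b ^ n′) ^ r         ≡⟨ ≡.cong₂ _*_ (^-distrib (2 ^ t) (4 ^ κ) r) (swap b n′ r) ⟩
    (2 ^ t) ^ r * (4 ^ κ) ^ r * (b ^ r) ^ n′ ≤⟨ ℕ.*-monoˡ-≤ ((b ^ r) ^ n′)
        (ℕ.*-mono-≤ (small 2 t t≤) (small 4 κ κ≤)) ⟩
    2 ^ n′ * 4 ^ n′ * (b ^ r) ^ n′               ≡⟨ ≡.cong (_* (b ^ r) ^ n′) (≡.sym (^-distrib 2 4 n′)) ⟩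
    8 ^ n′ * (b ^ r) ^ n′                        ≡⟨ ≡.sym (^-distrib 8 (b ^ r) n′) ⟩
    (2 * 4 * b ^ r) ^ n′                         ∎
    where
    small : ∀ a .{{_ : ℕ.NonZero a}} j → r * j ℕ.≤ n′ → (a ^ j) ^ r ℕ.≤ a ^ n′
    small a j le = ℕ.≤-trans (ℕ.≤-reflexive (≡.trans (ℕ.^-*-assoc a j r) (≡.cong (a ^_) (ℕ.*-comm j r))))
        (ℕ.^-monoʳ-≤ a le)

  strict-power : (2 * (2 * 4 * b ^ r)) ^ N ℕ.< (a ^ r) ^ N
  strict-power = ℕ.^-monoˡ-< N {{ℕ.>-nonZero (ℕ.*-mono-≤ 1≤n′ 1≤Q)}} gap

-- The exponent 100 suffices because 16¹⁰⁰ > 16 · 15¹⁰⁰.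
final-numeric : ∀ {n n′ t κ Q} → 1 ℕ.≤ n′ → n ℕ.≤ 100 ℕ.* n′ → 100 ℕ.* t ℕ.≤ n′ → 100 ℕ.* κ ℕ.≤ n′ → 10000 ℕ.≤ Q →
  ¬ (16 ℕ.^ (n′ ℕ.* Q) ℕ.≤ 2 ℕ.^ n ℕ.* (2 ℕ.^ t ℕ.* 4 ℕ.^ κ ℕ.* 15 ℕ.^ n′) ℕ.^ Q)
final-numeric {n} {n′} {t} {κ} {Q} 1≤n′ n≤ t≤ κ≤ Q≥ = power-gap {n} {n′} {t} {κ} {Q} 16 15 100
  (ℕ.<ᵇ⇒< (2 ℕ.* (2 ℕ.* 4 ℕ.* 15 ℕ.^ 100)) (16 ℕ.^ 100) tt) 1≤n′ n≤ t≤ κ≤ Q≥ (ℕ.≤-trans (ℕ.s≤s ℕ.z≤n) Q≥)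

-- The splittings of all the functions are each known only under double negation; as there are
-- finitely many, one double negation covers them all.
¬¬-choice : ∀ {n} {P : Fin n → Set} → (∀ i → ¬ ¬ P i) → ¬ ¬ (∀ i → P i)
¬¬-choice {zero}  ¬¬p k = k λ ()
¬¬-choice {suc n} ¬¬p k = ¬¬p zero λ p → ¬¬-choice (¬¬p ∘ suc) λ ps → k λ where
  zero    → p
  (suc i) → ps i

-- Factors for the XOR and the threshold tasks

countTrue : ∀ {n} → (Fin n → Bool) → ℕ
countTrue {zero}  b = 0
countTrue {suc n} b = (if b zero then 1 else 0) ℕ.+ countTrue (b ∘ suc)

count-tabulate : ∀ {A : Set} {P : A → Set} (P? : Decidable P) {n} (g : Fin n → A) →
  count P? (tabulate g) ≡ countTrue (does ∘ P? ∘ g)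
count-tabulate P? {zero}  g = ≡.refl
count-tabulate P? {suc n} g with does (P? (g zero))
... | true  = ≡.cong suc (count-tabulate P? (g ∘ suc))
... | false = count-tabulate P? (g ∘ suc)

agree : Sign → Sign → Bool
agree s t = does (s Sign.≟ t)

agreements≡ : ∀ {n} (y z : Vec Sign n) → agreements y z ≡ countTrue (λ i → agree (lookup y i) (lookup z i))
agreements≡ y z = count-tabulate (λ i → lookup y i Sign.≟ lookup z i) (λ i → i)

agreements-self : ∀ {n} (y : Vec Sign n) → agreements y y ≡ n
agreements-self y = ≡.trans (agreements≡ y y) (all-agree y)
  where
  all-agree : ∀ {n} (y : Vec Sign n) → countTrue (λ i → agree (lookup y i) (lookup y i)) ≡ n
  all-agree []           = ≡.refl
  all-agree (Sign.+ ∷ y) = ≡.cong suc (all-agree y)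
  all-agree (Sign.- ∷ y) = ≡.cong suc (all-agree y)

scaleOf sizeOf : Bool → ℕ
scaleOf active = if active then 4 else 1
sizeOf  active = if active then 2 else 0

module Blocks (R : Reals) (τ : ℕ) where

  open Reals R hiding (zero)
  open RealNotions R
  open OrderedField R
  open Functionals R
  open LowDegreeFunctions R
  open DualMeasures R
  open ProductBound R τ public

  monomial-++ : ∀ {N N′} (α : Vec ℕ N) (β : Vec ℕ N′) x y →
    monomial (α Vec.++ β) (x Vec.++ y) ≈ monomial α x * monomial β y
  monomial-++ []      β []      y = sym (*-identityˡ _)
  monomial-++ (a ∷ α) β (s ∷ x) y = trans (*-congˡ (monomial-++ α β x y)) (sym (*-assoc _ _ _))

  monomial-concat : ∀ {n m} (αs : Vec (Vec ℕ m) n) (xs : Block n m) → monomial (concat αs) (concat xs)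
      ≈ blockMonomial αs xs
  monomial-concat []       []       = refl
  monomial-concat (α ∷ αs) (x ∷ xs) = trans (monomial-++ α (concat αs) x (concat xs))
      (*-congˡ (monomial-concat αs xs))

  sum-concat : ∀ {n m} (αs : Vec (Vec ℕ m) n) → Vec.sum (concat αs) ≡ blockDegree αs
  sum-concat []       = ≡.refl
  sum-concat (α ∷ αs) = ≡.trans (sum-++ α) (≡.cong (Vec.sum α ℕ.+_) (sum-concat αs))

  lowDegree⇒lowBlockDegree : ∀ {n m D k} {g : Vec Sign (n ℕ.* m) → Carrier} → boost ℕ.* D ℕ.< k ℕ.* τ →
    LowDegree D g → LowBlockDegree {n} {m} k (g ∘ concat)
  lowDegree⇒lowBlockDegree {n} {m} {D} {k} D< (p , deg , eq) =
    represented (blocks p) (degree deg) (λ xs → trans (value p xs) (eq (concat xs)))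
    where
    blocks : Polynomial (n ℕ.* m) → BlockPolynomial n m
    blocks []            = []
    blocks ((c , α) ∷ p) = (c , proj₁ (Vec.group n m α)) ∷ blocks p
    degree : ∀ {p} → DegreeAtMost D p → BlockDegreeBelow k (blocks p)
    degree {[]}          []         = []
    degree {(c , α) ∷ p} (le ∷ les) = ℕ.≤-<-trans (ℕ.*-monoʳ-≤ boost
      (ℕ.≤-trans (ℕ.≤-reflexive (≡.trans (≡.sym (sum-concat (proj₁ (Vec.group n m α))))
          (≡.cong Vec.sum (≡.sym (proj₂ (Vec.group n m α)))))) le)) D<
      ∷ degree les
    value : ∀ p xs → evalBlocks (blocks p) xs ≈ eval p (Vec.map fromSign (concat xs))
    value []            xs = refl
    value ((c , α) ∷ p) xs = +-cong (*-congˡ (trans (sym (monomial-concat (proj₁ (Vec.group n m α)) xs))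
      (reflexive (≡.cong (λ β → monomial β (concat xs)) (≡.sym (proj₂ (Vec.group n m α))))))) (value p xs)

  Splittings : ∀ {n m} → (Fin n → BoolFun m) → (Fin n → ℕ) → Set
  Splittings f d = ∀ i → Splitting (f i) (scaleOf (τ ℕ.≤ᵇ d i)) (sizeOf (τ ℕ.≤ᵇ d i))

  coordinates : ∀ (wa wb : Bool → ℕ) {n m} (f : Fin n → BoolFun m) (d : Fin n → ℕ) → Splittings f d →
      Vec (Coordinate m) n
  coordinates wa wb {zero}  f d sp = []
  coordinates wa wb {suc n} f d sp = record
    { f         = f zero
    ; scale     = scaleOf (τ ℕ.≤ᵇ d zero)
    ; size      = sizeOf (τ ℕ.≤ᵇ d zero)
    ; splitting = sp zero
    ; a         = wa (τ ℕ.≤ᵇ d zero)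
    ; b         = wb (τ ℕ.≤ᵇ d zero)
    } ∷ coordinates wa wb (f ∘ suc) (d ∘ suc) (sp ∘ suc)

  -- An active coordinate costs 0 + 3 = 3 for XOR and 12 + 3 = 15 for the threshold task. An
  -- inactive one costs 1 in both: XOR keeps its sign with weights 0 and 1, the threshold task
  -- disregards its correctness with weights 1 and 0.
  bounds-coordinates : ∀ wa wb r → wa true ℕ.+ wb true ℕ.* 3 ≡ r → wa false ℕ.+ wb false ℕ.* 1 ≡ 1 →
    ∀ {n m} (f : Fin n → BoolFun m) d (sp : Splittings f d) → bounds (coordinates wa wb f d sp) ≡ r ℕ.^ count≥ τ d
  bounds-coordinates wa wb r active passive {zero}  f d sp = ≡.refl
  bounds-coordinates wa wb r active passive {suc n} f d sp with τ ℕ.≤ᵇ d zero | sp zero | bounds-coordinates wa wb r active passive (f ∘ suc) (d ∘ suc) (sp ∘ suc)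
  ... | true  | _ | ih = ≡.cong₂ ℕ._*_ active ih
  ... | false | _ | ih = ≡.trans (≡.cong₂ ℕ._*_ passive ih) (ℕ.*-identityˡ _)

  -- An active coordinate contributes the factor 4 z f to the XOR task and 12 + 4 z f to the threshold task.
  xorCoordinates thresholdCoordinates : ∀ {n m} (f : Fin n → BoolFun m) (d : Fin n → ℕ) → Splittings f d →
      Vec (Coordinate m) n
  xorCoordinates       = coordinates (λ _ → 0) (λ _ → 1)
  thresholdCoordinates = coordinates (λ active → if active then 12 else 1) (λ active → if active then 1 else 0)

  factors-xor : ∀ {n m} (f : Fin n → BoolFun m) d (sp : Splittings f d) (xs : Block n m) →
    factors (xorCoordinates f d sp) (Vec.replicate n Sign.+) xs ≈ fromℕ (4 ℕ.^ count≥ τ d) * fromSign (⨂ f xs)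
  factors-xor {zero}  f d sp [] = sym (trans (*-identityʳ _) fromℕ-1)
  factors-xor {suc n} f d sp (x ∷ xs) = trans (*-cong first (factors-xor (f ∘ suc) (d ∘ suc) (sp ∘ suc) xs))
    (trans (solve 4 (λ a b c d → a :* b :* (c :* d) := (a :* c) :* (b :* d)) refl
        (fromℕ (scaleOf (τ ℕ.≤ᵇ d zero))) _ _ _)
      (*-cong (scales (τ ℕ.≤ᵇ d zero) _) (sym (fromSign-* (f zero x) (⨂ (f ∘ suc) xs)))))
    where
    first : 0# + fromℕ 1 * (fromℕ (scaleOf (τ ℕ.≤ᵇ d zero)) * (1# * fromSign (f zero x)))
        ≈ fromℕ (scaleOf (τ ℕ.≤ᵇ d zero)) * fromSign (f zero x)
    first = trans (+-identityˡ _) (trans (*-congʳ fromℕ-1) (trans (*-identityˡ _) (*-congˡ (*-identityˡ _))))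
    scales : ∀ active k → fromℕ (scaleOf active) * fromℕ (4 ℕ.^ k)
        ≈ fromℕ (4 ℕ.^ ((if active then 1 else 0) ℕ.+ k))
    scales true  k = sym (fromℕ-* 4 (4 ℕ.^ k))
    scales false k = trans (*-congʳ fromℕ-1) (*-identityˡ _)

  -- The values 12 ± 4 of an active factor are natural numbers, so the effect of errors can be
  -- counted in `ℕ`.
  thresholdFactor : Bool → Sign → Sign → ℕ
  thresholdFactor active z s = if active then (if agree z s then 16 else 8) else 1

  factor≈ : ∀ active z s →
      fromℕ (if active then 12 else 1) + fromℕ (if active then 1 else 0) *
          (fromℕ (scaleOf active) * (fromSign z * fromSign s))
    ≈ fromℕ (thresholdFactor active z s)
  factor≈ false z s = trans (+-congˡ (zeroˡ _)) (+-identityʳ _)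
  factor≈ true Sign.+ Sign.+ = trans (+-congˡ (*-congʳ fromℕ-1))
      (solve 0 (con (+ 12) :+ con (+ 1) :* (con (+ 4) :* (con (+ 1) :* con (+ 1))) := con (+ 16)) refl)
  factor≈ true Sign.+ Sign.- = trans (+-congˡ (*-congʳ fromℕ-1))
      (solve 0 (con (+ 12) :+ con (+ 1) :* (con (+ 4) :* (con (+ 1) :* (:- con (+ 1)))) := con (+ 8)) refl)
  factor≈ true Sign.- Sign.+ = trans (+-congˡ (*-congʳ fromℕ-1))
      (solve 0 (con (+ 12) :+ con (+ 1) :* (con (+ 4) :* ((:- con (+ 1)) :* con (+ 1))) := con (+ 8)) refl)
  factor≈ true Sign.- Sign.- = trans (+-congˡ (*-congʳ fromℕ-1))
      (solve 0 (con (+ 12) :+ con (+ 1) :* (con (+ 4) :* ((:- con (+ 1)) :* (:- con (+ 1)))) := con (+ 16)) refl)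

  thresholdFactors : ∀ {n m} (f : Fin n → BoolFun m) (d : Fin n → ℕ) → Vec Sign n → Block n m → ℕ
  thresholdFactors {zero}  f d []       []       = 1
  thresholdFactors {suc n} f d (z ∷ zs) (x ∷ xs) =
    thresholdFactor (τ ℕ.≤ᵇ d zero) z (f zero x) ℕ.* thresholdFactors (f ∘ suc) (d ∘ suc) zs xs

  factors-threshold : ∀ {n m} (f : Fin n → BoolFun m) d (sp : Splittings f d) zs (xs : Block n m) →
    factors (thresholdCoordinates f d sp) zs xs ≈ fromℕ (thresholdFactors f d zs xs)
  factors-threshold {zero}  f d sp []       []       = sym fromℕ-1
  factors-threshold {suc n} f d sp (z ∷ zs) (x ∷ xs) = trans
    (*-cong (factor≈ (τ ℕ.≤ᵇ d zero) z (f zero x)) (factors-threshold (f ∘ suc) (d ∘ suc) (sp ∘ suc) zs xs))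
    (sym (fromℕ-* (thresholdFactor (τ ℕ.≤ᵇ d zero) z (f zero x)) _))

  -- A disagreement costs at most a factor 2.
  thresholdFactors-≥ : ∀ {n m} (f : Fin n → BoolFun m) d zs (xs : Block n m) →
    16 ℕ.^ count≥ τ d ℕ.* 2 ℕ.^ countTrue (λ i → agree (lookup zs i)
        (lookup (values f xs) i)) ℕ.≤ thresholdFactors f d zs xs ℕ.* 2 ℕ.^ n
  thresholdFactors-≥ {zero}  f d []       []       = ℕ.≤-refl
  thresholdFactors-≥ {suc n} f d (z ∷ zs) (x ∷ xs) =
    ℕ.≤-trans (ℕ.≤-reflexive (split (τ ℕ.≤ᵇ d zero) (agree z (f zero x)) _ _))
      (ℕ.≤-trans (ℕ.*-mono-≤ (one (τ ℕ.≤ᵇ d zero) (agree z (f zero x)))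
          (thresholdFactors-≥ (f ∘ suc) (d ∘ suc) zs xs))
        (ℕ.≤-reflexive (regroup (thresholdFactor (τ ℕ.≤ᵇ d zero) z (f zero x)) 2
            (thresholdFactors (f ∘ suc) (d ∘ suc) zs xs) (2 ℕ.^ n))))
    where
    regroup : ∀ a b c e → a ℕ.* b ℕ.* (c ℕ.* e) ≡ a ℕ.* c ℕ.* (b ℕ.* e)
    regroup = ℕ-Solver.solve-∀
    split : ∀ (p q : Bool) j k → 16 ℕ.^ ((if p then 1 else 0) ℕ.+ j) ℕ.* 2 ℕ.^ ((if q then 1 else 0) ℕ.+ k)
      ≡ 16 ℕ.^ (if p then 1 else 0) ℕ.* 2 ℕ.^ (if q then 1 else 0) ℕ.* (16 ℕ.^ j ℕ.* 2 ℕ.^ k)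
    split p q j k = ≡.trans (≡.cong₂ ℕ._*_ (ℕ.^-distribˡ-+-* 16 (if p then 1 else 0) j)
        (ℕ.^-distribˡ-+-* 2 (if q then 1 else 0) k))
      (regroup (16 ℕ.^ (if p then 1 else 0)) (16 ℕ.^ j) (2 ℕ.^ (if q then 1 else 0)) (2 ℕ.^ k))
    one : ∀ (p q : Bool) → 16 ℕ.^ (if p then 1 else 0) ℕ.* 2 ℕ.^ (if q then 1 else 0)
        ℕ.≤ (if p then (if q then 16 else 8) else 1) ℕ.* 2
    one true  true  = ℕ.≤-refl
    one true  false = ℕ.≤-refl
    one false true  = ℕ.≤-refl
    one false false = ℕ.s≤s ℕ.z≤n

  -- With `g` agreements and at most `t` errors, 2^n ≤ 2^g · 2^t; cancelling 2^g leaves the loss 2^t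
  -- against a fully correct output.
  thresholdFactors-few-errors : ∀ {n m t} (f : Fin n → BoolFun m) d zs (xs : Block n m) →
    n ℕ.≤ agreements zs (values f xs) ℕ.+ t → 16 ℕ.^ count≥ τ d ℕ.≤ 2 ℕ.^ t ℕ.* thresholdFactors f d zs xs
  thresholdFactors-few-errors {n} {t = t} f d zs xs le = ℕ.*-cancelʳ-≤ _ _ (2 ℕ.^ g) {{ℕ.m^n≢0 2 g}}
    (ℕ.≤-trans (thresholdFactors-≥ f d zs xs) (ℕ.≤-trans
      (ℕ.*-monoʳ-≤ F (ℕ.^-monoʳ-≤ 2 (≡.subst (λ g → n ℕ.≤ g ℕ.+ t) (agreements≡ zs (values f xs)) le)))
      (ℕ.≤-reflexive (≡.trans (≡.cong (F ℕ.*_) (ℕ.^-distribˡ-+-* 2 g t)) (regroup F (2 ℕ.^ g) (2 ℕ.^ t))))))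
    where
    g = countTrue (λ i → agree (lookup zs i) (lookup (values f xs) i))
    F = thresholdFactors f d zs xs
    regroup : ∀ a b c → a ℕ.* (b ℕ.* c) ≡ c ℕ.* a ℕ.* b
    regroup = ℕ-Solver.solve-∀

splitting : (R : Reals) → let open RealNotions R in ∀ τ {m} (f : BoolFun m) d →
  IsApproxDegree (1/ 5) f d → ¬ ¬ ProductBound.Splitting R (suc τ) f (scaleOf (suc τ ℕ.≤ᵇ d))
      (sizeOf (suc τ ℕ.≤ᵇ d))
splitting R τ f d approx k with suc τ ℕ.≤ᵇ d in eq
... | true  = DualMeasures.dualPair R f approx (ℕ.≤ᵇ⇒≤ (suc τ) d (≡.subst T (≡.sym eq) tt))
                (λ pair → k (ProductBound.dualSplitting R (suc τ) pair))
... | false = k (ProductBound.trivialSplitting R (suc τ) f)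

-- From the product bound to a contradiction

abstract
  -- The reciprocal of the constant c.
  costFactor : ℕ
  costFactor = overhead 100 boost

  costFactor≡ : costFactor ≡ overhead 100 boost
  costFactor≡ = ≡.refl

  10000≤costFactor : 10000 ℕ.≤ costFactor
  10000≤costFactor = overhead-≥ 100 boost

instance
  costFactor-nonZero : ℕ.NonZero costFactor
  costFactor-nonZero = ℕ.>-nonZero (ℕ.≤-trans (ℕ.s≤s ℕ.z≤n) 10000≤costFactor)

module Bounds (R : Reals) where

  open Reals R hiding (zero)
  open RealNotions R
  open OrderedField R
  open Functionals R
  open LowDegreeFunctions R
  open QueryPolynomials R

  fromSign*≤ : ∀ s {q} → 0# ≤ q → fromSign s * q ≤ q
  fromSign*≤ Sign.+ {q} 0≤q = ≤-reflexive (*-identityˡ q)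
  fromSign*≤ Sign.- {q} 0≤q = 0≤⇒≤ (≤-respʳ-≈ (solve 1 (λ q → q :+ q := q :- (:- con (+ 1)) :* q) refl q)
      (+-nonneg 0≤q 0≤q))

  0≤fromSign*+ : ∀ s {q} → 0# ≤ q → 0# ≤ fromSign s * q + q
  0≤fromSign*+ Sign.+ {q} 0≤q = +-nonneg (≤-respʳ-≈ (sym (*-identityˡ q)) 0≤q) 0≤q
  0≤fromSign*+ Sign.- {q} 0≤q = ≤-reflexive (solve 1 (λ q → con (+ 0) := (:- con (+ 1)) :* q :+ q) refl q)

  restrict : ∀ {K} → Subset K → (Fin K → Carrier) → Fin K → Carrier
  restrict S g k = if lookup S k then g k else 0#

  SolvesXor : ∀ {n m T} → (Fin n → BoolFun m) → Carrier → QueryAlgorithm Sign (n ℕ.* m) T → Set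
  SolvesXor f δ A = ∀ x → OutputProbabilityAtLeast (1/ 2 + δ) A (concat x) (λ z → z ≡ ⨂ f x)

  SolvesUpTo : ∀ {n m T} → ℕ → (Fin n → BoolFun m) → Carrier → QueryAlgorithm (Vec Sign n) (n ℕ.* m) T → Set
  SolvesUpTo {n} t f δ A =
    ∀ x → OutputProbabilityAtLeast δ A (concat x) (λ z → n ℕ.≤ agreements z (values f x) ℕ.+ t)

  module _ {n m : ℕ} (f : Fin n → BoolFun m) (d : Fin n → ℕ) (T : ℕ) where

    -- What a too cheap algorithm would provide. The threshold is stored as `suc τ`, hence positive;
    -- `2T<` says that after amplification the degree of the probabilities leaves room for at most
    -- `κ` annihilators.
    record Setup : Set where
      field
        τ κ        : ℕ
        splittings : Blocks.Splittings R (suc τ) f d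
        2T<        : boost ℕ.* (T ℕ.+ T) ℕ.< suc κ ℕ.* suc τ
      n′ : ℕ
      n′ = count≥ (suc τ) d
      field
        many       : n ℕ.≤ 100 ℕ.* n′
        nonempty   : 1 ℕ.≤ n′
        few        : 100 ℕ.* κ ℕ.≤ n′

    module _ {c : Carrier} (Qc≈1 : fromℕ costFactor * c ≈ 1#) where

      cost-ℕ : ∀ {μ} → fromℕ T < c * fromℕ μ → costFactor ℕ.* T ℕ.< μ
      cost-ℕ {μ} lt = fromℕ-cancel-< (<-respˡ-≈ (sym (fromℕ-* costFactor T)) (<-respʳ-≈
        (trans (sym (*-assoc _ c _)) (trans (*-congʳ Qc≈1) (*-identityˡ _)))
        (*-monoˡ-< (fromℕ-mono-< {0} {costFactor} (ℕ.>-nonZero⁻¹ costFactor)) lt)))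

      setup : 1 ℕ.≤ n → (∀ i → IsApproxDegree (1/ 5) (f i) (d i)) → ∀ {μ} → IsMinSubsetSum ⌈0·99 n ⌉ d μ →
        fromℕ T < c * fromℕ μ → ¬ ¬ Setup
      setup 1≤n approx {μ} min lt k = from-threshold (threshold (0<⌈0·99⌉ 1≤n) (⌈0·99⌉≤ n) min)
        where
        from-threshold : ∃[ τ ] n ℕ.< count≥ τ d ℕ.+ ⌈0·99 n ⌉ × μ ℕ.≤ n ℕ.* τ → ⊥
        -- A zero threshold would make `μ` zero, which no number of queries is below.
        from-threshold (zero  , _ , μ≤) = ℕ.<⇒≱ (cost-ℕ lt)
            (ℕ.≤-trans μ≤ (ℕ.≤-trans (ℕ.≤-reflexive (ℕ.*-zeroʳ n)) ℕ.z≤n))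
        from-threshold (suc τ , many , μ≤) = ¬¬-choice (λ i → splitting R τ (f i) (d i) (approx i)) λ sp → k record
          { τ          = τ
          ; κ          = boost ℕ.* (T ℕ.+ T) ℕ./ suc τ
          ; splittings = sp
          ; 2T<        = m<[1+m/n]*n (boost ℕ.* (T ℕ.+ T)) (suc τ)
          ; many       = ℕ.<⇒≤ n<100n′
          ; nonempty   = m<n*o⇒0<o 100 n′ n<100n′
          ; few        = overhead-few 100 boost T (suc τ)
              (≡.subst (λ Q → Q ℕ.* T ℕ.≤ μ) costFactor≡ (ℕ.<⇒≤ (cost-ℕ lt))) μ≤ (ℕ.<⇒≤ n<100n′)
          }
          where
          n′ = count≥ (suc τ) d
          n<100n′ : n ℕ.< 100 ℕ.* n′
          n<100n′ = ⌈0·99⌉-complement n′ many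

      -- The defining comparison of `δ` with powers of 2 is used once, with numerator `0 - n` and
      -- denominator `costFactor`. Since `costFactor * c` is 1, the exponents agree and no other
      -- property of the real power is required.
      power-bound : ∀ {δ} → δ ≈2^ (- (c * fromℕ n)) → 1# ≤ fromℕ (2 ℕ.^ n) * δ ^ costFactor
      power-bound (_ , compare) = ≤-respʳ-≈ (*-congʳ (sym (fromℕ-^ 2 n)))
        (proj₁ (compare 0 n costFactor) (≤-reflexive (sym (trans (+-congˡ exponent) (-‿inverseʳ (fromℕ n))))))
        where
        exponent : fromℕ costFactor * - (c * fromℕ n) ≈ - fromℕ n
        exponent = trans (solve 3 (λ q c n → q :* (:- (c :* n)) := :- (q :* c :* n)) refl (fromℕ costFactor) c
            (fromℕ n))
          (-‿cong (trans (*-congʳ Qc≈1) (*-identityˡ _)))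

      -- Both tasks lead to this inequality. Raising it to the power `costFactor` replaces δ by
      -- 2^(-n), and what remains contradicts `final-numeric`.
      refute : (S : Setup) → let open Setup S in ∀ {δ} → δ ≈2^ (- (c * fromℕ n)) → ∀ {t} → 100 ℕ.* t ℕ.≤ n′ →
        ¬ (δ * fromℕ (16 ℕ.^ n′) ≤ fromℕ (2 ℕ.^ t ℕ.* 4 ℕ.^ κ ℕ.* 15 ℕ.^ n′))
      refute S {δ} δ≈ {t} t≤ le = final-numeric {n} {n′} {t} {κ} {costFactor} nonempty many t≤ few 10000≤costFactor (fromℕ-cancel-≤ (begin
        fromℕ (16 ℕ.^ (n′ ℕ.* Q))                       ≈⟨ sym (*-identityˡ _) ⟩
        1# * fromℕ (16 ℕ.^ (n′ ℕ.* Q))                  ≤⟨ *-mono-≤ 0≤1 (0≤fromℕ (16 ℕ.^ (n′ ℕ.* Q)))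
            (power-bound δ≈) ≤-refl ⟩
        fromℕ (2 ℕ.^ n) * δ ^ Q * fromℕ (16 ℕ.^ (n′ ℕ.* Q)) ≈⟨ *-assoc _ _ _ ⟩
        fromℕ (2 ℕ.^ n) * (δ ^ Q * fromℕ (16 ℕ.^ (n′ ℕ.* Q))) ≈⟨ *-congˡ
            (*-congˡ (trans (reflexive (≡.cong fromℕ (≡.sym (ℕ.^-*-assoc 16 n′ Q)))) (fromℕ-^ (16 ℕ.^ n′) Q))) ⟩
        fromℕ (2 ℕ.^ n) * (δ ^ Q * fromℕ (16 ℕ.^ n′) ^ Q) ≈⟨ *-congˡ (sym (^-distrib-* δ _ Q)) ⟩
        fromℕ (2 ℕ.^ n) * (δ * fromℕ (16 ℕ.^ n′)) ^ Q   ≤⟨ *-monoˡ-≤ (0≤fromℕ (2 ℕ.^ n))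
            (^-mono-≤ Q (*-nonneg (<⇒≤ (proj₁ δ≈)) (0≤fromℕ (16 ℕ.^ n′))) le) ⟩
        fromℕ (2 ℕ.^ n) * fromℕ X ^ Q                   ≈⟨ sym
            (trans (fromℕ-* (2 ℕ.^ n) (X ℕ.^ Q)) (*-congˡ (fromℕ-^ X Q))) ⟩
        fromℕ (2 ℕ.^ n ℕ.* X ℕ.^ Q)                     ∎))
        where
        open Setup S
        open ≤-Reasoning
        Q = costFactor
        X = 2 ℕ.^ t ℕ.* 4 ℕ.^ κ ℕ.* 15 ℕ.^ n′

    module _ (S : Setup) where

      open Setup S
      open Blocks R (suc τ)

      probability-low : ∀ {O} (A : QueryAlgorithm O (n ℕ.* m) T) κ′ →
        LowBlockDegree {n} {m} (suc κ) (λ xs → QueryAlgorithm.outcomeProbability A (concat xs) κ′)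
      probability-low A κ′ = lowDegree⇒lowBlockDegree {n} {m} {g = λ x → QueryAlgorithm.outcomeProbability A x κ′} 2T< (lowDegree-outcomeProbability A κ′)

      -- The product measure has mass 1, so a lower bound valid at every input survives integration,
      -- where `productBound` with H = 1 limits it from above.
      averaged : ∀ {K} (cs : Vec (Coordinate m) n) (z : Fin K → Vec Sign n) (p : Fin K → Block n m → Carrier) {L} →
        (∀ k → LowBlockDegree (suc κ) (p k)) → SignSumsBelow p 1# →
        (∀ xs → L ≤ sum (λ k → p k xs * factors cs (z k) xs)) → L ≤ fromℕ (4 ℕ.^ κ ℕ.* bounds cs)
      averaged cs z p {L} low below L≤ = begin
        L                                                     ≈⟨ sym
            (trans (apply-const M L) (trans (*-congˡ (measures-total cs)) (*-identityʳ L))) ⟩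
        ∫ (measures cs) (λ _ → L)                             ≤⟨ monotone (measures cs) L≤ ⟩
        ∫ (measures cs) (λ xs → sum (λ k → p k xs * factors cs (z k) xs)) ≈⟨ apply-sum M
            (λ k xs → p k xs * factors cs (z k) xs) ⟩
        integralSum cs z p                                    ≤⟨ productBound cs (suc κ) z p 0≤1 low below ⟩
        fromℕ (4 ℕ.^ κ ℕ.* bounds cs) * 1#                    ≈⟨ *-identityʳ _ ⟩
        fromℕ (4 ℕ.^ κ ℕ.* bounds cs)                         ∎
        where
        open ≤-Reasoning
        M = functional (measures cs)

      module _ (A : QueryAlgorithm Sign (n ℕ.* m) T) {δ : Carrier} (0≤δ : 0# ≤ δ) (correct : SolvesXor f δ A) where

        open QueryAlgorithm A

        private
          signedProbability : Fin K → Block n m → Carrier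
          signedProbability k xs = fromSign (output k) * outcomeProbability (concat xs) k

          below : SignSumsBelow signedProbability 1#
          below ε xs = ≤-trans (sum-mono K (λ k → ≤-trans
              (≤-reflexive (trans (sym (*-assoc _ _ _)) (*-congʳ (sym (fromSign-* (ε k) (output k))))))
              (fromSign*≤ (ε k Sign.* output k) (outcomeProbability-nonneg A (concat xs) k))))
            (≤-reflexive (outcomeProbability-sum A (concat xs)))

          -- Adding the total probability 1 to the signed sum counts every correct outcome twice and
          -- no outcome negatively. So the signed sum is at least 2(1/2 + δ) - 1 = 2δ, of which δ is
          -- kept.
          bias : ∀ xs → δ ≤ fromSign (⨂ f xs) * sum (λ k → signedProbability k xs)
          bias xs with correct xs
          ... | S , right , δ≤ = 0≤⇒≤ (≤-respʳ-≈ rearranged (+-nonneg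
              (≤⇒0≤ (≤-trans (+-mono-≤ δ≤ δ≤) doubled)) 0≤δ))
            where
            s = fromSign (⨂ f xs)
            Σₖ = functional (sumMeasure K)
            prob = outcomeProbability (concat xs)
            total-biased = s * sum (λ k → signedProbability k xs) + sum prob
            correct-part = sum (restrict S prob)
            pointwise : ∀ k → restrict S prob k + restrict S prob k ≤ s * signedProbability k xs + prob k
            pointwise k with lookup S k in eq
            ... | true  = ≤-reflexive (+-congʳ (sym (trans (sym (*-assoc _ _ _)) (trans (*-congʳ
              (trans (*-congˡ (reflexive (≡.cong fromSign (right k (lookup⇒[]= k S eq)))))
                  (Amplification.fromSign-square (⨂ f xs))))
              (*-identityˡ _)))))
            ... | false = ≤-respˡ-≈ (sym (+-identityˡ 0#)) (≤-respʳ-≈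
              (+-congʳ (trans (*-congʳ (fromSign-* (⨂ f xs) (output k))) (*-assoc _ _ _)))
              (0≤fromSign*+ (⨂ f xs Sign.* output k) (outcomeProbability-nonneg A (concat xs) k)))
            doubled : correct-part + correct-part ≤ total-biased
            doubled = ≤-respˡ-≈ (additive Σₖ (restrict S prob) (restrict S prob))
              (≤-respʳ-≈ (trans (additive Σₖ (λ k → s * signedProbability k xs) prob)
                  (+-congʳ (homogeneous Σₖ s (λ k → signedProbability k xs))))
                (sum-mono K pointwise))
            rearranged : total-biased - ((1/ 2 + δ) + (1/ 2 + δ)) + δ ≈ s * sum (λ k → signedProbability k xs) - δ
            rearranged = trans (+-congʳ (+-congʳ (+-congˡ (outcomeProbability-sum A (concat xs)))))
              (trans (+-congʳ (+-congʳ (+-congˡ (sym Amplification.half+half))))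
                (solve 3 (λ b h δ → b :+ (h :+ h) :- ((h :+ δ) :+ (h :+ δ)) :+ δ := b :- δ) refl _ (1/ 2) δ))

        -- The product bound gives δ 4^n′ ≤ 4^κ 3^n′. Multiplying by 4^n′ and relaxing 12 to 15
        -- brings it to the form shared with the threshold task.
        xor-bound : δ * fromℕ (16 ℕ.^ n′) ≤ fromℕ (2 ℕ.^ 0 ℕ.* 4 ℕ.^ κ ℕ.* 15 ℕ.^ n′)
        xor-bound = begin
          δ * fromℕ (16 ℕ.^ n′)                         ≡⟨ ≡.cong (λ k → δ * fromℕ k) (^-distrib 4 4 n′) ⟩
          δ * fromℕ (4 ℕ.^ n′ ℕ.* 4 ℕ.^ n′)             ≈⟨ trans (*-congˡ (fromℕ-* (4 ℕ.^ n′) (4 ℕ.^ n′)))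
              (sym (*-assoc _ _ _)) ⟩
          δ * fromℕ (4 ℕ.^ n′) * fromℕ (4 ℕ.^ n′)       ≤⟨ *-mono-≤ (*-nonneg 0≤δ (0≤fromℕ (4 ℕ.^ n′)))
              (0≤fromℕ (4 ℕ.^ n′)) δ4≤ ≤-refl ⟩
          fromℕ (4 ℕ.^ κ ℕ.* bounds cs) * fromℕ (4 ℕ.^ n′) ≈⟨ sym (fromℕ-* (4 ℕ.^ κ ℕ.* bounds cs) (4 ℕ.^ n′)) ⟩
          fromℕ (4 ℕ.^ κ ℕ.* bounds cs ℕ.* 4 ℕ.^ n′)    ≤⟨ fromℕ-mono-≤ 3≤15 ⟩
          fromℕ (2 ℕ.^ 0 ℕ.* 4 ℕ.^ κ ℕ.* 15 ℕ.^ n′)     ∎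
          where
          open ≤-Reasoning
          cs = xorCoordinates f d splittings
          -- The output sign is already part of `signedProbability`, so the coordinates themselves
          -- carry the sign +.
          zs : Vec Sign n
          zs = Vec.replicate n Sign.+
          pointwise : ∀ xs → δ * fromℕ (4 ℕ.^ n′) ≤ sum (λ k → signedProbability k xs * factors cs zs xs)
          pointwise xs = begin
            δ * fromℕ (4 ℕ.^ n′)                        ≤⟨ *-mono-≤ 0≤δ (0≤fromℕ (4 ℕ.^ n′)) (bias xs) ≤-refl ⟩
            fromSign (⨂ f xs) * sum (λ k → signedProbability k xs) * fromℕ (4 ℕ.^ n′)
              ≈⟨ solve 3 (λ s p g → s :* p :* g := p :* (g :* s)) refl _ _ _ ⟩
            sum (λ k → signedProbability k xs) * (fromℕ (4 ℕ.^ n′) * fromSign (⨂ f xs))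
              ≈⟨ *-congˡ (sym (factors-xor f d splittings xs)) ⟩
            sum (λ k → signedProbability k xs) * factors cs zs xs
              ≈⟨ sym (homogeneousʳ (functional (sumMeasure K)) (factors cs zs xs) (λ k → signedProbability k xs)) ⟩
            sum (λ k → signedProbability k xs * factors cs zs xs) ∎
          δ4≤ : δ * fromℕ (4 ℕ.^ n′) ≤ fromℕ (4 ℕ.^ κ ℕ.* bounds cs)
          δ4≤ = averaged cs (λ _ → zs) signedProbability
              (λ k → lowBlockDegree-scale _ (probability-low A k)) below pointwise
          3≤15 : 4 ℕ.^ κ ℕ.* bounds cs ℕ.* 4 ℕ.^ n′ ℕ.≤ 2 ℕ.^ 0 ℕ.* 4 ℕ.^ κ ℕ.* 15 ℕ.^ n′
          3≤15 = ℕ.≤-trans (ℕ.≤-reflexive (≡.trans (≡.cong (λ b → 4 ℕ.^ κ ℕ.* b ℕ.* 4 ℕ.^ n′)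
              (bounds-coordinates (λ _ → 0) (λ _ → 1) 3 ≡.refl ≡.refl f d splittings))
              (≡.trans (ℕ.*-assoc (4 ℕ.^ κ) (3 ℕ.^ n′) (4 ℕ.^ n′))
                  (≡.cong₂ ℕ._*_ (≡.sym (ℕ.*-identityˡ (4 ℕ.^ κ))) (≡.sym (^-distrib 3 4 n′))))))
            (ℕ.*-monoʳ-≤ (1 ℕ.* 4 ℕ.^ κ) (ℕ.^-monoˡ-≤ n′ (ℕ.m≤m+n 12 3)))

      module _ (A : QueryAlgorithm (Vec Sign n) (n ℕ.* m) T) {δ : Carrier} (0≤δ : 0# ≤ δ) {t : ℕ}
        (correct : SolvesUpTo t f δ A) where

        open QueryAlgorithm A

        private
          probability : Fin K → Block n m → Carrier
          probability k xs = outcomeProbability (concat xs) k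

          below : SignSumsBelow probability 1#
          below ε xs = ≤-trans (sum-mono K (λ k → fromSign*≤ (ε k) (outcomeProbability-nonneg A (concat xs) k)))
            (≤-reflexive (outcomeProbability-sum A (concat xs)))

        -- An output with at most `t` errors has product of factors at least 16^n′ / 2^t, and such
        -- outputs have probability at least δ on every input. Hence δ 16^n′ / 2^t bounds the
        -- weighted sum from below pointwise; averaging and multiplying back by 2^t concludes.
        threshold-bound : δ * fromℕ (16 ℕ.^ n′) ≤ fromℕ (2 ℕ.^ t ℕ.* 4 ℕ.^ κ ℕ.* 15 ℕ.^ n′)
        threshold-bound = begin
          δ * fromℕ (16 ℕ.^ n′) ≤⟨ averaged-scaled ⟩
          fromℕ (2 ℕ.^ t) * fromℕ (4 ℕ.^ κ ℕ.* bounds cs) ≈⟨ sym (fromℕ-* (2 ℕ.^ t) (4 ℕ.^ κ ℕ.* bounds cs)) ⟩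
          fromℕ (2 ℕ.^ t ℕ.* (4 ℕ.^ κ ℕ.* bounds cs))     ≡⟨ ≡.cong fromℕ
              (≡.trans (≡.sym (ℕ.*-assoc (2 ℕ.^ t) (4 ℕ.^ κ) (bounds cs)))
            (≡.cong (2 ℕ.^ t ℕ.* 4 ℕ.^ κ ℕ.*_) (bounds-coordinates _ _ 15 ≡.refl ≡.refl f d splittings))) ⟩
          fromℕ (2 ℕ.^ t ℕ.* 4 ℕ.^ κ ℕ.* 15 ℕ.^ n′)       ∎
          where
          open ≤-Reasoning
          cs = thresholdCoordinates f d splittings
          half^ : Carrier
          half^ = proj₁ (reciprocal (fromℕ-mono-< {0} (ℕ.m^n>0 2 t)))
          0≤half^ = <⇒≤ (proj₁ (proj₂ (reciprocal (fromℕ-mono-< {0} (ℕ.m^n>0 2 t)))))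
          half^-inverse = proj₂ (proj₂ (reciprocal (fromℕ-mono-< {0} (ℕ.m^n>0 2 t))))
          pointwise : ∀ xs → half^ * (δ * fromℕ (16 ℕ.^ n′))
              ≤ sum (λ k → probability k xs * factors cs (output k) xs)
          pointwise xs with correct xs
          ... | S , right , δ≤ = begin
            half^ * (δ * fromℕ (16 ℕ.^ n′))             ≈⟨ solve 3
                (λ h δ g → h :* (δ :* g) := δ :* (h :* g)) refl _ _ _ ⟩
            δ * (half^ * fromℕ (16 ℕ.^ n′))             ≤⟨ *-mono-≤ 0≤δ
                (*-nonneg 0≤half^ (0≤fromℕ (16 ℕ.^ n′))) δ≤ ≤-refl ⟩
            sum (restrict S prob) * (half^ * fromℕ (16 ℕ.^ n′)) ≈⟨ sym
                (homogeneousʳ (functional (sumMeasure K)) _ (restrict S prob)) ⟩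
            sum (λ k → restrict S prob k * (half^ * fromℕ (16 ℕ.^ n′))) ≤⟨ sum-mono K each ⟩
            sum (λ k → prob k * factors cs (output k) xs) ∎
            where
            prob = outcomeProbability (concat xs)
            nonneg : ∀ k → 0# ≤ factors cs (output k) xs
            nonneg k = ≤-respʳ-≈ (sym (factors-threshold f d splittings (output k) xs))
                (0≤fromℕ (thresholdFactors f d (output k) xs))
            each : ∀ k → restrict S prob k * (half^ * fromℕ (16 ℕ.^ n′)) ≤ prob k * factors cs (output k) xs
            each k with lookup S k in eq
            -- Outcomes outside the guaranteed set are dropped, which is permitted because their
            -- factors are nonnegative.
            ... | false = ≤-respˡ-≈ (sym (zeroˡ _)) (*-nonneg (outcomeProbability-nonneg A (concat xs) k)
                (nonneg k))
            ... | true  = *-monoˡ-≤ (outcomeProbability-nonneg A (concat xs) k) (begin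
              half^ * fromℕ (16 ℕ.^ n′)                  ≤⟨ *-monoˡ-≤ 0≤half^
                  (fromℕ-mono-≤ (thresholdFactors-few-errors f d (output k) xs (right k (lookup⇒[]= k S eq)))) ⟩
              half^ * fromℕ (2 ℕ.^ t ℕ.* F)              ≈⟨ *-congˡ (fromℕ-* (2 ℕ.^ t) F) ⟩
              half^ * (fromℕ (2 ℕ.^ t) * fromℕ F)        ≈⟨ trans (sym (*-assoc _ _ _))
                  (trans (*-congʳ (trans (*-comm _ _) half^-inverse)) (*-identityˡ _)) ⟩
              fromℕ F                                    ≈⟨ sym (factors-threshold f d splittings (output k) xs) ⟩
              factors cs (output k) xs                   ∎)
              where F = thresholdFactors f d (output k) xs
          averaged-scaled : δ * fromℕ (16 ℕ.^ n′) ≤ fromℕ (2 ℕ.^ t) * fromℕ (4 ℕ.^ κ ℕ.* bounds cs)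
          averaged-scaled = ≤-respˡ-≈ (trans (sym (*-assoc _ _ _)) (trans (*-congʳ half^-inverse) (*-identityˡ _)))
            (*-monoˡ-≤ (0≤fromℕ (2 ℕ.^ t)) (averaged cs output probability (probability-low A) below pointwise))

-- The three tasks

reciprocal-positive : (R : Reals) → let open Reals R; open RealNotions R in
  ∀ n .{{_ : ℕ.NonZero n}} → 0# < 1/ n
reciprocal-positive R (suc n) = inverse-positive (0<fromℕ n) (1/-inverse (suc n))
  where
  open RealNotions R
  open Functionals R

module FewErrors (R : Reals) where

  open Reals R hiding (zero)
  open RealNotions R
  open OrderedField R

  -- The number of errors is at most β n = n/h² ≤ n′/h. Clearing h² makes this an inequality of
  -- natural numbers, and the quotient may then be rounded down.
  few-errors : ∀ h n n′ g {β} .{{_ : ℕ.NonZero h}} → fromℕ (h ℕ.* h) * β ≈ 1# →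
    (1# - β) * fromℕ n ≤ fromℕ g → n ℕ.≤ h ℕ.* n′ → n ℕ.≤ g ℕ.+ n′ ℕ./ h
  few-errors h n n′ g {β} Hβ≈1 le n≤ = ℕ.≤-trans (ℕ.m≤n+m∸n n g) (ℕ.+-monoʳ-≤ g e≤)
    where
    H = h ℕ.* h
    e = n ℕ.∸ g
    Hn≤ : H ℕ.* n ℕ.≤ H ℕ.* g ℕ.+ n
    Hn≤ = fromℕ-cancel-≤ (begin
      fromℕ (H ℕ.* n)                                   ≈⟨ fromℕ-* H n ⟩
      fromℕ H * fromℕ n                                 ≈⟨ solve 3
          (λ H β n → H :* n := H :* ((con (+ 1) :- β) :* n) :+ H :* β :* n) refl (fromℕ H) β (fromℕ n) ⟩
      fromℕ H * ((1# - β) * fromℕ n) + fromℕ H * β * fromℕ n ≤⟨ +-mono-≤ (*-monoˡ-≤ (0≤fromℕ H) le)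
          (≤-reflexive (trans (*-congʳ Hβ≈1) (*-identityˡ _))) ⟩
      fromℕ H * fromℕ g + fromℕ n                       ≈⟨ sym
          (trans (fromℕ-+ (H ℕ.* g) n) (+-congʳ (fromℕ-* H g))) ⟩
      fromℕ (H ℕ.* g ℕ.+ n)                             ∎)
      where open ≤-Reasoning
    He≤n : H ℕ.* e ℕ.≤ n
    He≤n = ℕ.≤-trans (ℕ.≤-reflexive (ℕ.*-distribˡ-∸ H n g)) (ℕ.≤-trans (ℕ.∸-monoˡ-≤ (H ℕ.* g) Hn≤)
      (ℕ.≤-reflexive (ℕ.m+n∸m≡n (H ℕ.* g) n)))
    he≤n′ : h ℕ.* e ℕ.≤ n′
    he≤n′ = ℕ.*-cancelˡ-≤ h (ℕ.≤-trans (ℕ.≤-reflexive (≡.sym (ℕ.*-assoc h h e))) (ℕ.≤-trans He≤n n≤))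
    e≤ : e ℕ.≤ n′ ℕ./ h
    e≤ = ℕ.≤-trans (ℕ.≤-reflexive (≡.sym (ℕ.m*n/n≡m e h)))
        (ℕ./-monoˡ-≤ h (ℕ.≤-trans (ℕ.≤-reflexive (ℕ.*-comm e h)) he≤n′))

module Tasks (R : Reals) where

  open Reals R hiding (zero)
  open RealNotions R
  open OrderedField R
  open Bounds R
  open FewErrors R

  module _ (c β : Carrier) (Qc≈1 : fromℕ costFactor * c ≈ 1#) (Hβ≈1 : fromℕ (100 ℕ.* 100) * β ≈ 1#) (0<β : 0# < β)
    {n m : ℕ} (1≤n : 1 ℕ.≤ n) (f : Fin n → BoolFun m) (d : Fin n → ℕ)
        (approx : ∀ i → IsApproxDegree (1/ 5) (f i) (d i))
    {μ : ℕ} (min : IsMinSubsetSum ⌈0·99 n ⌉ d μ) {δ : Carrier} (δ≈ : δ ≈2^ (- (c * fromℕ n))) (T : ℕ) where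

    0≤δ : 0# ≤ δ
    0≤δ = <⇒≤ (proj₁ δ≈)

    xor-task : (A : QueryAlgorithm Sign (n ℕ.* m) T) →
      (∀ x → OutputProbabilityAtLeast (1/ 2 + δ) A (concat x) (λ z → z ≡ ⨂ f x)) → c * fromℕ μ ≤ fromℕ T
    xor-task A correct lt = setup f d T Qc≈1 1≤n approx min lt λ S →
      refute f d T Qc≈1 S δ≈ {0} ℕ.z≤n (xor-bound f d T S A 0≤δ correct)

    threshold-task : (A : QueryAlgorithm (Vec Sign n) (n ℕ.* m) T) →
      (∀ x → OutputProbabilityAtLeast δ A (concat x) (λ z → (1# - β) * fromℕ n ≤ fromℕ
          (agreements z (values f x)))) →
      c * fromℕ μ ≤ fromℕ T
    threshold-task A correct lt = setup f d T Qc≈1 1≤n approx min lt λ S → let open Setup S in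
      refute f d T Qc≈1 S δ≈ {n′ ℕ./ 100}
        (ℕ.≤-trans (ℕ.≤-reflexive (ℕ.*-comm 100 (n′ ℕ./ 100))) (ℕ.m/n*n≤m n′ 100))
        (threshold-bound f d T S A 0≤δ {n′ ℕ./ 100} (λ x → let (O , right , δ≤) = correct x in
          O , (λ k k∈O → few-errors 100 n n′ (agreements (QueryAlgorithm.output A k) (values f x)) Hβ≈1
              (right k k∈O) many) , δ≤))

    -- A fully correct vector agrees in all n places, hence in at least (1 - β)n, so this is an
    -- instance of the threshold task.
    vector-task : (A : QueryAlgorithm (Vec Sign n) (n ℕ.* m) T) →
      (∀ x → OutputProbabilityAtLeast δ A (concat x) (λ z → z ≡ values f x)) → c * fromℕ μ ≤ fromℕ T
    vector-task A correct = threshold-task A λ x → let (O , right , δ≤) = correct x in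
      O , (λ k k∈O → ≡.subst (λ z → (1# - β) * fromℕ n ≤ fromℕ (agreements z (values f x))) (≡.sym (right k k∈O))
        (≡.subst (λ g → (1# - β) * fromℕ n ≤ fromℕ g) (≡.sym (agreements-self (values f x))) all)) , δ≤
      where
      all : (1# - β) * fromℕ n ≤ fromℕ n
      all = 0≤⇒≤ (≤-respʳ-≈ (solve 2 (λ β n → β :* n := n :- (con (+ 1) :- β) :* n) refl β (fromℕ n))
        (*-nonneg (<⇒≤ 0<β) (0≤fromℕ n)))


theorem1p5 : (R : Reals) → let open Reals R in let open RealNotions R in
    ∃[ c ] ∃[ β ] 0# < c × 0# < β ×
    (∀ (n m : ℕ) → 1 ℕ.≤ n → 1 ℕ.≤ m →
    (f : Fin n → BoolFun m) →
    (d : Fin n → ℕ) → (∀ i → IsApproxDegree (1/ 5) (f i) (d i)) →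
    (μ : ℕ) → IsMinSubsetSum ⌈0·99 n ⌉ d μ →
    (δ : Carrier) → δ ≈2^ (- (c * fromℕ n)) →
    (∀ (T : ℕ) (A : QueryAlgorithm Sign (n ℕ.* m) T) →
    (∀ (x : Vec (Vec Sign m) n) →
    OutputProbabilityAtLeast (1/ 2 + δ) A (concat x) (λ z → z ≡ ⨂ f x)) →
    c * fromℕ μ ≤ fromℕ T)
    × (∀ (T : ℕ) (A : QueryAlgorithm (Vec Sign n) (n ℕ.* m) T) →
    (∀ (x : Vec (Vec Sign m) n) →
    OutputProbabilityAtLeast δ A (concat x) (λ z → z ≡ values f x)) →
    c * fromℕ μ ≤ fromℕ T)
    × (∀ (T : ℕ) (A : QueryAlgorithm (Vec Sign n) (n ℕ.* m) T) →
    (∀ (x : Vec (Vec Sign m) n) →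
    OutputProbabilityAtLeast δ A (concat x)
    (λ z → (1# - β) * fromℕ n ≤ fromℕ (agreements z (values f x)))) →
    c * fromℕ μ ≤ fromℕ T))
theorem1p5 R = c , β , reciprocal-positive R costFactor , reciprocal-positive R (100 ℕ.* 100) ,
  λ n m 1≤n _ f d approx μ min δ δ≈ →
    (λ T → xor-task c β Qc≈1 Hβ≈1 0<β 1≤n f d approx min δ≈ T) ,
    (λ T → vector-task c β Qc≈1 Hβ≈1 0<β 1≤n f d approx min δ≈ T) ,
    (λ T → threshold-task c β Qc≈1 Hβ≈1 0<β 1≤n f d approx min δ≈ T)
  where
  open RealNotions R
  open Tasks R
  c = 1/ costFactor
  -- One factor 100 passes from `n` to the number `n′` of active functions, the other leaves at most
  -- `n′ / 100` errors, as `refute` demands.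
  β = 1/ (100 ℕ.* 100)
  Qc≈1 = 1/-inverse costFactor
  Hβ≈1 = 1/-inverse (100 ℕ.* 100)
  0<β = reciprocal-positive R (100 ℕ.* 100)
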